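{- Let $l\ge 1$ be an odd integer. Let $2<p<q$ be primes such that $q\geq \frac{(p+l)p}{2}$ and $(l+2)q\equiv 2 \pmod p$. Let $\rho,\sigma$ be the unique non-negative integers with $1+pq=(\rho+1)p+(\sigma+1)q$. Write $\rho=\frac{(p+l)s}{2}+\tau$ with integers $s\ge 0$ and $0\le\tau<\frac{p+l}{2}$ (so $s=\lfloor 2\rho/(p+l)\rfloor$). Let $r_1,r_2>pq$ be primes such that $r_1(q-sp)\equiv -1\pmod{pq}$ and $r_2\equiv -r_1\pmod{pq}$. Put $\alpha_1^+=\frac{(p+l)q}{2}$ and $\alpha_1^-=(\rho+s)p-q$, and define $$u_1^+=(\rho-\tau)p,\quad u_1^-=-\frac{(p-l-2)q}{2}+((p-1)s+\tau)p,$$ $$u_2^+=(p-1)q-\frac{(p-l-2)sp}{2},\quad u_2^-=\frac{(p+l)q}{2}+\tau p,$$ $$t_1^{+}=\Big\lfloor\frac{(\alpha_1^+-u_1^+)r_1}{pq}\Big\rfloor+1,\quad t_1^{ - }=\Big\lfloor\frac{(\alpha_1^--u_1^-)r_1}{pq}\Big\rfloor+1,$$ $$t_2^{+}=\Big\lfloor\frac{(\alpha_1^+-u_2^+)r_2}{pq}\Big\rfloor+1,\quad t_2^{ - }=\Big\lfloor\frac{(\alpha_1^--u_2^-)r_2}{pq}\Big\rfloor+1,$$ and $$k_1^+=r_1u_1^++t_1^+pq,\ k_1^-=r_1u_1^-+t_1^-pq,\ k_2^+=r_2u_2^++t_2^+pq,\ k_2^-=r_2u_2^-+t_2^-pq.$$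 Let $w$ be the integer with $0\le w\le p-1$ and $w(l+2)\equiv 2\pmod p$. (i) If $l+2\le w\le \frac{p-l-2}{2}$, then $a_{pqr_1}(k_1^-)=-\frac{p-l-2}{2}$, $a_{pqr_1}(k_1^+)=\frac{p+l+2}{2}$, and $\{a_{pqr_1}(k):k\ge 0\}$ is the set of all integers in $[-\frac{p-l-2}{2},\frac{p+l+2}{2}]$. (ii) If $\frac{p+l+2}{2}\le w\le p-l-2$, then $a_{pqr_2}(k_2^-)=-\frac{p-l-2}{2}$, $a_{pqr_2}(k_2^+)=\frac{p+l+2}{2}$, and $\{a_{pqr_2}(k):k\ge 0\}$ is the set of all integers in $[-\frac{p-l-2}{2},\frac{p+l+2}{2}]$. In both cases (i) and (ii), $M(p;q)=\frac{p+l+2}{2}<\frac{2p}{3}$.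
   Context: For a positive integer $n$, the $n$-th cyclotomic polynomial is $\Phi_n(x)=\prod_{1\le j\le n,\ \gcd(j,n)=1}(x-e^{2\pi i j/n})=\sum_{k=0}^{\varphi(n)}a_n(k)x^k$, with $a_n(k)=0$ for $k>\varphi(n)$ (and for $k<0$). $A(n)=\max\{|a_n(k)|:k\ge0\}$. For primes $p<q$, $M(p;q)=\max\{A(pqr): r \text{ prime}, r>q\}$. $\lfloor x\rfloor$ denotes the largest integer $\le x$. -}

module Defs where

open import Data.Nat as ℕ using (ℕ; zero; suc; _⊔_)
open import Data.Nat.Divisibility using (_∣?_)
open import Data.Nat.Primality using (Prime)
open import Data.Integer as ℤ using (ℤ; +_; -[1+_]; ∣_∣; _/ℕ_)
open import Data.List using (List; []; _∷_; _++_; replicate; length; map; foldr; upTo)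
open import Data.Product using (Σ; _×_; ∃)
open import Relation.Nullary using (yes; no)
open import Relation.Binary.PropositionalEquality using (_≡_)

-- Integer polynomials as coefficient lists, lowest degree first:
-- (c₀ ∷ c₁ ∷ …) represents c₀ + c₁ x + ….

Poly : Set
Poly = List ℤ

infixl 6 _+ₚ_ _-ₚ_
infixl 7 _*ₚ_

_+ₚ_ : Poly → Poly → Poly
[]       +ₚ q        = q
(a ∷ p)  +ₚ []       = a ∷ p
(a ∷ p)  +ₚ (b ∷ q)  = (a ℤ.+ b) ∷ (p +ₚ q)

scaleₚ : ℤ → Poly → Poly
scaleₚ c = map (c ℤ.*_)

_-ₚ_ : Poly → Poly → Poly
p -ₚ q = p +ₚ scaleₚ (ℤ.- (+ 1)) q

_*ₚ_ : Poly → Poly → Poly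
[]      *ₚ q = []
(a ∷ p) *ₚ q = scaleₚ a q +ₚ ((+ 0) ∷ (p *ₚ q))

coeffₚ : Poly → ℕ → ℤ
coeffₚ []      k       = + 0
coeffₚ (a ∷ p) zero    = a
coeffₚ (a ∷ p) (suc k) = coeffₚ p k

headₚ : Poly → ℤ
headₚ p = coeffₚ p 0

tailₚ : Poly → Poly
tailₚ []      = []
tailₚ (_ ∷ p) = p

-- First N coefficients of the power series A / B, assuming the constant
-- term b₀ of B is a unit (±1), so that 1/b₀ = b₀.
-- For a monic-up-to-sign exact division A = B·C with deg C < N this is C.
divSeries : ℕ → Poly → Poly → Poly
divSeries zero    A B = []
divSeries (suc N) A B =
  let c = headₚ B ℤ.* headₚ A in
  c ∷ divSeries N (tailₚ (A -ₚ scaleₚ c B)) B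

-- x^m - 1 (for m ≥ 1)
xPowMinusOne : ℕ → Poly
xPowMinusOne m = ℤ.- (+ 1) ∷ (replicate (m ℕ.∸ 1) (+ 0) ++ ((+ 1) ∷ []))

nthₚ : List Poly → ℕ → Poly
nthₚ []       k       = (+ 1) ∷ []
nthₚ (p ∷ ps) zero    = p
nthₚ (p ∷ ps) (suc k) = nthₚ ps k

-- product of Φ_d over the proper divisors d of m (1 ≤ d < m), given the
-- table T = [Φ₁, …, Φ_{m-1}]
properDivProd : ℕ → List Poly → Poly
properDivProd m T = go (upTo m)
  where
  go : List ℕ → Poly
  go []       = (+ 1) ∷ []
  go (i ∷ is) with suc i ∣? m
  ... | yes _ = nthₚ T i *ₚ go is
  ... | no  _ = go is

-- Φ_m = (x^m - 1) / ∏_{d ∣ m, d < m} Φ_d   (exact division)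
nextCyclo : ℕ → List Poly → Poly
nextCyclo m T =
  let D = properDivProd m T in
  divSeries (suc m ℕ.∸ (length D ℕ.∸ 1)) (xPowMinusOne m) D

cycloTable : ℕ → List Poly
cycloTable zero    = []
cycloTable (suc n) = let T = cycloTable n in T ++ (nextCyclo (suc n) T ∷ [])

-- The n-th cyclotomic polynomial (n ≥ 1); Φ₀ is a dummy value.
Φ : ℕ → Poly
Φ n = nthₚ (cycloTable n) (n ℕ.∸ 1)

a : ℕ → ℤ → ℤ
a n (+ k)      = coeffₚ (Φ n) k
a n -[1+ _ ]   = + 0

A : ℕ → ℕ
A n = foldr _⊔_ 0 (map ∣_∣ (Φ n))

-- "M(p;q) = m", where M(p;q) = max { A(pqr) : r prime, r > q }:
-- m is an upper bound attained by some prime r > q.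
MEquals : ℕ → ℕ → ℕ → Set
MEquals p q m =
  ((r : ℕ) → Prime r → q ℕ.< r → A (p ℕ.* q ℕ.* r) ℕ.≤ m)
  × (∃ λ r → Prime r × q ℕ.< r × A (p ℕ.* q ℕ.* r) ≡ m)

fdiv : ℤ → ℕ → ℤ
fdiv x zero    = + 0
fdiv x (suc d) = x /ℕ suc d

half : ℤ → ℤ
half x = fdiv x 2

modℕ : ℕ → ℕ → ℕ
modℕ x zero    = x
modℕ x (suc n) = x ℕ.% suc n

{-
Write Φ_pqr(x) = Φ_pq(x^r) (1 + x + … + x^(p-1)) (1 - x^q) / (1 - x^(pq)).  Its k-th coefficient is the sum over
0 ≤ m < p of S(k - m) - S(k - m - q), where S is the coefficient sequence of Φ_pq(x^r) / (1 - x^(pq)).  In the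
coordinates t = r (p x + q y) + p q z, with 0 ≤ x < q and 0 ≤ y < p, the sequence S is explicit, because Φ_pq has
coefficient 1 on the box x ≤ ρ, y ≤ σ and -1 on the opposite box x > ρ, y > σ.

Along the window m = 0, …, p - 1 the coordinate y takes every value once, and subtracting q changes only y.  Pairing
the two terms of index m, row y contributes E(y) or E(y) - 1 to every coefficient, with E independent of k.  So all
coefficients lie in [U - p, U], and counting the rows with E = 1 gives that U and p - U are at most
max(σ + 1, p - σ - 1), which is (p + l + 2)/2 here; this holds for every prime r > q.  Two consecutive coefficients
differ by a second difference of S over a lattice rectangle, hence by at most 1, so every value between two attained
ones is attained.

For r₁ and r₂ one step of the window is (∓s, ±1) in the (x, y)-plane.  At k⁺ the p points of the window include the
diagonal ((σ - n) s, n), n ≤ σ, of the positive box, entirely below the threshold, and no other point of either sum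
counts; this gives σ + 1.  At k⁻ the roles of the two boxes are exchanged, which gives -(p - σ - 1).
-}
module Submission where

import Defs
open import Algebra.Bundles using (CommutativeMonoid)
open import Data.Integer as ℤ using (ℤ; +_; -[1+_]; +≤+; -<+; ∣_∣; +<+; -≤-)
open import Data.Integer.DivMod using (a≡a%ℕn+[a/ℕn]*n; n%ℕd<d)
open import Data.Integer.Divisibility.Signed using (∣ᵤ⇒∣; divides)
open import Data.Integer.Tactic.RingSolver using (solve-∀)
open import Data.List using ([]; _∷_; _++_; replicate; length; foldr; map; applyUpTo; upTo; List; filter)
open import Data.List.Membership.Propositional using (_∈_)
open import Data.List.Membership.Propositional.Properties
  using (∈-applyUpTo⁺; ∈-applyUpTo⁻; ∈-upTo⁺; ∈-upTo⁻; ∈-map⁺; ∈-map⁻; ∈-++⁺ˡ; ∈-++⁺ʳ; ∈-++⁻; ∈-filter⁺; ∈-filter⁻)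
open import Data.List.Membership.Propositional.Properties.WithK using (unique∧set⇒bag)
open import Data.List.Properties using (length-map; map-applyUpTo; map-∘; length-++; filter-accept; filter-reject)
open import Data.List.Relation.Binary.BagAndSetEquality using (∼bag⇒↭)
open import Data.List.Relation.Binary.Permutation.Propositional using (_↭_; ↭⇒↭ₛ; ↭-sym; ↭⇒↭ₛ′)
open import Data.List.Relation.Binary.Permutation.Propositional.Properties as Perm using (All-resp-↭)
open import Data.List.Relation.Unary.All using (All; []; _∷_)
open import Data.List.Relation.Unary.AllPairs using ([]; _∷_)
open import Data.List.Relation.Unary.Any using (here; there)
open import Data.List.Relation.Unary.Unique.Propositional using (Unique)
open import Data.Nat as ℕ using (ℕ; zero; suc; pred)
open import Data.Nat.Coprimality as Coprimality using (Coprime; coprime-divisor; coprime-Bézout)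
open import Data.Nat.GCD using (module Bézout)
open import Data.Nat.ListAction using (sum)
open import Data.Nat.ListAction.Properties using (sum-↭)
open import Data.Nat.Primality using (Prime; prime⇒irreducible; prime⇒nonZero; prime⇒nonTrivial; euclidsLemma)
open import Data.Product using (_,_; _×_; ∃; proj₁; proj₂; ∃₂)
open import Data.Sum using (inj₁; inj₂; _⊎_)
open import Function using (_∋_; _∘_; mk⇔; _⇔_)
open import Level using (0ℓ)
open import Relation.Binary.PropositionalEquality
  using (_≡_; refl; trans; cong; subst; sym; cong₂; _≗_; module ≡-Reasoning; _≢_; subst₂)
open import Relation.Nullary using (¬_; contradiction; Dec; yes; no)
import Data.Nat.Properties as ℕ
import Data.Integer.Properties as ℤ
import Data.List.Relation.Unary.Unique.Propositional.Properties as Unique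
import Data.List.Relation.Binary.Permutation.Setoid.Properties as PermSetoid
import Data.Nat.Divisibility as ℕ
import Algebra.Solver.CommutativeMonoid
import Data.Nat.DivMod as ℕ
open import Data.Nat.Tactic.RingSolver using () renaming (solve-∀ to ℕ-solve-∀)

-- Where the constants come from. Modulo `p`, `q (σ + 1) ≡ 1` and `(l + 2) q ≡ 2` give
-- `2 (σ + 1) ≡ l + 2`, and size and parity leave only `2 (σ + 1) = p + l + 2`. Call `p x + q y`,
-- less `p q` in the opposite box, the weight of a point. One step of the diagonal changes it by
-- `h = q - s p > 0`. Hence `σ q` is the greatest weight on the diagonal of the positive box, and
-- `(ρ + s) p - q = ρ p - h` the greatest one among the points met in the opposite box at k⁻. The
-- subtracted sum sits `v` rows higher, cyclically, where `v ≡ -1/r` modulo `p`; this is `w` for r₁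
-- and `p - w` for r₂. Its points must exceed the threshold, which asks for `v q > σ h`. As `σ h =
-- (l + 1) q + (p - 1) + τ p < (l + 2) q`, it is enough that `v ≥ l + 2`, while `v ≤ (p - l - 2) /
-- 2` keeps the raised rows of the positive box from wrapping around. No roots of unity occur: the
-- closed form of Φ_pqr is verified after multiplication by factors x^m - 1, whose constant term -1
-- makes them cancellable on sequences supported on the nonnegative integers.

-- Certificates for integer arithmetic, residues, Iverson brackets.

module Lin where

  open import Data.Integer using (_+_; _*_; _-_; -_; _≤_; _<_)

  -- Certificates: an equation or inequality follows from hypotheses a ≡ b, 0 ≤ d through a ring identity.
  by-≡ : ∀ {x y a b : ℤ} c → a ≡ b → x ≡ y + (a - b) * c → x ≡ y
  by-≡ {y = y} {a} c refl eq = trans eq (((∀ y a c → y + (a - a) * c ≡ y) ∋ solve-∀) y a c)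

  by-≤ : ∀ {x y d : ℤ} → + 0 ≤ d → y ≡ x + d → x ≤ y
  by-≤ {x} 0≤d refl = subst (_≤ x + _) (ℤ.+-identityʳ x) (ℤ.+-monoʳ-≤ x 0≤d)

  by-< : ∀ {x y d : ℤ} → + 0 ≤ d → y ≡ x + + 1 + d → x < y
  by-< {x} {y} 0≤d eq = ℤ.suc[i]≤j⇒i<j (by-≤ 0≤d (trans eq (cong (_+ _) (ℤ.+-comm x (+ 1)))))

  gap : ∀ {x y} → x ≤ y → + 0 ≤ y - x
  gap = ℤ.i≤j⇒0≤j-i

  gap< : ∀ {x y} → x < y → + 0 ≤ y - x - + 1
  gap< {x} {y} x<y = subst (+ 0 ≤_) (((∀ x y → y - (+ 1 + x) ≡ y - x - + 1) ∋ solve-∀) x y) (gap (ℤ.i<j⇒suc[i]≤j x<y))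

  ≡⇒≤ : ∀ {x y : ℤ} → x ≡ y → x ≤ y
  ≡⇒≤ refl = ℤ.≤-refl

  infixl 6 _⊕_
  infixl 7 _⊗_

  _⊕_ : ∀ {x y} → + 0 ≤ x → + 0 ≤ y → + 0 ≤ x + y
  _⊕_ = ℤ.+-mono-≤

  _⊗_ : ∀ {x y} → + 0 ≤ x → + 0 ≤ y → + 0 ≤ x * y
  _⊗_ {+ m} {+ n} _ _ = subst (+ 0 ≤_) (ℤ.pos-* m n) (+≤+ ℕ.z≤n)

  0≤+ : ∀ n → + 0 ≤ + n
  0≤+ n = +≤+ ℕ.z≤n

  pos-pred : ∀ {n} → 0 ℕ.< n → + pred n ≡ + n - + 1
  pos-pred {suc n} _ = refl

  -- Congruences are carried as equations with an explicit quotient `M`, so that the ring solver can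
  -- combine them. A nonzero `M` would push one of the two residues up to `q` or beyond.
  residue-unique : ∀ {q x x′} M → x ℕ.< q → x′ ℕ.< q → + x - + x′ ≡ + q * M → x ≡ x′
  residue-unique {q} {x} {x′} (+ zero) _ _ eq = ℤ.+-injective (ℤ.i-j≡0⇒i≡j (+ x) (+ x′) (trans eq (ℤ.*-zeroʳ (+ q))))
  residue-unique {q} {x} {x′} (+ suc m) x<q _ eq = contradiction x<q (ℕ.≤⇒≯ (ℤ.drop‿+≤+ {q} {x}
    (by-≤ (0≤+ x′ ⊕ 0≤+ q ⊗ 0≤+ m)
    (by-≡ (+ 1) eq (((∀ q x x′ m → x ≡ q + (x′ + q * m) + (x - x′ - q * (+ 1 + m)) * + 1) ∋ solve-∀) (+ q) (+ x)
      (+ x′) (+ m))))))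
  residue-unique {q} {x} {x′} -[1+ m ] _ x′<q eq = contradiction x′<q (ℕ.≤⇒≯ (ℤ.drop‿+≤+ {q} {x′}
    (by-≤ (0≤+ x ⊕ 0≤+ q ⊗ 0≤+ m)
    (by-≡ (- + 1) eq (((∀ q x x′ m → x′ ≡ q + (x + q * m) + (x - x′ - q * (- (+ 1 + m))) * - + 1) ∋ solve-∀) (+ q)
      (+ x) (+ x′) (+ m))))))

  -- In Iverson brackets: b z = [z ≥ 0], le x n = [x ≤ n], eq x n = [x = n].
  b : ℤ → ℤ
  b (+ _)    = + 1
  b -[1+ _ ] = + 0

  b-yes : ∀ {z} → + 0 ≤ z → b z ≡ + 1
  b-yes (+≤+ _) = refl

  b-no : ∀ {z} → z < + 0 → b z ≡ + 0
  b-no -<+ = refl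

  le : ℕ → ℕ → ℤ
  le zero    n       = + 1
  le (suc x) zero    = + 0
  le (suc x) (suc n) = le x n

  eq : ℕ → ℕ → ℤ
  eq zero    zero    = + 1
  eq zero    (suc n) = + 0
  eq (suc x) zero    = + 0
  eq (suc x) (suc n) = eq x n

  le-yes : ∀ {x n} → x ℕ.≤ n → le x n ≡ + 1
  le-yes ℕ.z≤n       = refl
  le-yes (ℕ.s≤s x≤n) = le-yes x≤n

  le-no : ∀ {x n} → n ℕ.< x → le x n ≡ + 0
  le-no {suc x} {zero}  _           = refl
  le-no {suc x} {suc n} (ℕ.s≤s n<x) = le-no n<x

  le-step : ∀ x n → le x n - le (suc x) n ≡ eq x n
  le-step zero    zero    = refl
  le-step zero    (suc n) = refl
  le-step (suc x) zero    = refl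
  le-step (suc x) (suc n) = le-step x n

  eq-refl : ∀ n → eq n n ≡ + 1
  eq-refl zero    = refl
  eq-refl (suc n) = eq-refl n

  eq-≢ : ∀ {x n} → ¬ x ≡ n → eq x n ≡ + 0
  eq-≢ {zero}  {zero}  ne = contradiction refl ne
  eq-≢ {zero}  {suc n} ne = refl
  eq-≢ {suc x} {zero}  ne = refl
  eq-≢ {suc x} {suc n} ne = eq-≢ λ e → ne (cong suc e)

-- Polynomials acting on two-sided integer sequences.

module Series where

  open import Defs
  open import Data.Integer using (_+_; _*_; _-_; -_; _≤_; _<_)

  Seq : Set
  Seq = ℤ → ℤ

  δ : Seq
  δ (+ zero)  = + 1
  δ (+ suc _) = + 0
  δ -[1+ _ ]  = + 0

  -- Multiplication of the formal series with coefficients `f` by a polynomial. Indexing by all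
  -- integers makes shifts total, so polynomials act as commuting operators without boundary terms.
  act : Poly → Seq → Seq
  act []      f k = + 0
  act (c ∷ P) f k = c * f k + act P f (k - + 1)

  Causal : Seq → Set
  Causal f = ∀ n → f -[1+ n ] ≡ + 0

  δ-causal : Causal δ
  δ-causal _ = refl

  act-cong : ∀ P {f g} → f ≗ g → act P f ≗ act P g
  act-cong []      f≗g k = refl
  act-cong (c ∷ P) f≗g k = cong₂ (λ x y → c * x + y) (f≗g k) (act-cong P f≗g (k - + 1))

  act-+ : ∀ P Q f k → act (P +ₚ Q) f k ≡ act P f k + act Q f k
  act-+ []      Q       f k = sym (ℤ.+-identityˡ _)
  act-+ (c ∷ P) []      f k = sym (ℤ.+-identityʳ _)
  act-+ (c ∷ P) (d ∷ Q) f k rewrite act-+ P Q f (k - + 1) =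
    ((∀ c d x u v → (c + d) * x + (u + v) ≡ (c * x + u) + (d * x + v)) ∋ solve-∀) c d (f k) _ _

  act-scale : ∀ c P f k → act (scaleₚ c P) f k ≡ c * act P f k
  act-scale c []      f k = sym (ℤ.*-zeroʳ c)
  act-scale c (d ∷ P) f k rewrite act-scale c P f (k - + 1) =
    ((∀ c d x u → c * d * x + c * u ≡ c * (d * x + u)) ∋ solve-∀) c d (f k) _

  act-* : ∀ P Q f k → act (P *ₚ Q) f k ≡ act P (act Q f) k
  act-* []      Q f k = refl
  act-* (c ∷ P) Q f k
    rewrite act-+ (scaleₚ c Q) (+ 0 ∷ P *ₚ Q) f k | act-scale c Q f k | act-* P Q f (k - + 1) =
    cong (_+_ (c * act Q f k)) (ℤ.+-identityˡ _)

  act-lin : ∀ P c f g k → act P (λ j → c * f j + g j) k ≡ c * act P f k + act P g k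
  act-lin []      c f g k = sym (trans (ℤ.+-identityʳ _) (ℤ.*-zeroʳ c))
  act-lin (d ∷ P) c f g k rewrite act-lin P c f g (k - + 1) =
    ((∀ c d x y u v → d * (c * x + y) + (c * u + v) ≡ c * (d * x + u) + (d * y + v)) ∋ solve-∀)
      c d (f k) (g k) _ _

  act-shift : ∀ P f k → act P (λ j → f (j - + 1)) k ≡ act P f (k - + 1)
  act-shift []      f k = refl
  act-shift (c ∷ P) f k = cong (_+_ (c * f (k - + 1))) (act-shift P f (k - + 1))

  act-zero : ∀ P k → act P (λ _ → + 0) k ≡ + 0
  act-zero []      k = refl
  act-zero (c ∷ P) k = cong₂ _+_ (ℤ.*-zeroʳ c) (act-zero P (k - + 1))

  act-comm : ∀ P Q f → act P (act Q f) ≗ act Q (act P f)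
  act-comm []      Q f k = sym (act-zero Q k)
  act-comm (c ∷ P) Q f k = sym (begin
    act Q (λ j → c * f j + act P f (j - + 1)) k         ≡⟨ act-lin Q c f _ k ⟩
    c * act Q f k + act Q (λ j → act P f (j - + 1)) k   ≡⟨ cong (_+_ (c * act Q f k)) (act-shift Q _ k) ⟩
    c * act Q f k + act Q (act P f) (k - + 1)           ≡⟨ cong (_+_ (c * act Q f k)) (act-comm P Q f (k - + 1)) ⟨
    c * act Q f k + act P (act Q f) (k - + 1)           ∎)
    where open ≡-Reasoning

  act-causal : ∀ P {f} → Causal f → Causal (act P f)
  act-causal []      f0 n = refl
  act-causal (c ∷ P) f0 n = cong₂ _+_ (trans (cong (c *_) (f0 n)) (ℤ.*-zeroʳ c)) (act-causal P f0 _)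

  act-δ : ∀ P k → act P δ (+ k) ≡ coeffₚ P k
  act-δ []      k       = refl
  act-δ (c ∷ P) zero    = trans (cong₂ _+_ (ℤ.*-identityʳ c) (act-causal P δ-causal 0)) (ℤ.+-identityʳ c)
  act-δ (c ∷ P) (suc k) = trans (cong₂ _+_ (ℤ.*-zeroʳ c) (act-δ P k)) (ℤ.+-identityˡ _)

  infix 4 _≈ₚ_

  -- Coefficientwise, because sums and products of lists may carry trailing zeros.
  _≈ₚ_ : Poly → Poly → Set
  P ≈ₚ Q = ∀ k → coeffₚ P k ≡ coeffₚ Q k

  act-≈ : ∀ P Q → P ≈ₚ Q → ∀ f → act P f ≗ act Q f
  act-≈ []      []      eq f k = refl
  act-≈ []      (d ∷ Q) eq f k = cong₂ (λ x y → x * f k + y) (eq 0) (act-≈ [] Q (eq ∘ suc) f (k - + 1))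
  act-≈ (c ∷ P) []      eq f k = cong₂ (λ x y → x * f k + y) (eq 0) (act-≈ P [] (eq ∘ suc) f (k - + 1))
  act-≈ (c ∷ P) (d ∷ Q) eq f k = cong₂ (λ x y → x * f k + y) (eq 0) (act-≈ P Q (eq ∘ suc) f (k - + 1))

  δ⇒≈ : ∀ P Q → act P δ ≗ act Q δ → P ≈ₚ Q
  δ⇒≈ P Q eq k = trans (sym (act-δ P k)) (trans (eq (+ k)) (act-δ Q k))

  act⇒≈ : ∀ P Q → (∀ f → act P f ≗ act Q f) → P ≈ₚ Q
  act⇒≈ P Q eq = δ⇒≈ P Q (eq δ)

  1ₚ : Poly
  1ₚ = + 1 ∷ []

  act-1 : ∀ f → act 1ₚ f ≗ f
  act-1 f k = trans (ℤ.+-identityʳ _) (ℤ.*-identityˡ _)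

  *ₚ-commutativeMonoid : CommutativeMonoid 0ℓ 0ℓ
  *ₚ-commutativeMonoid = record
    { Carrier = Poly
    ; _≈_ = _≈ₚ_
    ; _∙_ = _*ₚ_
    ; ε = 1ₚ
    ; isCommutativeMonoid = record
      { isMonoid = record
        { isSemigroup = record
          { isMagma = record
            { isEquivalence = record
              { refl = λ _ → refl
              ; sym = λ e k → sym (e k)
              ; trans = λ e e′ k → trans (e k) (e′ k)
              }
            ; ∙-cong = λ {P} {P′} {Q} {Q′} e e′ → act⇒≈ (P *ₚ Q) (P′ *ₚ Q′) λ f k → trans (act-* P Q f k)
                (trans (act-cong P (act-≈ Q Q′ e′ f) k)
                (trans (act-≈ P P′ e (act Q′ f) k) (sym (act-* P′ Q′ f k))))
            }
          ; assoc = λ P Q R → act⇒≈ (P *ₚ Q *ₚ R) (P *ₚ (Q *ₚ R)) λ f k → trans (act-* (P *ₚ Q) R f k)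
              (trans (act-* P Q (act R f) k) (sym (trans (act-* P (Q *ₚ R) f k) (act-cong P (act-* Q R f) k))))
          }
        ; identity = idˡ , λ P k → trans (comm P 1ₚ k) (idˡ P k)
        }
      ; comm = comm
      }
    }
    where
    comm : ∀ P Q → P *ₚ Q ≈ₚ Q *ₚ P
    comm P Q = act⇒≈ (P *ₚ Q) (Q *ₚ P) λ f k → trans (act-* P Q f k) (trans (act-comm P Q f k) (sym (act-* Q P f k)))
    idˡ : ∀ P → 1ₚ *ₚ P ≈ₚ P
    idˡ P = act⇒≈ (1ₚ *ₚ P) P λ f k → trans (act-* 1ₚ P f k) (act-1 (act P f) k)

  -- Over the integers this means ±1; in this form `c` is its own inverse, which is what `divSeries`
  -- relies on.
  Unit : ℤ → Set
  Unit c = c * c ≡ + 1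

  unit-cancel : ∀ {c} → Unit c → ∀ x y → c * x ≡ c * y → x ≡ y
  unit-cancel {c} u x y eq = begin
    x            ≡⟨ ℤ.*-identityˡ x ⟨
    + 1 * x      ≡⟨ cong (_* x) u ⟨
    c * c * x    ≡⟨ ℤ.*-assoc c c x ⟩
    c * (c * x)  ≡⟨ cong (c *_) eq ⟩
    c * (c * y)  ≡⟨ ℤ.*-assoc c c y ⟨
    c * c * y    ≡⟨ cong (_* y) u ⟩
    + 1 * y      ≡⟨ ℤ.*-identityˡ y ⟩
    y            ∎
    where open ≡-Reasoning

  unit-* : ∀ {c d} → Unit c → Unit d → Unit (c * d)
  unit-* {c} {d} u v = trans (((∀ c d → c * d * (c * d) ≡ c * c * (d * d)) ∋ solve-∀) c d) (cong₂ _*_ u v)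

  +-cancelʳ : ∀ z x y → x + z ≡ y + z → x ≡ y
  +-cancelʳ z x y eq = trans (sym (plus-minus x z)) (trans (cong (_- z) eq) (plus-minus y z))
    where
    plus-minus : ∀ x z → x + z - z ≡ x
    plus-minus = solve-∀

  head-* : ∀ P Q → headₚ (P *ₚ Q) ≡ headₚ P * headₚ Q
  head-* []      Q       = refl
  head-* (c ∷ P) []      = sym (ℤ.*-zeroʳ c)
  head-* (c ∷ P) (d ∷ Q) = ℤ.+-identityʳ (c * d)

  k-1≤k : ∀ k → k - + 1 ≤ k
  k-1≤k k = ℤ.i-j≤i k (+ 1)

  act-local : ∀ P {f g} n → (∀ j → j ≤ n → f j ≡ g j) → act P f n ≡ act P g n
  act-local []      n eq = refl
  act-local (c ∷ P) n eq = cong₂ (λ x y → c * x + y) (eq n ℤ.≤-refl)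
    (act-local P (n - + 1) λ j j≤ → eq j (ℤ.≤-trans j≤ (k-1≤k n)))

  -- Cancellation: with constant term ±1, the value of `f` at `m` is determined by that of `act P f`
  -- at `m` and by earlier values of `f`. Causality starts the induction.
  act-regular : ∀ P {f g} → Unit (headₚ P) → Causal f → Causal g → act P f ≗ act P g → f ≗ g
  act-regular (c ∷ P) {f} {g} u f0 g0 eq k = agree (suc ∣ k ∣) k (bound k)
    where
    bound : ∀ k → k < + suc ∣ k ∣
    bound (+ n)     = +<+ ℕ.≤-refl
    bound -[1+ n ]  = -<+
    agree : ∀ n j → j < + n → f j ≡ g j
    agree n       -[1+ m ] _ = trans (f0 m) (sym (g0 m))
    agree (suc n) (+ m) (+<+ (ℕ.s≤s m≤n)) with ℕ.m≤n⇒m<n∨m≡n m≤n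
    ... | inj₁ m<n  = agree n (+ m) (+<+ m<n)
    ... | inj₂ refl = unit-cancel {c} u (f (+ m)) (g (+ m))
      (+-cancelʳ (act P g (+ m - + 1)) (c * f (+ m)) (c * g (+ m)) (trans
        (cong (_+_ (c * f (+ m))) (sym (act-local P (+ m - + 1) λ j j≤ → agree m j (ℤ.≤-<-trans j≤ (pred< m)))))
        (eq (+ m))))
      where
      pred< : ∀ m → + m - + 1 < + m
      pred< zero    = -<+
      pred< (suc m) = +<+ ℕ.≤-refl

  coeff-+ : ∀ P Q k → coeffₚ (P +ₚ Q) k ≡ coeffₚ P k + coeffₚ Q k
  coeff-+ []      Q       k       = sym (ℤ.+-identityˡ _)
  coeff-+ (c ∷ P) []      k       = sym (ℤ.+-identityʳ _)
  coeff-+ (c ∷ P) (d ∷ Q) zero    = refl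
  coeff-+ (c ∷ P) (d ∷ Q) (suc k) = coeff-+ P Q k

  coeff-scale : ∀ c P k → coeffₚ (scaleₚ c P) k ≡ c * coeffₚ P k
  coeff-scale c []      k       = sym (ℤ.*-zeroʳ c)
  coeff-scale c (d ∷ P) zero    = refl
  coeff-scale c (d ∷ P) (suc k) = coeff-scale c P k

  coeff-tail : ∀ P k → coeffₚ (tailₚ P) k ≡ coeffₚ P (suc k)
  coeff-tail []      k = refl
  coeff-tail (c ∷ P) k = refl

  coeff-beyond : ∀ P k → length P ℕ.≤ k → coeffₚ P k ≡ + 0
  coeff-beyond []      k       _           = refl
  coeff-beyond (c ∷ P) (suc k) (ℕ.s≤s len) = coeff-beyond P k len

  length-divSeries : ∀ N P B → length (divSeries N P B) ≡ N
  length-divSeries zero    P B = refl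
  length-divSeries (suc N) P B = cong suc (length-divSeries N _ B)

  -- If `B` times `f` is `P`, one division step peels off `f 0` and leaves the same problem for
  -- `rest`, which is `f` without its constant term, shifted down by one place.
  divSeries-correct : ∀ N P B f → Unit (headₚ B) → Causal f → (∀ k → act B f (+ k) ≡ coeffₚ P k) →
    ∀ k → k ℕ.< N → coeffₚ (divSeries N P B) k ≡ f (+ k)
  divSeries-correct (suc N) P (b ∷ B) f u f0 eq k k<N = go k k<N
    where
    open ≡-Reasoning
    rest : Seq
    rest (+ j)    = f (+ suc j)
    rest -[1+ _ ] = + 0

    split : ∀ j → f j ≡ f (+ 0) * δ j + rest (j - + 1)
    split (+ zero)  = sym (trans (ℤ.+-identityʳ _) (ℤ.*-identityʳ _))
    split (+ suc j) = sym (trans (cong (_+ f (+ suc j)) (ℤ.*-zeroʳ (f (+ 0)))) (ℤ.+-identityˡ _))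
    split -[1+ j ]  = trans (f0 j) (sym (trans (ℤ.+-identityʳ _) (ℤ.*-zeroʳ (f (+ 0)))))

    constant : coeffₚ P 0 ≡ b * f (+ 0)
    constant = begin
      coeffₚ P 0                         ≡⟨ eq 0 ⟨
      b * f (+ 0) + act B f (-[1+ 0 ])   ≡⟨ cong (_+_ (b * f (+ 0))) (act-causal B f0 0) ⟩
      b * f (+ 0) + + 0                  ≡⟨ ℤ.+-identityʳ _ ⟩
      b * f (+ 0)                        ∎

    quotient : b * headₚ P ≡ f (+ 0)
    quotient = begin
      b * coeffₚ P 0     ≡⟨ cong (b *_) constant ⟩
      b * (b * f (+ 0))  ≡⟨ ℤ.*-assoc b b _ ⟨
      b * b * f (+ 0)    ≡⟨ cong (_* f (+ 0)) u ⟩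
      + 1 * f (+ 0)      ≡⟨ ℤ.*-identityˡ _ ⟩
      f (+ 0)            ∎

    rest-eq : ∀ k → act (b ∷ B) rest (+ k) ≡ coeffₚ (tailₚ (P -ₚ scaleₚ (b * headₚ P) (b ∷ B))) k
    rest-eq k = sym (begin
      coeffₚ (tailₚ (P -ₚ scaleₚ (b * headₚ P) (b ∷ B))) k
        ≡⟨ coeff-tail (P -ₚ scaleₚ (b * headₚ P) (b ∷ B)) k ⟩
      coeffₚ (P -ₚ scaleₚ (b * headₚ P) (b ∷ B)) (suc k)
        ≡⟨ coeff-+ P _ (suc k) ⟩
      coeffₚ P (suc k) + coeffₚ (scaleₚ (- + 1) (scaleₚ (b * headₚ P) (b ∷ B))) (suc k)
        ≡⟨ cong₂ _+_ (sym (eq (suc k))) (trans (coeff-scale (- + 1) (scaleₚ (b * headₚ P) (b ∷ B)) (suc k))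
             (cong (- + 1 *_) (trans (coeff-scale (b * headₚ P) (b ∷ B) (suc k))
               (cong (_* coeffₚ B k) quotient)))) ⟩
      act (b ∷ B) f (+ suc k) + - + 1 * (f (+ 0) * coeffₚ B k)
        ≡⟨ cong (_+ - + 1 * (f (+ 0) * coeffₚ B k)) (trans (act-cong (b ∷ B) split (+ suc k))
             (trans (act-lin (b ∷ B) (f (+ 0)) δ _ (+ suc k))
               (cong₂ (λ x y → f (+ 0) * x + y) (act-δ (b ∷ B) (suc k)) (act-shift (b ∷ B) rest (+ suc k))))) ⟩
      f (+ 0) * coeffₚ B k + act (b ∷ B) rest (+ k) + - + 1 * (f (+ 0) * coeffₚ B k)
        ≡⟨ ((∀ x y → x + y + - + 1 * x ≡ y) ∋ solve-∀) (f (+ 0) * coeffₚ B k) _ ⟩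
      act (b ∷ B) rest (+ k) ∎)

    go : ∀ k → k ℕ.< suc N → coeffₚ (divSeries (suc N) P (b ∷ B)) k ≡ f (+ k)
    go zero    _            = quotient
    go (suc k) (ℕ.s≤s k<N) = divSeries-correct N _ (b ∷ B) rest u (λ _ → refl) rest-eq k k<N

  length-+ : ∀ P Q → length (P +ₚ Q) ≡ length P ℕ.⊔ length Q
  length-+ []      Q       = refl
  length-+ (c ∷ P) []      = refl
  length-+ (c ∷ P) (d ∷ Q) = cong suc (length-+ P Q)

  length-* : ∀ P Q {m n} → length P ≡ suc m → length Q ≡ suc n → length (P *ₚ Q) ≡ suc (m ℕ.+ n)
  length-* (c ∷ []) Q {n = n} refl lQ = begin
    length (scaleₚ c Q +ₚ (+ 0 ∷ []))   ≡⟨ length-+ (scaleₚ c Q) _ ⟩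
    length (scaleₚ c Q) ℕ.⊔ 1           ≡⟨ cong (ℕ._⊔ 1) (trans (length-map _ Q) lQ) ⟩
    suc (n ℕ.⊔ 0)                       ≡⟨ cong suc (ℕ.⊔-identityʳ n) ⟩
    suc n                               ∎
    where open ≡-Reasoning
  length-* (c ∷ P@(_ ∷ P′)) Q {n = n} refl lQ = begin
    length (scaleₚ c Q +ₚ (+ 0 ∷ P *ₚ Q))             ≡⟨ length-+ (scaleₚ c Q) _ ⟩
    length (scaleₚ c Q) ℕ.⊔ suc (length (P *ₚ Q))     ≡⟨ cong₂ (λ x y → x ℕ.⊔ suc y) (trans (length-map _ Q) lQ)
      (length-* P Q refl lQ) ⟩
    suc (n ℕ.⊔ suc (length P′ ℕ.+ n))                 ≡⟨ cong suc (ℕ.m≤n⇒m⊔n≡n (ℕ.m≤n+m n (suc (length P′)))) ⟩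
    suc (suc (length P′ ℕ.+ n))                       ∎
    where open ≡-Reasoning

  abstract
    -- Opaque, so that exponents such as `p q r` never unfold into lists; `e-def` is the only way
    -- back to the definition.
    e : ℕ → Poly
    e = xPowMinusOne

    e-def : ∀ m → e m ≡ xPowMinusOne m
    e-def m = refl

  head-e : ∀ m → headₚ (e m) ≡ - + 1
  head-e m = cong headₚ (e-def m)

  act-e : ∀ m → 0 ℕ.< m → ∀ f k → act (e m) f k ≡ f (k - + m) - f k
  act-e (suc m) _ f k = trans (cong (λ P → act P f k) (e-def (suc m))) (trans (cong (_+_ (- + 1 * f k)) (tail m (k - + 1)))
    (trans (cong (λ j → - + 1 * f k + f j) (((∀ k m → k - + 1 - m ≡ k - (+ 1 + m)) ∋ solve-∀) k (+ m)))
      (((∀ x y → - + 1 * x + y ≡ y - x) ∋ solve-∀) (f k) (f (k - + suc m)))))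
    where
    tail : ∀ m k → act (replicate m (+ 0) ++ + 1 ∷ []) f k ≡ f (k - + m)
    tail zero    k = trans (act-1 f k) (cong f (sym (ℤ.+-identityʳ k)))
    tail (suc m) k = trans (ℤ.+-identityˡ _) (trans (tail m (k - + 1))
      (cong f (((∀ k m → k - + 1 - m ≡ k - (+ 1 + m)) ∋ solve-∀) k (+ m))))

  ∑ : ℕ → (ℕ → ℤ) → ℤ
  ∑ zero    f = + 0
  ∑ (suc n) f = ∑ n f + f n

  ∑-cong : ∀ n {f g : ℕ → ℤ} → (∀ m → m ℕ.< n → f m ≡ g m) → ∑ n f ≡ ∑ n g
  ∑-cong zero    eq = refl
  ∑-cong (suc n) eq = cong₂ _+_ (∑-cong n λ m m<n → eq m (ℕ.m<n⇒m<1+n m<n)) (eq n ℕ.≤-refl)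

  ∑-zero : ∀ n → ∑ n (λ _ → + 0) ≡ + 0
  ∑-zero zero    = refl
  ∑-zero (suc n) = cong (_+ + 0) (∑-zero n)

  window : ℕ → Seq → Seq
  window n f k = ∑ n λ m → f (k - + m)

  -- Telescoping: this is (x - 1)(1 + x + ... + x^(n-1)) = x^n - 1 in operator form.
  window-difference : ∀ n → 0 ℕ.< n → ∀ f k → act (e 1) (window n f) k ≡ act (e n) f k
  window-difference n 0<n f k = trans (act-e 1 ℕ.≤-refl (window n f) k) (trans (telescope n) (sym (act-e n 0<n f k)))
    where
    telescope : ∀ n → window n f (k - + 1) - window n f k ≡ f (k - + n) - f k
    telescope zero    = sym (trans (cong (λ j → f j - f k) (ℤ.+-identityʳ k)) (ℤ.+-inverseʳ (f k)))
    telescope (suc n) = trans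
      (((∀ w w′ x y → w′ + x - (w + y) ≡ w′ - w + (x - y)) ∋ solve-∀) (window n f k) (window n f (k - + 1)) (f
        (k - + 1 - + n)) (f (k - + n)))
      (trans (cong₂ (λ d j → d + (f j - f (k - + n))) (telescope n) (((∀ k m → k - + 1 - m ≡ k -
        (+ 1 + m)) ∋ solve-∀) k (+ n)))
        (((∀ x y z → y - z + (x - y) ≡ x - z) ∋ solve-∀) (f (k - + suc n)) (f (k - + n)) (f k)))

  window-causal : ∀ n {f} → Causal f → Causal (window n f)
  window-causal n {f} f0 k = trans (∑-cong n λ m _ → vanish m) (∑-zero n)
    where
    vanish : ∀ m → f (-[1+ k ] - + m) ≡ + 0
    vanish zero    = f0 k
    vanish (suc m) = f0 _

-- Finite sums and their reindexing.

module Sums where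

  open import Data.Integer using (_+_; _-_; -_; _≤_)
  open Series
  open Lin

  ∑-minus : ∀ n (f h : ℕ → ℤ) → ∑ n f - ∑ n h ≡ ∑ n (λ m → f m - h m)
  ∑-minus zero    f h = refl
  ∑-minus (suc n) f h = trans (((∀ u v w z → u + v - (w + z) ≡ u - w + (v - z)) ∋ solve-∀) (∑ n f) (f n) (∑ n h) (h n))
    (cong (_+ (f n - h n)) (∑-minus n f h))

  ∑-mono : ∀ n {f h : ℕ → ℤ} → (∀ m → f m ≤ h m) → ∑ n f ≤ ∑ n h
  ∑-mono zero    f≤h = ℤ.≤-refl
  ∑-mono (suc n) f≤h = ℤ.+-mono-≤ (∑-mono n f≤h) (f≤h n)

  ∑-shift : ∀ n f → ∑ (suc n) f ≡ f 0 + ∑ n (f ∘ suc)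
  ∑-shift zero    f = ℤ.+-comm (+ 0) (f 0)
  ∑-shift (suc n) f = trans (cong (_+ f (suc n)) (∑-shift n f)) (ℤ.+-assoc (f 0) (∑ n (f ∘ suc)) (f (suc n)))

  ∑-applyUpTo : ∀ n f → ∑ n f ≡ foldr _+_ (+ 0) (applyUpTo f n)
  ∑-applyUpTo zero    f = refl
  ∑-applyUpTo (suc n) f = trans (∑-shift n f) (cong (_+_ (f 0)) (∑-applyUpTo n (f ∘ suc)))

  -- `π` enumerates 0, ..., n - 1 without repetition, and two duplicate-free lists with the same
  -- members are permutations of each other.
  ∑-permute : ∀ n (π : ℕ → ℕ) → (∀ m → m ℕ.< n → π m ℕ.< n) → (∀ {i j} → i ℕ.< j → j ℕ.< n → π i ≢ π j) →
    (∀ y → y ℕ.< n → ∃ λ m → m ℕ.< n × y ≡ π m) → ∀ f → ∑ n (f ∘ π) ≡ ∑ n f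
  ∑-permute n π π< inj surj f = begin
    ∑ n (f ∘ π)                                 ≡⟨ ∑-applyUpTo n (f ∘ π) ⟩
    foldr _+_ (+ 0) (applyUpTo (f ∘ π) n)       ≡⟨ cong (foldr _+_ (+ 0)) (map-applyUpTo π f n) ⟨
    foldr _+_ (+ 0) (map f (applyUpTo π n))     ≡⟨ PermSetoid.foldr-commMonoid
      (ℤ.≡-setoid) ℤ.+-0-isCommutativeMonoid (↭⇒↭ₛ (Perm.map⁺ f perm)) ⟩
    foldr _+_ (+ 0) (map f (upTo n))            ≡⟨ cong (foldr _+_ (+ 0)) (map-applyUpTo (λ m → m) f n) ⟩
    foldr _+_ (+ 0) (applyUpTo f n)             ≡⟨ ∑-applyUpTo n f ⟨
    ∑ n f                                       ∎
    where
    open ≡-Reasoning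
    to : ∀ {y} → y ∈ applyUpTo π n → y ∈ upTo n
    to y∈ with m , m<n , refl ← ∈-applyUpTo⁻ π y∈ = ∈-upTo⁺ (π< m m<n)
    from : ∀ {y} → y ∈ upTo n → y ∈ applyUpTo π n
    from {y} y∈ with m , m<n , refl ← surj y (∈-upTo⁻ y∈) = ∈-applyUpTo⁺ π m<n
    perm : applyUpTo π n ↭ upTo n
    perm = ∼bag⇒↭ (unique∧set⇒bag (Unique.applyUpTo⁺₁ π n inj) (Unique.upTo⁺ n) (mk⇔ to from))

  ∑-le : ∀ c n → ∑ n (λ y → le c y) ≡ + (n ℕ.∸ c)
  ∑-le c zero    = cong +_ (sym (ℕ.0∸n≡0 c))
  ∑-le c (suc n) = trans (cong (_+ le c n) (∑-le c n)) (cases (c ℕ.≤? n))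
    where
    cases : Dec (c ℕ.≤ n) → + (n ℕ.∸ c) + le c n ≡ + (suc n ℕ.∸ c)
    cases (yes c≤n) = trans (cong (_+_ (+ (n ℕ.∸ c))) (le-yes c≤n)) (cong +_ (trans (ℕ.+-comm (n ℕ.∸ c) 1) (sym
        (ℕ.+-∸-assoc 1 c≤n))))
    cases (no c≰n)  = trans (cong₂ (λ d i → + d + i) (ℕ.m≤n⇒m∸n≡0 (ℕ.<⇒≤ (ℕ.≰⇒> c≰n))) (le-no (ℕ.≰⇒> c≰n)))
      (cong +_ (sym (ℕ.m≤n⇒m∸n≡0 (ℕ.≰⇒> c≰n))))

  ∑-one : ∀ n → ∑ n (λ _ → + 1) ≡ + n
  ∑-one zero    = refl
  ∑-one (suc n) = trans (cong (_+ + 1) (∑-one n)) (cong +_ (ℕ.+-comm n 1))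

  ∑-plus : ∀ n (f h : ℕ → ℤ) → ∑ n (λ m → f m + h m) ≡ ∑ n f + ∑ n h
  ∑-plus zero    f h = refl
  ∑-plus (suc n) f h = trans (cong (_+ (f n + h n)) (∑-plus n f h))
    (((∀ u v w z → u + w + (v + z) ≡ u + v + (w + z)) ∋ solve-∀) (∑ n f) (f n) (∑ n h) (h n))

  ∑-neg : ∀ n f → ∑ n (λ m → - f m) ≡ - ∑ n f
  ∑-neg zero    f = refl
  ∑-neg (suc n) f = trans (cong (_+ - f n) (∑-neg n f)) (sym (ℤ.neg-distrib-+ (∑ n f) (f n)))

-- Heights of polynomials and discrete intermediate values.

module Heights where

  open import Defs using (Poly; coeffₚ)
  open import Data.Integer using (_+_; _-_; -_; _≤_)
  open Lin

  height-≤ : ∀ P {M} → (∀ k → ∣ coeffₚ P k ∣ ℕ.≤ M) → foldr ℕ._⊔_ 0 (map ∣_∣ P) ℕ.≤ M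
  height-≤ []      h = ℕ.z≤n
  height-≤ (c ∷ P) h = ℕ.⊔-lub (h 0) (height-≤ P (h ∘ suc))

  ≤-height : ∀ P k → ∣ coeffₚ P k ∣ ℕ.≤ foldr ℕ._⊔_ 0 (map ∣_∣ P)
  ≤-height []      k       = ℕ.z≤n
  ≤-height (c ∷ P) zero    = ℕ.m≤m⊔n ∣ c ∣ _
  ≤-height (c ∷ P) (suc k) = ℕ.≤-trans (≤-height P k) (ℕ.m≤n⊔m ∣ c ∣ _)

  ∣∣-≤ : ∀ {z M} → - + M ≤ z → z ≤ + M → ∣ z ∣ ℕ.≤ M
  ∣∣-≤ {+ z}             _       (+≤+ z≤M) = z≤M
  ∣∣-≤ { -[1+ z ]} {suc M} (-≤- z≤M) _    = ℕ.s≤s z≤M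

  module Intermediate (f : ℕ → ℤ) (step : ∀ k → - + 1 ≤ f (suc k) - f k × f (suc k) - f k ≤ + 1) where

    -- As long as `z` is not met at `i`, `f i + 1 ≤ z`, and a rise of at most 1 keeps
    -- `f (suc i) ≤ z`.
    ascending : ∀ d i z → f i ≤ z → z ≤ f (i ℕ.+ d) → ∃ λ k → k ℕ.≤ i ℕ.+ d × f k ≡ z
    ascending zero    i z fi≤z z≤ = i , ℕ.m≤m+n i 0 , ℤ.≤-antisym fi≤z (subst (λ j → z ≤ f j) (ℕ.+-identityʳ i) z≤)
    ascending (suc d) i z fi≤z z≤ = cases (z ℤ.≟ f i)
      where
      cases : Dec (z ≡ f i) → ∃ λ k → k ℕ.≤ i ℕ.+ suc d × f k ≡ z
      cases (yes z≡) = i , ℕ.m≤m+n i (suc d) , sym z≡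
      cases (no z≢)  =
        let k , k≤ , fk≡ = ascending d (suc i) z
              (by-≤ (gap< (ℤ.≤∧≢⇒< fi≤z (z≢ ∘ sym)) ⊕ gap (proj₂ (step i)))
                (((∀ x y z → z ≡ y + (z - x - + 1 + (+ 1 - (y - x)))) ∋ solve-∀) (f i) (f (suc i)) z))
              (subst (λ j → z ≤ f j) (ℕ.+-suc i d) z≤)
        in k , subst (k ℕ.≤_) (sym (ℕ.+-suc i d)) k≤ , fk≡

    descending : ∀ d i z → z ≤ f i → f (i ℕ.+ d) ≤ z → ∃ λ k → k ℕ.≤ i ℕ.+ d × f k ≡ z
    descending zero    i z z≤fi f≤z = i , ℕ.m≤m+n i 0 , ℤ.≤-antisym (subst (λ j → f j ≤ z) (ℕ.+-identityʳ i) f≤z) z≤fi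
    descending (suc d) i z z≤fi f≤z = cases (z ℤ.≟ f i)
      where
      cases : Dec (z ≡ f i) → ∃ λ k → k ℕ.≤ i ℕ.+ suc d × f k ≡ z
      cases (yes z≡) = i , ℕ.m≤m+n i (suc d) , sym z≡
      cases (no z≢)  =
        let k , k≤ , fk≡ = descending d (suc i) z
              (by-≤ (gap< (ℤ.≤∧≢⇒< z≤fi z≢) ⊕ gap (proj₁ (step i)))
                (((∀ x y z → y ≡ z + (x - z - + 1 + (y - x - - + 1))) ∋ solve-∀) (f i) (f (suc i)) z))
              (subst (λ j → f j ≤ z) (ℕ.+-suc i d) f≤z)
        in k , subst (k ℕ.≤_) (sym (ℕ.+-suc i d)) k≤ , fk≡

    -- The bound `k ≤ i ⊔ j` is kept for the application, where the values of `f` are known to be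
    -- coefficients only up to the degree of the cyclotomic polynomial.
    attained : ∀ i j z → f i ≤ z → z ≤ f j → ∃ λ k → k ℕ.≤ i ℕ.⊔ j × f k ≡ z
    attained i j z fi≤z z≤fj = cases (ℕ.≤-total i j)
      where
      cases : i ℕ.≤ j ⊎ j ℕ.≤ i → ∃ λ k → k ℕ.≤ i ℕ.⊔ j × f k ≡ z
      cases (inj₁ i≤j) =
        let k , k≤ , fk≡ = ascending (j ℕ.∸ i) i z fi≤z (subst (λ j → z ≤ f j) (sym (ℕ.m+[n∸m]≡n i≤j)) z≤fj)
        in k , ℕ.≤-trans (ℕ.≤-trans k≤ (ℕ.≤-reflexive (ℕ.m+[n∸m]≡n i≤j))) (ℕ.m≤n⊔m i j) , fk≡
      cases (inj₂ j≤i) =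
        let k , k≤ , fk≡ = descending (i ℕ.∸ j) j z z≤fj (subst (λ i → f i ≤ z) (sym (ℕ.m+[n∸m]≡n j≤i)) fi≤z)
        in k , ℕ.≤-trans (ℕ.≤-trans k≤ (ℕ.≤-reflexive (ℕ.m+[n∸m]≡n j≤i))) (ℕ.m≤m⊔n i j) , fk≡

-- From the recursive definition of `Φ` to products over divisors.

module Cyclo where

  open import Defs
  open import Data.Nat.Divisibility using (_∣_; _∣?_)
  open import Data.Integer using ()
  open Series

  open CommutativeMonoid *ₚ-commutativeMonoid using () renaming
    (isCommutativeMonoid to *ₚ-isCommutativeMonoid; isEquivalence to ≈ₚ-isEquivalence; setoid to ≈ₚ-setoid)

  record IsDivisors (n : ℕ) (ds : List ℕ) : Set where
    field
      unique   : Unique ds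
      sound    : ∀ {d} → d ∈ ds → d ∣ n
      complete : ∀ {d} → d ∣ n → d ∈ ds

  open IsDivisors

  isDivisors-prime : ∀ {p} → Prime p → IsDivisors p (1 ∷ p ∷ [])
  isDivisors-prime {p} pp = record
    { unique   = (1≢p ∷ []) ∷ [] ∷ []
    ; sound    = λ { (here refl) → ℕ.1∣ p ; (there (here refl)) → ℕ.∣-refl }
    ; complete = λ d∣p → from (prime⇒irreducible pp d∣p)
    }
    where
    1≢p : 1 ≢ p
    1≢p refl = contradiction (ℕ.nonTrivial⇒n>1 1 {{prime⇒nonTrivial pp}}) λ { (ℕ.s≤s ()) }
    from : ∀ {d} → d ≡ 1 ⊎ d ≡ p → d ∈ 1 ∷ p ∷ []
    from (inj₁ refl) = here refl
    from (inj₂ refl) = there (here refl)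

  prime∤⇒coprime : ∀ {p n} → Prime p → ¬ p ∣ n → Coprime n p
  prime∤⇒coprime pp p∤n (d∣n , d∣p) with prime⇒irreducible pp d∣p
  ... | inj₁ refl = refl
  ... | inj₂ refl = contradiction d∣n p∤n

  -- A divisor of `p m` prime to `p` divides `m`; any other is `p` times a divisor of `m`. Since `p`
  -- does not divide `m`, the two kinds do not overlap.
  isDivisors-* : ∀ {p m ds} → Prime p → ¬ p ∣ m → IsDivisors m ds →
    IsDivisors (p ℕ.* m) (ds ++ map (p ℕ.*_) ds)
  isDivisors-* {p} {m} {ds} pp p∤m D = record
    { unique   = Unique.++⁺ (unique D)
        (Unique.map⁺ (ℕ.*-cancelˡ-≡ _ _ p) (unique D)) disjoint
    ; sound    = λ d∈ → sound′ (∈-++⁻ ds d∈)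
    ; complete = complete′
    }
    where
    instance _ = prime⇒nonZero pp
    disjoint : ∀ {d} → ¬ (d ∈ ds × d ∈ map (p ℕ.*_) ds)
    disjoint (d∈ , d∈′) with _ , _ , refl ← ∈-map⁻ (p ℕ.*_) d∈′ =
      p∤m (ℕ.∣-trans (ℕ.m∣m*n _) (sound D d∈))
    sound′ : ∀ {d} → d ∈ ds ⊎ d ∈ map (p ℕ.*_) ds → d ∣ p ℕ.* m
    sound′ (inj₁ d∈) = ℕ.∣n⇒∣m*n p (sound D d∈)
    sound′ (inj₂ d∈) with _ , d′∈ , refl ← ∈-map⁻ (p ℕ.*_) d∈ = ℕ.*-monoʳ-∣ p (sound D d′∈)
    complete′ : ∀ {d} → d ∣ p ℕ.* m → d ∈ ds ++ map (p ℕ.*_) ds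
    complete′ {d} d∣pm with p ∣? d
    ... | no p∤d = ∈-++⁺ˡ (complete D (coprime-divisor (prime∤⇒coprime pp p∤d) d∣pm))
    ... | yes (ℕ.divides k refl) = ∈-++⁺ʳ ds (subst (_∈ map (p ℕ.*_) ds) (ℕ.*-comm p k)
            (∈-map⁺ (p ℕ.*_) (complete D (ℕ.*-cancelˡ-∣ p (subst (_∣ p ℕ.* m) (ℕ.*-comm k p) d∣pm)))))

  length-cycloTable : ∀ n → length (cycloTable n) ≡ n
  length-cycloTable zero    = refl
  length-cycloTable (suc n) = trans (length-++ (cycloTable n)) (trans (ℕ.+-comm _ 1) (cong suc (length-cycloTable n)))

  nth-++ˡ : ∀ Ps Qs i → i ℕ.< length Ps → nthₚ (Ps ++ Qs) i ≡ nthₚ Ps i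
  nth-++ˡ (P ∷ Ps) Qs zero    _         = refl
  nth-++ˡ (P ∷ Ps) Qs (suc i) (ℕ.s≤s l) = nth-++ˡ Ps Qs i l

  nth-length : ∀ Ps P → nthₚ (Ps ++ P ∷ []) (length Ps) ≡ P
  nth-length []       P = refl
  nth-length (_ ∷ Ps) P = nth-length Ps P

  nth-beyond : ∀ Ps i → length Ps ℕ.≤ i → nthₚ Ps i ≡ 1ₚ
  nth-beyond []       i       _         = refl
  nth-beyond (P ∷ Ps) (suc i) (ℕ.s≤s l) = nth-beyond Ps i l

  Φ-suc : ∀ n → Φ (suc n) ≡ nextCyclo (suc n) (cycloTable n)
  Φ-suc n = subst (λ i → nthₚ (cycloTable n ++ nextCyclo (suc n) (cycloTable n) ∷ []) i ≡ nextCyclo (suc n) (cycloTable n))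
    (length-cycloTable n) (nth-length (cycloTable n) _)

  nth-table : ∀ n i → i ℕ.< n → nthₚ (cycloTable n) i ≡ Φ (suc i)
  nth-table (suc n) i i<1+n with ℕ.m≤n⇒m<n∨m≡n (ℕ.s≤s⁻¹ i<1+n)
  ... | inj₂ refl = refl
  ... | inj₁ i<n  = trans (nth-++ˡ (cycloTable n) _ i (subst (i ℕ.<_) (sym (length-cycloTable n)) i<n)) (nth-table n i i<n)

  -- properDivProd recurses through a local function; these two definitions recover it by unification.
  mutual
    divProd : (m : ℕ) (T : List Poly) → List ℕ → Poly
    divProd = _

    properDivProd≡ : ∀ m T → properDivProd m T ≡ divProd m T (upTo m)
    properDivProd≡ m T with upTo m
    ... | is = refl

  prodₚ : List Poly → Poly
  prodₚ = foldr _*ₚ_ 1ₚ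

  divProd≡ : ∀ m T is → divProd m T is ≡ prodₚ (map (nthₚ T) (filter (λ i → suc i ∣? m) is))
  divProd≡ m T []       = refl
  divProd≡ m T (i ∷ is) with suc i ∣? m
  ... | yes d = trans (cong (nthₚ T i *ₚ_) (divProd≡ m T is))
    (cong (prodₚ ∘ map (nthₚ T)) (sym (filter-accept (λ i → suc i ∣? m) d)))
  ... | no ¬d = trans (divProd≡ m T is) (cong (prodₚ ∘ map (nthₚ T)) (sym (filter-reject (λ i → suc i ∣? m) ¬d)))

  divisors-↭ : ∀ {n ds} → IsDivisors (suc n) ds → map suc (filter (λ i → suc i ∣? suc n) (upTo (suc n))) ↭ ds
  divisors-↭ {n} {ds} D = ∼bag⇒↭ (unique∧set⇒bag
    (Unique.map⁺ ℕ.suc-injective (Unique.filter⁺ (λ i → suc i ∣? suc n) (Unique.upTo⁺ (suc n)))) (unique D)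
    (mk⇔ to from))
    where
    is = filter (λ i → suc i ∣? suc n) (upTo (suc n))
    to : ∀ {d} → d ∈ map suc is → d ∈ ds
    to d∈ with _ , i∈ , refl ← ∈-map⁻ suc d∈ =
      complete D (proj₂ (∈-filter⁻ (λ i → suc i ∣? suc n) {xs = upTo (suc n)} i∈))
    from : ∀ {d} → d ∈ ds → d ∈ map suc is
    from {zero}  d∈ = contradiction (ℕ.0∣⇒≡0 (sound D d∈)) λ ()
    from {suc d} d∈ = ∈-map⁺ suc (∈-filter⁺ (λ i → suc i ∣? suc n) (∈-upTo⁺ (ℕ.∣⇒≤ (sound D d∈))) (sound D d∈))

  -- At `d = suc n` the index runs past the table and the default value 1 of `nthₚ` appears. Hence
  -- the list of all divisors of `suc n` can replace that of the proper ones.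
  factor : ℕ → ℕ → Poly
  factor n d = nthₚ (cycloTable n) (pred d)

  -- The definition meets the divisors in increasing order, which depends on the sizes of the
  -- primes. A permutation is enough, because the product is commutative.
  properDivProd-↭ : ∀ n {ds} → IsDivisors (suc n) ds →
    ∃ λ Ps → properDivProd (suc n) (cycloTable n) ≡ prodₚ Ps × Ps ↭ map (factor n) ds
  properDivProd-↭ n {ds} D = map (nthₚ (cycloTable n)) is ,
    trans (properDivProd≡ (suc n) (cycloTable n)) (divProd≡ (suc n) (cycloTable n) (upTo (suc n))) ,
    subst (_↭ map (factor n) ds) (sym (map-∘ is)) (Perm.map⁺ (factor n) (divisors-↭ D))
    where is = filter (λ i → suc i ∣? suc n) (upTo (suc n))

  prod-↭ : ∀ {Ps Qs} → Ps ↭ Qs → prodₚ Ps ≈ₚ prodₚ Qs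
  prod-↭ p = PermSetoid.foldr-commMonoid ≈ₚ-setoid *ₚ-isCommutativeMonoid (↭⇒↭ₛ′ ≈ₚ-isEquivalence p)

  degree : Poly → ℕ
  degree P = length P ℕ.∸ 1

  -- With truncated subtraction the equation on lengths just says that P is nonempty.
  Proper : Poly → Set
  Proper P = length P ≡ suc (degree P) × Unit (headₚ P)

  prod-proper : ∀ {Ps} → All Proper Ps → Unit (headₚ (prodₚ Ps)) × length (prodₚ Ps) ≡ suc (sum (map degree Ps))
  prod-proper []                          = refl , refl
  prod-proper {P ∷ Ps} ((len , u) ∷ rest) =
    let u′ , len′ = prod-proper rest in
    subst Unit (sym (head-* P (prodₚ Ps))) (unit-* {headₚ P} {headₚ (prodₚ Ps)} u u′) , length-* P (prodₚ Ps) len len′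

  module _ (n : ℕ) {ds : List ℕ} (D : IsDivisors (suc n) ds) (Ps : List Poly) (Ps≡ : map (factor n) ds ≡ Ps)
      (proper : All Proper Ps)
           (f : Seq) (f0 : Causal f) (quotient : ∀ k → act (prodₚ Ps) f k ≡ act (e (suc n)) δ k) where

    private
      N : ℕ
      N = suc (suc n) ℕ.∸ sum (map degree Ps)

      Q = properDivProd (suc n) (cycloTable n)
      Qs = proj₁ (properDivProd-↭ n D)
      Q≡ = proj₁ (proj₂ (properDivProd-↭ n D))
      Qs↭ : Qs ↭ Ps
      Qs↭ = subst (Qs ↭_) Ps≡ (proj₂ (proj₂ (properDivProd-↭ n D)))
      Q≈ : Q ≈ₚ prodₚ Ps
      Q≈ = subst (_≈ₚ prodₚ Ps) (sym Q≡) (prod-↭ Qs↭)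
      lengthQ : length Q ≡ suc (sum (map degree Ps))
      lengthQ = trans (cong length Q≡) (trans (proj₂ (prod-proper (All-resp-↭ (↭-sym Qs↭) proper)))
                  (cong suc (sum-↭ (Perm.map⁺ degree Qs↭))))

      Φ≡ : Φ (suc n) ≡ divSeries N (e (suc n)) Q
      Φ≡ = trans (Φ-suc n) (cong₂ (λ l P → divSeries (suc (suc n) ℕ.∸ (l ℕ.∸ 1)) P Q) lengthQ (sym (e-def (suc n))))

    length-Φ : length (Φ (suc n)) ≡ N
    length-Φ = trans (cong length Φ≡) (length-divSeries N _ _)

    -- No unfolding of `Φ` is needed: a causal `f` whose product with the earlier factors is x^(n+1)
    -- - 1 is the quotient that `divSeries` computes.
    coeff-Φ : ∀ k → k ℕ.< N → coeffₚ (Φ (suc n)) k ≡ f (+ k)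
    coeff-Φ k k<N = trans (cong (λ P → coeffₚ P k) Φ≡)
      (divSeries-correct N (e (suc n)) Q f unitQ f0 (λ k → trans (act-≈ Q (prodₚ Ps) Q≈ f (+ k)) (trans (quotient
        (+ k)) (act-δ (e (suc n)) k))) k k<N)
      where
      unitQ : Unit (headₚ Q)
      unitQ = subst Unit (sym (Q≈ 0)) (proj₁ (prod-proper proper))

-- Lattice coordinates of exponents and the series Φ_pq(x^r) / (1 - x^(pq)).

module Lattice (p q r ρ σ : ℕ) (0<p : 0 ℕ.< p) (0<q : 0 ℕ.< q) (0<r : 0 ℕ.< r)
  (ρ<q : suc ρ ℕ.< q) (σ<p : suc σ ℕ.< p)
  (ident : + p ℤ.* + suc ρ ℤ.+ + q ℤ.* + suc σ ≡ + 1 ℤ.+ + p ℤ.* + q)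
  (r̄ g : ℤ) (inv : + r ℤ.* r̄ ≡ + 1 ℤ.+ + p ℤ.* + q ℤ.* g) where

  open import Data.Integer using (_+_; _*_; _-_; -_; _≤_; _<_; _%ℕ_; _/ℕ_)
  open Series
  open Lin
  open Sums

  private
    instance
      p≢0 : ℕ.NonZero p
      p≢0 = ℕ.>-nonZero 0<p
      q≢0 : ℕ.NonZero q
      q≢0 = ℕ.>-nonZero 0<q
      pq≢0 : ℕ.NonZero (p ℕ.* q)
      pq≢0 = ℕ.m*n≢0 p q

  abstract
    value : ℕ → ℕ → ℤ → ℤ
    value x y z = + r * (+ p * + x + + q * + y) + + p * + q * z

    value-def : ∀ x y z → value x y z ≡ + r * (+ p * + x + + q * + y) + + p * + q * z
    value-def x y z = refl

  abstract
    -- Unreduced coordinates of the integer 1: `suc ρ` inverts `p` modulo `q`, `suc σ` inverts `q`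
    -- modulo `p`, and `r̄` inverts `r`. Scaling by `t` and reducing the first two yields `X`, `Y`,
    -- `Z`.
    u v w : ℤ
    u = r̄ * + suc ρ
    v = r̄ * + suc σ
    w = - (+ r * r̄) - g

    bezout : + r * (+ p * u + + q * v) + + p * + q * w ≡ + 1
    bezout = by-≡ (+ r * r̄) ident (by-≡ (+ 1) inv
      (((∀ p q r r̄ g x y → r * (p * (r̄ * x) + q * (r̄ * y)) + p * q * (- (r * r̄) - g)
          ≡ + 1 + (p * x + q * y - (+ 1 + p * q)) * (r * r̄) + (r * r̄ - (+ 1 + p * q * g)) * + 1) ∋ solve-∀)
        (+ p) (+ q) (+ r) r̄ g (+ suc ρ) (+ suc σ)))

    X Y : ℤ → ℕ
    X t = (t * u) %ℕ q
    Y t = (t * v) %ℕ p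

    Z : ℤ → ℤ
    Z t = + r * ((t * u) /ℕ q + (t * v) /ℕ p) + t * w

    X<q : ∀ t → X t ℕ.< q
    X<q t = n%ℕd<d (t * u) q

    Y<p : ∀ t → Y t ℕ.< p
    Y<p t = n%ℕd<d (t * v) p

    value-coords : ∀ t → t ≡ value (X t) (Y t) (Z t)
    value-coords t = trans (by-≡ (- t) bezout (by-≡ (+ r * + p) (a≡a%ℕn+[a/ℕn]*n (t * u) q) (by-≡ (+ r * + q)
        (a≡a%ℕn+[a/ℕn]*n (t * v) p)
      (((∀ p q r t u v w x y k l → t ≡ r * (p * x + q * y) + p * q * (r * (k + l) + t * w)
          + (r * (p * u + q * v) + p * q * w - + 1) * - t + (t * u - (x + k * q)) * (r * p) + (t * v -
            (y + l * p)) * (r * q)) ∋ solve-∀)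
        (+ p) (+ q) (+ r) t u v w (+ X t) (+ Y t) ((t * u) /ℕ q) ((t * v) /ℕ p))))) (sym (value-def (X t) (Y t) (Z t)))

  private
    -- The first equation makes `c` invertible modulo `q`, so `q` divides `d`; the quotient is
    -- written out for `residue-unique`.
    divide : ∀ {c u q N d M} → c * u + q * N ≡ + 1 → c * d ≡ q * M → d ≡ q * (u * M + N * d)
    divide {c} {u} {q} {N} {d} {M} e₁ e₂ = by-≡ (- d) e₁ (by-≡ u e₂
      (((∀ c u q N d M → d ≡ q * (u * M + N * d) + (c * u + q * N - + 1) * - d +
        (c * d - q * M) * u) ∋ solve-∀) c u q N d M))

    bezout-x : + r * + p * u + + q * (+ r * v + + p * w) ≡ + 1
    bezout-x = trans (((∀ p q r u v w → r * p * u + q * (r * v + p * w) ≡ r *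
        (p * u + q * v) + p * q * w) ∋ solve-∀) (+ p) (+ q) (+ r) u v w) bezout

    bezout-y : + r * + q * v + + p * (+ r * u + + q * w) ≡ + 1
    bezout-y = trans (((∀ p q r u v w → r * q * v + p * (r * u + q * w) ≡ r *
        (p * u + q * v) + p * q * w) ∋ solve-∀) (+ p) (+ q) (+ r) u v w) bezout

  value-injective : ∀ {x y z x′ y′ z′} → x ℕ.< q → y ℕ.< p → x′ ℕ.< q → y′ ℕ.< p →
    value x y z ≡ value x′ y′ z′ → x ≡ x′ × y ≡ y′ × z ≡ z′
  value-injective {x} {y} {z} {x′} {y′} {z′} x<q y<p x′<q y′<p value≡ = x≡x′ , y≡y′ , z≡z′ x≡x′ y≡y′
    where
    expanded : + r * (+ p * + x + + q * + y) + + p * + q * z ≡ + r * (+ p * + x′ + + q * + y′) + + p * + q * z′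
    expanded = trans (sym (value-def x y z)) (trans value≡ (value-def x′ y′ z′))
    x≡x′ : x ≡ x′
    x≡x′ = residue-unique (u * (+ r * (+ y′ - + y) + + p * (z′ - z)) + (+ r * v + + p * w) *
        (+ x - + x′)) x<q x′<q (divide {+ r * + p} {u} {+ q} {+ r * v + + p * w} {+ x - + x′} {+ r *
        (+ y′ - + y) + + p * (z′ - z)}
      bezout-x
      (by-≡ (+ 1) expanded (((∀ p q r x y z x′ y′ z′ → r * p * (x - x′) ≡ q * (r * (y′ - y) + p * (z′ - z))
          + (r * (p * x + q * y) + p * q * z - (r * (p * x′ + q * y′) + p * q * z′)) * + 1) ∋ solve-∀)
        (+ p) (+ q) (+ r) (+ x) (+ y) z (+ x′) (+ y′) z′)))
    y≡y′ : y ≡ y′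
    y≡y′ = residue-unique (v * (+ r * (+ x′ - + x) + + q * (z′ - z)) + (+ r * u + + q * w) *
        (+ y - + y′)) y<p y′<p (divide {+ r * + q} {v} {+ p} {+ r * u + + q * w} {+ y - + y′} {+ r *
        (+ x′ - + x) + + q * (z′ - z)}
      bezout-y
      (by-≡ (+ 1) expanded (((∀ p q r x y z x′ y′ z′ → r * q * (y - y′) ≡ p * (r * (x′ - x) + q * (z′ - z))
          + (r * (p * x + q * y) + p * q * z - (r * (p * x′ + q * y′) + p * q * z′)) * + 1) ∋ solve-∀)
        (+ p) (+ q) (+ r) (+ x) (+ y) z (+ x′) (+ y′) z′)))
    z≡z′ : x ≡ x′ → y ≡ y′ → z ≡ z′
    z≡z′ refl refl = ℤ.*-cancelˡ-≡ (+ (p ℕ.* q)) z z′ (begin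
      + (p ℕ.* q) * z   ≡⟨ cong (_* z) (ℤ.pos-* p q) ⟩
      + p * + q * z     ≡⟨ by-≡ (+ 1) expanded (((∀ c d d′ → d ≡ d′ + (c + d - (c + d′)) * + 1) ∋ solve-∀) (+ r *
        (+ p * + x + + q * + y)) (+ p * + q * z) (+ p * + q * z′)) ⟩
      + p * + q * z′    ≡⟨ cong (_* z′) (ℤ.pos-* p q) ⟨
      + (p ℕ.* q) * z′  ∎)
      where open ≡-Reasoning

  -- Modulo `q` only the term `r p x` of a value survives, and `r p` is invertible there.
  X-unique : ∀ t x M → x ℕ.< q → t ≡ + r * + p * + x + + q * M → X t ≡ x
  X-unique t x M x<q t≡ = residue-unique (u * N + (+ r * v + + p * w) * (+ X t - + x)) (X<q t) x<q
    (divide {+ r * + p} {u} {+ q} {+ r * v + + p * w} {+ X t - + x} {N} bezout-x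
      (by-≡ (+ 1) (trans (sym (value-def (X t) (Y t) (Z t))) (trans (sym (value-coords t)) t≡))
        (((∀ p q r x x′ y z m → r * p * (x - x′) ≡ q * (m - r * y - p * z)
            + (r * (p * x + q * y) + p * q * z - (r * p * x′ + q * m)) * + 1) ∋ solve-∀)
          (+ p) (+ q) (+ r) (+ X t) (+ x) (+ Y t) (Z t) M)))
    where N = M - + r * + Y t - + p * Z t

  Y-unique : ∀ t y M → y ℕ.< p → t ≡ + r * + q * + y + + p * M → Y t ≡ y
  Y-unique t y M y<p t≡ = residue-unique (v * N + (+ r * u + + q * w) * (+ Y t - + y)) (Y<p t) y<p
    (divide {+ r * + q} {v} {+ p} {+ r * u + + q * w} {+ Y t - + y} {N} bezout-y
      (by-≡ (+ 1) (trans (sym (value-def (X t) (Y t) (Z t))) (trans (sym (value-coords t)) t≡))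
        (((∀ p q r x y y′ z m → r * q * (y - y′) ≡ p * (m - r * x - q * z)
            + (r * (p * x + q * y) + p * q * z - (r * q * y′ + p * m)) * + 1) ∋ solve-∀)
          (+ p) (+ q) (+ r) (+ X t) (+ Y t) (+ y) (Z t) M)))
    where N = M - + r * + X t - + q * Z t

  on-values : ∀ {ℓ} (P : ℤ → Set ℓ) → (∀ x y z → x ℕ.< q → y ℕ.< p → P (value x y z)) → ∀ t → P t
  on-values P h t = subst P (sym (value-coords t)) (h (X t) (Y t) (Z t) (X<q t) (Y<p t))

  coords : ∀ x y z → x ℕ.< q → y ℕ.< p → X (value x y z) ≡ x × Y (value x y z) ≡ y × Z (value x y z) ≡ z
  coords x y z x<q y<p = value-injective (X<q t) (Y<p t) x<q y<p (sym (value-coords t))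
    where t = value x y z

  lift : (ℕ → ℕ → ℤ → ℤ) → Seq
  lift F t = F (X t) (Y t) (Z t)

  lift-value : ∀ F x y z → x ℕ.< q → y ℕ.< p → lift F (value x y z) ≡ F x y z
  lift-value F x y z x<q y<p = congruence (coords x y z x<q y<p)
    where
    congruence : ∀ {x x′ y y′ z z′} → x ≡ x′ × y ≡ y′ × z ≡ z′ → F x y z ≡ F x′ y′ z′
    congruence (refl , refl , refl) = refl

  value-suc-x : ∀ x y z → value (suc x) y z - + (p ℕ.* r) ≡ value x y z
  value-suc-x x y z = trans (cong₂ _-_ (value-def (suc x) y z) (ℤ.pos-* p r)) (trans
    (((∀ p q r x y z → r * (p * (+ 1 + x) + q * y) + p * q * z - p * r ≡ r * (p * x + q * y) + p * q * z) ∋ solve-∀)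
      (+ p) (+ q) (+ r) (+ x) (+ y) z) (sym (value-def x y z)))

  -- A borrow: replacing x = 0 by q - 1 costs `p q r`, that is `r` units of the third coordinate.
  value-zero-x : ∀ y z → value 0 y z - + (p ℕ.* r) ≡ value (pred q) y (z - + r)
  value-zero-x y z = trans (cong₂ _-_ (value-def 0 y z) (ℤ.pos-* p r)) (trans
    (((∀ p q r y z → r * (p * + 0 + q * y) + p * q * z - p * r ≡ r * (p * (q - + 1) + q * y) + p * q * (z - r)) ∋ solve-∀)
      (+ p) (+ q) (+ r) (+ y) z)
    (trans (cong (λ x → + r * (+ p * x + + q * + y) + + p * + q * (z - + r)) (sym (pos-pred 0<q)))
      (sym (value-def (pred q) y (z - + r)))))

  value-suc-y : ∀ x y z → value x (suc y) z - + (q ℕ.* r) ≡ value x y z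
  value-suc-y x y z = trans (cong₂ _-_ (value-def x (suc y) z) (ℤ.pos-* q r)) (trans
    (((∀ p q r x y z → r * (p * x + q * (+ 1 + y)) + p * q * z - q * r ≡ r * (p * x + q * y) + p * q * z) ∋ solve-∀)
      (+ p) (+ q) (+ r) (+ x) (+ y) z) (sym (value-def x y z)))

  value-zero-y : ∀ x z → value x 0 z - + (q ℕ.* r) ≡ value x (pred p) (z - + r)
  value-zero-y x z = trans (cong₂ _-_ (value-def x 0 z) (ℤ.pos-* q r)) (trans
    (((∀ p q r x z → r * (p * x + q * + 0) + p * q * z - q * r ≡ r * (p * x + q * (p - + 1)) + p * q * (z - r)) ∋ solve-∀)
      (+ p) (+ q) (+ r) (+ x) z)
    (trans (cong (λ y → + r * (+ p * + x + + q * y) + + p * + q * (z - + r)) (sym (pos-pred 0<p)))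
      (sym (value-def x (pred p) (z - + r)))))

  value-z : ∀ x y z → value x y z - + (p ℕ.* q) ≡ value x y (z - + 1)
  value-z x y z = trans (cong₂ _-_ (value-def x y z) (ℤ.pos-* p q)) (trans
    (((∀ p q r x y z → r * (p * x + q * y) + p * q * z - p * q ≡ r * (p * x + q * y) + p * q * (z - + 1)) ∋ solve-∀)
      (+ p) (+ q) (+ r) (+ x) (+ y) z) (sym (value-def x y (z - + 1))))

  pred< : ∀ {n} → 0 ℕ.< n → pred n ℕ.< n
  pred< {suc n} _ = ℕ.≤-refl

  <-pred : ∀ {m n} → suc m ℕ.< n → m ℕ.< pred n
  <-pred (ℕ.s≤s m<n) = m<n

  -- In Φ_pq the exponents of the opposite box are `p x + q y - p q`. After substituting x^r this
  -- offset is `r` units of `z`, whence the second threshold `z + r` used below.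
  box : ℕ → ℕ → ℤ → ℤ → ℤ
  box x y α β = le x ρ * le y σ * α - (+ 1 - le x ρ) * (+ 1 - le y σ) * β

  module _ {x y : ℕ} (α β : ℤ) where

    private
      box-le : ∀ {a c} → le x ρ ≡ a → le y σ ≡ c → box x y α β ≡ a * c * α - (+ 1 - a) * (+ 1 - c) * β
      box-le refl refl = refl

    box-in : x ℕ.≤ ρ → y ℕ.≤ σ → box x y α β ≡ α
    box-in x≤ρ y≤σ = trans (box-le (le-yes x≤ρ) (le-yes y≤σ))
      (((∀ α β → + 1 * + 1 * α - (+ 1 - + 1) * (+ 1 - + 1) * β ≡ α) ∋ solve-∀) α β)

    box-out : ρ ℕ.< x → σ ℕ.< y → box x y α β ≡ - β
    box-out ρ<x σ<y = trans (box-le (le-no ρ<x) (le-no σ<y))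
      (((∀ α β → + 0 * + 0 * α - (+ 1 - + 0) * (+ 1 - + 0) * β ≡ - β) ∋ solve-∀) α β)

    box-above : x ℕ.≤ ρ → σ ℕ.< y → box x y α β ≡ + 0
    box-above x≤ρ σ<y = trans (box-le (le-yes x≤ρ) (le-no σ<y))
      (((∀ α β → + 1 * + 0 * α - (+ 1 - + 1) * (+ 1 - + 0) * β ≡ + 0) ∋ solve-∀) α β)

    box-right : ρ ℕ.< x → y ℕ.≤ σ → box x y α β ≡ + 0
    box-right ρ<x y≤σ = trans (box-le (le-no ρ<x) (le-yes y≤σ))
      (((∀ α β → + 0 * + 1 * α - (+ 1 - + 0) * (+ 1 - + 1) * β ≡ + 0) ∋ solve-∀) α β)

    box-cases : ∀ {ℓ} (P : ℤ → Set ℓ) → (x ℕ.≤ ρ → y ℕ.≤ σ → P α) →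
      (ρ ℕ.< x → σ ℕ.< y → P (- β)) → P (+ 0) → P (box x y α β)
    box-cases P in-box out-box mixed = cases (x ℕ.≤? ρ) (y ℕ.≤? σ)
      where
      cases : Dec (x ℕ.≤ ρ) → Dec (y ℕ.≤ σ) → P (box x y α β)
      cases (yes x≤ρ) (yes y≤σ) = subst P (sym (box-in x≤ρ y≤σ)) (in-box x≤ρ y≤σ)
      cases (yes x≤ρ) (no y≰σ)  = subst P (sym (box-above x≤ρ (ℕ.≰⇒> y≰σ))) mixed
      cases (no x≰ρ)  (yes y≤σ) = subst P (sym (box-right (ℕ.≰⇒> x≰ρ) y≤σ)) mixed
      cases (no x≰ρ)  (no y≰σ)  = subst P (sym (box-out (ℕ.≰⇒> x≰ρ) (ℕ.≰⇒> y≰σ))) (out-box (ℕ.≰⇒> x≰ρ) (ℕ.≰⇒> y≰σ))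

  -- S t is the coefficient of x^t in Φ_pq(x^r) / (1 - x^(pq)).
  s : ℕ → ℕ → ℤ → ℤ
  s x y z = box x y (b z) (b (z + + r))

  S : Seq
  S = lift s

  private
    shift-r : ∀ z → z - + r + + r ≡ z
    shift-r z = ((∀ z r → z - r + r ≡ z) ∋ solve-∀) z (+ r)

    -- The differences of `s` in the first direction and then in the second: the first leaves only
    -- the edges x = 0 and x = ρ + 1, the second only the corners (0, 0) and (ρ + 1, σ + 1).
    V W : ℕ → ℕ → ℤ → ℤ
    V x y z = - (eq x 0 * b z) + eq x (suc ρ) * (le y σ * b z + (+ 1 - le y σ) * b (z + + r))
    W x y z = eq x 0 * eq y 0 * (b z - b (z - + r)) - eq x (suc ρ) * eq y (suc σ) * (b (z + + r) - b z)

    difference-x : act (e (p ℕ.* r)) S ≗ lift V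
    difference-x = on-values _ λ x y z x<q y<p → trans (act-e (p ℕ.* r) (ℕ.*-mono-≤ 0<p 0<r) S (value x y z))
      (trans (step x y z x<q y<p) (sym (lift-value V x y z x<q y<p)))
      where
      step : ∀ x y z → x ℕ.< q → y ℕ.< p → S (value x y z - + (p ℕ.* r)) - S (value x y z) ≡ V x y z
      -- The neighbour of x = 0 is `pred q`, beyond `ρ`, with third coordinate `z - r`. There the
      -- opposite box has threshold `z - r + r = z`, so it joins the positive box seamlessly and
      -- only `- b z` remains.
      step zero y z x<q y<p = trans
        (cong₂ _-_ (trans (cong S (value-zero-x y z)) (lift-value s (pred q) y (z - + r) (pred< 0<q) y<p))
          (lift-value s 0 y z x<q y<p))
        (trans (cong₂ (λ a z′ → a * le y σ * b (z - + r) - (+ 1 - a) * (+ 1 - le y σ) * b z′ - s 0 y z)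
          (le-no (<-pred ρ<q)) (shift-r z))
        (((∀ c b b′ b″ → + 0 * c * b′ - (+ 1 - + 0) * (+ 1 - c) * b - (+ 1 * c * b - (+ 1 - + 1) * (+ 1 - c) * b″)
            ≡ - (+ 1 * b) + + 0 * (c * b + (+ 1 - c) * b″)) ∋ solve-∀) (le y σ) (b z) (b (z - + r)) (b (z + + r))))
      step (suc x) y z x<q y<p = trans
        (cong₂ _-_ (trans (cong S (value-suc-x x y z)) (lift-value s x y z (ℕ.<-trans ℕ.≤-refl x<q) y<p))
          (lift-value s (suc x) y z x<q y<p))
        (trans (((∀ a a′ c b b″ → a * c * b - (+ 1 - a) * (+ 1 - c) * b″ - (a′ * c * b - (+ 1 - a′) * (+ 1 - c) * b″)
            ≡ - (+ 0 * b) + (a - a′) * (c * b + (+ 1 - c) * b″)) ∋ solve-∀) (le x ρ) (le (suc x) ρ) (le y σ) (b z)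
              (b (z + + r)))
        (cong (λ i → - (+ 0 * b z) + i * (le y σ * b z + (+ 1 - le y σ) * b (z + + r))) (le-step x ρ)))

    difference-y : act (e (q ℕ.* r)) (lift V) ≗ lift W
    difference-y = on-values _ λ x y z x<q y<p → trans (act-e (q ℕ.* r) (ℕ.*-mono-≤ 0<q 0<r) (lift V) (value x y z))
      (trans (step x y z x<q y<p) (sym (lift-value W x y z x<q y<p)))
      where
      step : ∀ x y z → x ℕ.< q → y ℕ.< p → lift V (value x y z - + (q ℕ.* r)) - lift V (value x y z) ≡ W x y z
      step x zero z x<q y<p = trans
        (cong₂ _-_ (trans (cong (lift V) (value-zero-y x z)) (lift-value V x (pred p) (z - + r) x<q (pred< 0<p)))
          (lift-value V x 0 z x<q y<p))
        (trans (cong₂ (λ c z′ → - (eq x 0 * b (z - + r)) + eq x (suc ρ) * (c * b (z - + r) + (+ 1 - c) * b z′) - V x 0 z)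
          (le-no (<-pred σ<p)) (shift-r z))
        (((∀ i j b b′ b″ → - (i * b′) + j * (+ 0 * b′ + (+ 1 - + 0) * b) - (- (i * b) + j * (+ 1 * b + (+ 1 - + 1) * b″))
            ≡ i * + 1 * (b - b′) - j * + 0 * (b″ - b)) ∋ solve-∀)
          (eq x 0) (eq x (suc ρ)) (b z) (b (z - + r)) (b (z + + r))))
      step x (suc y) z x<q y<p = trans
        (cong₂ _-_ (trans (cong (lift V) (value-suc-y x y z)) (lift-value V x y z x<q (ℕ.<-trans ℕ.≤-refl y<p)))
          (lift-value V x (suc y) z x<q y<p))
        (trans (((∀ i j c c′ b b′ b″ → - (i * b) + j * (c * b + (+ 1 - c) * b″) - (- (i * b) + j * (c′ * b +
          (+ 1 - c′) * b″))
            ≡ i * + 0 * (b - b′) - j * (c - c′) * (b″ - b)) ∋ solve-∀)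
          (eq x 0) (eq x (suc ρ)) (le y σ) (le (suc y) σ) (b z) (b (z - + r)) (b (z + + r)))
        (cong (λ i → eq x 0 * + 0 * (b z - b (z - + r)) - eq x (suc ρ) * i * (b (z + + r) - b z)) (le-step y σ)))

  b-step : ∀ z → b z - b (z - + 1) ≡ δ z
  b-step (+ zero)  = refl
  b-step (+ suc n) = refl
  b-step -[1+ n ]  = refl

  δ-≢ : ∀ {t} → ¬ t ≡ + 0 → δ t ≡ + 0
  δ-≢ {+ zero}    t≢0 = contradiction refl t≢0
  δ-≢ {+ suc n}   _   = refl
  δ-≢ { -[1+ n ]} _   = refl

  δ-pq : ∀ z → δ (+ p * + q * z) ≡ δ z
  δ-pq z with z ℤ.≟ + 0
  ... | yes refl = cong δ (ℤ.*-zeroʳ (+ p * + q))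
  ... | no z≢0   = trans (δ-≢ λ pqz≡0 → z≢0 (ℤ.*-cancelˡ-≡ (+ (p ℕ.* q)) z (+ 0)
      (trans (cong (_* z) (ℤ.pos-* p q)) (trans pqz≡0 (sym (ℤ.*-zeroʳ (+ (p ℕ.* q)))))))) (sym (δ-≢ z≢0))

  δ-value : ∀ {x y x′ y′} z z′ → x ℕ.< q → y ℕ.< p → x′ ℕ.< q → y′ ℕ.< p →
    δ (value x y z - value x′ y′ z′) ≡ eq x x′ * eq y y′ * δ (z - z′)
  δ-value {x} {y} {x′} {y′} z z′ x<q y<p x′<q y′<p with x ℕ.≟ x′ | y ℕ.≟ y′
  ... | no x≢ | _ rewrite eq-≢ x≢ = δ-≢ λ t≡0 →
    x≢ (proj₁ (value-injective x<q y<p x′<q y′<p (ℤ.i-j≡0⇒i≡j _ _ t≡0)))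
  ... | yes _ | no y≢ rewrite eq-≢ y≢ = trans (δ-≢ λ t≡0 →
    y≢ (proj₁ (proj₂ (value-injective x<q y<p x′<q y′<p (ℤ.i-j≡0⇒i≡j _ _ t≡0)))))
    (sym (cong (_* δ (z - z′)) (ℤ.*-zeroʳ (eq x x′))))
  ... | yes refl | yes refl rewrite eq-refl x | eq-refl y = trans (trans (cong δ (trans (cong₂ _-_
      (value-def x y z) (value-def x y z′))
      (((∀ c d z z′ → c + d * z - (c + d * z′) ≡ d * (z - z′)) ∋ solve-∀) (+ r * (+ p * + x + + q * + y)) (+ p * + q) z z′)))
      (δ-pq (z - z′))) (sym (ℤ.*-identityˡ _))

  private
    n = p ℕ.* q ℕ.* r

    pos-n : + n ≡ + p * + q * + r
    pos-n = trans (ℤ.pos-* (p ℕ.* q) r) (cong (_* + r) (ℤ.pos-* p q))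

    -- The corners left by `W` have values 0, `r`, `n` and `r + n`, the exponents of the numerator
    -- (x^r - 1)(x^n - 1).
    value-0 : value 0 0 (+ 0) ≡ + 0
    value-0 = trans (value-def 0 0 (+ 0)) (((∀ p q r → r * (p * + 0 + q * + 0) + p * q * + 0 ≡ + 0) ∋ solve-∀)
        (+ p) (+ q) (+ r))

    value-r : value (suc ρ) (suc σ) (- + r) ≡ + r
    value-r = trans (value-def (suc ρ) (suc σ) (- + r)) (by-≡ (+ r) ident (((∀ p q r x y → r *
        (p * x + q * y) + p * q * - r ≡ r + (p * x + q * y - (+ 1 + p * q)) * r) ∋ solve-∀)
      (+ p) (+ q) (+ r) (+ suc ρ) (+ suc σ)))

    value-n : value 0 0 (+ r) ≡ + n
    value-n = trans (value-def 0 0 (+ r)) (trans (((∀ p q r → r *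
        (p * + 0 + q * + 0) + p * q * r ≡ p * q * r) ∋ solve-∀) (+ p) (+ q) (+ r)) (sym pos-n))

    value-r+n : value (suc ρ) (suc σ) (+ 0) ≡ + r + + n
    value-r+n = trans (value-def (suc ρ) (suc σ) (+ 0)) (trans (by-≡ (+ r) ident
      (((∀ p q r x y → r * (p * x + q * y) + p * q * + 0 ≡ r + p * q * r + (p * x + q * y - (+ 1 + p * q)) * r) ∋ solve-∀)
        (+ p) (+ q) (+ r) (+ suc ρ) (+ suc σ))) (cong (_+_ (+ r)) (sym pos-n)))

    difference-z : act (e (p ℕ.* q)) (lift W) ≗ λ t → - act (e r) (act (e n) δ) t
    difference-z = on-values _ step
      where
      open ≡-Reasoning
      step : ∀ x y z → x ℕ.< q → y ℕ.< p → act (e (p ℕ.* q)) (lift W) (value x y z) ≡ - act (e r) (act (e n) δ) (value x y z)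
      step x y z x<q y<p = begin
        act (e (p ℕ.* q)) (lift W) t
          ≡⟨ act-e (p ℕ.* q) (ℕ.*-mono-≤ 0<p 0<q) (lift W) t ⟩
        lift W (t - + (p ℕ.* q)) - lift W t
          ≡⟨ cong₂ _-_ (trans (cong (lift W) (value-z x y z)) (lift-value W x y (z - + 1) x<q y<p))
            (lift-value W x y z x<q y<p) ⟩
        W x y (z - + 1) - W x y z
          ≡⟨ ((∀ i j b0 br bm b0′ br′ bm′ → i * (b0′ - bm′) - j * (br′ - b0′) - (i * (b0 - bm) - j * (br - b0))
               ≡ i * (bm - bm′) - j * (b0 - b0′) - (i * (b0 - b0′) - j * (br - br′))) ∋ solve-∀)
               (eq x 0 * eq y 0) (eq x (suc ρ) * eq y (suc σ)) (b z) (b (z + + r)) (b (z - + r))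
               (b (z - + 1)) (b (z - + 1 + + r)) (b (z - + 1 - + r)) ⟩
        I * (b (z - + r) - b (z - + 1 - + r)) - J * (b z - b (z - + 1)) - (I * (b z - b (z - + 1)) - J * (b
          (z + + r) - b (z - + 1 + + r)))
          ≡⟨ cong₂ _-_ (cong₂ (λ β γ → I * β - J * γ) (b-step′ (z - + r) _ (swap₁ z (+ r))) (b-step″ z))
               (cong₂ (λ β γ → I * β - J * γ) (b-step″ z) (trans (b-step′ (z + + r) _ (swap₂ z (+ r))) (cong (λ c
                 → δ (z + c)) (sym (ℤ.neg-involutive (+ r)))))) ⟩
        I * δ (z - + r) - J * δ (z - + 0) - (I * δ (z - + 0) - J * δ (z - - + r))
          ≡⟨ cong₂ _-_
               (cong₂ _-_ (at 0 0 (+ r) value-n 0<q 0<p) (at (suc ρ) (suc σ) (+ 0) value-r+n ρ<q σ<p))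
               (cong₂ _-_ (at 0 0 (+ 0) value-0 0<q 0<p)
                 (at (suc ρ) (suc σ) (- + r) value-r ρ<q σ<p)) ⟩
        δ (t - + n) - δ (t - (+ r + + n)) - (δ (t - + 0) - δ (t - + r))
          ≡⟨ cong₂ (λ β γ → δ (t - + n) - δ β - (δ γ - δ (t - + r))) (((∀ t r n → t -
            (r + n) ≡ t - r - n) ∋ solve-∀) t (+ r) (+ n)) (ℤ.+-identityʳ t) ⟩
        δ (t - + n) - δ (t - + r - + n) - (δ t - δ (t - + r))
          ≡⟨ ((∀ a b c d → a - b - (c - d) ≡ - (b - d - (a - c))) ∋ solve-∀) (δ (t - + n)) (δ (t - + r - + n))
            (δ t) (δ (t - + r)) ⟩
        - (δ (t - + r - + n) - δ (t - + r) - (δ (t - + n) - δ t))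
          ≡⟨ cong -_ (trans (act-e r 0<r (act (e n) δ) t) (cong₂ _-_ (act-e n 0<n δ (t - + r)) (act-e n 0<n δ t))) ⟨
        - act (e r) (act (e n) δ) t ∎
        where
        t = value x y z
        I = eq x 0 * eq y 0
        J = eq x (suc ρ) * eq y (suc σ)
        0<n : 0 ℕ.< n
        0<n = ℕ.*-mono-≤ (ℕ.*-mono-≤ 0<p 0<q) 0<r
        swap₁ : ∀ z r → z - + 1 - r ≡ z - r - + 1
        swap₁ = solve-∀
        swap₂ : ∀ z r → z - + 1 + r ≡ z + r - + 1
        swap₂ = solve-∀
        b-step′ : ∀ z z′ → z′ ≡ z - + 1 → b z - b z′ ≡ δ z
        b-step′ z _ refl = b-step z
        b-step″ : ∀ z → b z - b (z - + 1) ≡ δ (z - + 0)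
        b-step″ z = trans (b-step z) (cong δ (sym (ℤ.+-identityʳ z)))
        at : ∀ x′ y′ z′ {c} → value x′ y′ z′ ≡ c → x′ ℕ.< q → y′ ℕ.< p → eq x x′ * eq y y′ * δ (z - z′) ≡ δ (t - c)
        at x′ y′ z′ refl x′<q y′<p = sym (δ-value z z′ x<q y<p x′<q y′<p)

  -- Since Φ_pq(x^r) = (x^r - 1)(x^(pqr) - 1) / ((x^(pr) - 1)(x^(qr) - 1)), this says that `S` is
  -- Φ_pq(x^r) / (1 - x^(pq)). Taken at `r = 1` it yields Φ_pq itself.
  S-equation : act (e (p ℕ.* q)) (act (e (q ℕ.* r)) (act (e (p ℕ.* r)) S)) ≗ λ t → - act (e r) (act (e (p ℕ.* q ℕ.* r)) δ) t
  S-equation t = trans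
    (act-cong (e (p ℕ.* q)) (λ k → trans (act-cong (e (q ℕ.* r)) difference-x k) (difference-y k)) t) (difference-z t)

  value-≥ : ∀ x y {z} → + 0 ≤ z → + 0 ≤ value x y z
  value-≥ x y {z} 0≤z = subst (+ 0 ≤_) (sym (value-def x y z))
    (0≤+ r ⊗ (0≤+ p ⊗ 0≤+ x ⊕ 0≤+ q ⊗ 0≤+ y) ⊕ 0≤+ p ⊗ 0≤+ q ⊗ 0≤z)

  -- The least point of this region is the corner (ρ + 1, σ + 1, -r), whose value is `r`.
  value-≥r : ∀ {x y z} → ρ ℕ.< x → σ ℕ.< y → + 0 ≤ z + + r → + r ≤ value x y z
  value-≥r {x} {y} {z} ρ<x σ<y 0≤z+r = subst (+ r ≤_) (sym (value-def x y z))
    (by-≤ {d = + r * (+ p * (+ x - + suc ρ) + + q * (+ y - + suc σ)) + + p * + q * (z + + r)}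
      (0≤+ r ⊗ (0≤+ p ⊗ gap (+≤+ ρ<x) ⊕ 0≤+ q ⊗ gap (+≤+ σ<y)) ⊕ 0≤+ p ⊗ 0≤+ q ⊗ 0≤z+r)
      (by-≡ (+ r) ident (((∀ p q r x y z x′ y′ → r * (p * x + q * y) + p * q * z
          ≡ r + (r * (p * (x - x′) + q * (y - y′)) + p * q * (z + r)) + (p * x′ + q * y′ - (+ 1 + p * q)) * r) ∋ solve-∀)
        (+ p) (+ q) (+ r) (+ x) (+ y) z (+ suc ρ) (+ suc σ))))

  b-zero : ∀ {z} → ¬ + 0 ≤ z → b z ≡ + 0
  b-zero z≱0 = b-no (ℤ.≰⇒> z≱0)

  S-negative : ∀ t → t < + 0 → S t ≡ + 0
  S-negative = on-values _ λ x y z x<q y<p t<0 → trans (lift-value s x y z x<q y<p)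
    (box-cases (b z) (b (z + + r)) (_≡ + 0)
      (λ _ _ → b-zero λ 0≤z → ℤ.<⇒≱ t<0 (value-≥ x y 0≤z))
      (λ ρ<x σ<y → cong -_ (b-zero λ 0≤z+r → ℤ.<⇒≱ t<0 (ℤ.≤-trans (0≤+ r) (value-≥r {x} {y} ρ<x σ<y 0≤z+r))))
      refl)

  S-causal : Causal S
  S-causal n = S-negative -[1+ n ] -<+

  s-difference : ∀ x y z → s x y z - s x y (z - + 1) ≡ le x ρ * le y σ * δ z - (+ 1 - le x ρ) * (+ 1 - le y σ) * δ (z + + r)
  s-difference x y z = trans
    (((∀ a c β β′ γ γ′ → a * c * β - (+ 1 - a) * (+ 1 - c) * γ - (a * c * β′ - (+ 1 - a) * (+ 1 - c) * γ′)
        ≡ a * c * (β - β′) - (+ 1 - a) * (+ 1 - c) * (γ - γ′)) ∋ solve-∀)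
      (le x ρ) (le y σ) (b z) (b (z - + 1)) (b (z + + r)) (b (z - + 1 + + r)))
    (cong₂ (λ d d′ → le x ρ * le y σ * d - (+ 1 - le x ρ) * (+ 1 - le y σ) * d′) (b-step z)
      (trans (cong (λ j → b (z + + r) - b j) (((∀ z r → z - + 1 + r ≡ z + r - + 1) ∋ solve-∀) z (+ r))) (b-step (z + + r))))

  private
    zero-product : ∀ {a c d : ℤ} → (a ≡ + 0) ⊎ (c ≡ + 0) ⊎ (d ≡ + 0) → a * c * d ≡ + 0
    zero-product                 (inj₁ refl)        = refl
    zero-product {a} {d = d}     (inj₂ (inj₁ refl)) = cong (_* d) (ℤ.*-zeroʳ a)
    zero-product {a} {c}         (inj₂ (inj₂ refl)) = ℤ.*-zeroʳ (a * c)

    in-zero : ∀ x y {d} → (x ℕ.≤ ρ → y ℕ.≤ σ → d ≡ + 0) → le x ρ * le y σ * d ≡ + 0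
    in-zero x y {d} d≡0 = zero-product {le x ρ} {le y σ} (cases (x ℕ.≤? ρ) (y ℕ.≤? σ))
      where
      cases : Dec (x ℕ.≤ ρ) → Dec (y ℕ.≤ σ) → (le x ρ ≡ + 0) ⊎ (le y σ ≡ + 0) ⊎ (d ≡ + 0)
      cases (no x≰ρ) _          = inj₁ (le-no (ℕ.≰⇒> x≰ρ))
      cases _ (no y≰σ)          = inj₂ (inj₁ (le-no (ℕ.≰⇒> y≰σ)))
      cases (yes x≤ρ) (yes y≤σ) = inj₂ (inj₂ (d≡0 x≤ρ y≤σ))

    out-zero : ∀ x y {d} → (ρ ℕ.< x → σ ℕ.< y → d ≡ + 0) → (+ 1 - le x ρ) * (+ 1 - le y σ) * d ≡ + 0
    out-zero x y {d} d≡0 = zero-product {+ 1 - le x ρ} {+ 1 - le y σ} (cases (x ℕ.≤? ρ) (y ℕ.≤? σ))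
      where
      cases : Dec (x ℕ.≤ ρ) → Dec (y ℕ.≤ σ) → (+ 1 - le x ρ ≡ + 0) ⊎ (+ 1 - le y σ ≡ + 0) ⊎ (d ≡ + 0)
      cases (yes x≤ρ) _         = inj₁ (cong (_-_ (+ 1)) (le-yes x≤ρ))
      cases _ (yes y≤σ)         = inj₂ (inj₁ (cong (_-_ (+ 1)) (le-yes y≤σ)))
      cases (no x≰ρ) (no y≰σ)   = inj₂ (inj₂ (d≡0 (ℕ.≰⇒> x≰ρ) (ℕ.≰⇒> y≰σ)))

  -- The difference is the coefficient sequence of Φ_pq(x^r), supported on z = 0 in the positive box
  -- and z = -r in the opposite one; the bound is its degree r (p - 1)(q - 1).
  S-difference-zero : ∀ t → + r * (+ p * + q - + p - + q + + 1) < t → S t - S (t - + (p ℕ.* q)) ≡ + 0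
  S-difference-zero = on-values _ λ x y z x<q y<p φ<t → trans
    (cong₂ _-_ (lift-value s x y z x<q y<p) (trans (cong S (value-z x y z)) (lift-value s x y (z - + 1) x<q y<p)))
    (trans (s-difference x y z) (cong₂ _-_
      (in-zero x y λ x≤ρ y≤σ → δ-≢ λ z≡0 → ℤ.<⇒≱ φ<t (low x y z x≤ρ y≤σ z≡0))
      (out-zero x y λ _ _ → δ-≢ λ z+r≡0 → ℤ.<⇒≱ φ<t (high x y z x<q y<p z+r≡0))))
    where
    low : ∀ x y z → x ℕ.≤ ρ → y ℕ.≤ σ → z ≡ + 0 → value x y z ≤ + r * (+ p * + q - + p - + q + + 1)
    low x y z x≤ρ y≤σ z≡0 = subst (_≤ + r * (+ p * + q - + p - + q + + 1)) (sym (value-def x y z))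
      (by-≤ {d = + r * (+ p * (+ ρ - + x) + + q * (+ σ - + y))}
        (0≤+ r ⊗ (0≤+ p ⊗ gap (+≤+ x≤ρ) ⊕ 0≤+ q ⊗ gap (+≤+ y≤σ)))
        (by-≡ (- + r) ident (by-≡ (- (+ p * + q)) z≡0
          (((∀ p q r x y z ρ σ → r * (p * q - p - q + + 1) ≡ r * (p * x + q * y) + p * q * z + r * (p *
            (ρ - x) + q * (σ - y))
            + (p * (+ 1 + ρ) + q * (+ 1 + σ) - (+ 1 + p * q)) * - r + (z - + 0) * - (p * q)) ∋ solve-∀)
            (+ p) (+ q) (+ r) (+ x) (+ y) z (+ ρ) (+ σ)))))
    high : ∀ x y z → x ℕ.< q → y ℕ.< p → z + + r ≡ + 0 → value x y z ≤ + r * (+ p * + q - + p - + q + + 1)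
    high x y z x<q y<p z+r≡0 = subst (_≤ + r * (+ p * + q - + p - + q + + 1)) (sym (value-def x y z))
      (by-≤ {d = + r * (+ p * (+ q - + suc x) + + q * (+ p - + suc y) + + 1)}
        (0≤+ r ⊗ (0≤+ p ⊗ gap (+≤+ x<q) ⊕ 0≤+ q ⊗ gap (+≤+ y<p) ⊕ 0≤+ 1))
        (by-≡ (- (+ p * + q)) z+r≡0
          (((∀ p q r x y z → r * (p * q - p - q + + 1) ≡ r * (p * x + q * y) + p * q * z + r * (p * (q -
            (+ 1 + x)) + q * (p - (+ 1 + y)) + + 1)
            + (z + r - + 0) * - (p * q)) ∋ solve-∀) (+ p) (+ q) (+ r) (+ x) (+ y) z)))

  -- Kaplan's lemma and coefficient bounds valid for every r.

  module Kaplan (p+q<pq : p ℕ.+ q ℕ.< p ℕ.* q) where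

    Bit : ℤ → Set
    Bit v = + 0 ≤ v × v ≤ + 1

    bit-0 : Bit (+ 0)
    bit-0 = +≤+ ℕ.z≤n , +≤+ ℕ.z≤n

    bit-b : ∀ t → Bit (b t)
    bit-b (+ n)    = +≤+ ℕ.z≤n , ℤ.≤-refl
    bit-b -[1+ n ] = bit-0

    bit-b-difference : ∀ {t t′} → t′ ≤ t → Bit (b t - b t′)
    bit-b-difference {+ n}      {+ m}      _  = bit-0
    bit-b-difference {+ n}      { -[1+ m ]} _ = +≤+ ℕ.z≤n , ℤ.≤-refl
    bit-b-difference { -[1+ n ]} { -[1+ m ]} _ = bit-0

    bit-resp : ∀ {v w} → v ≡ w → Bit w → Bit v
    bit-resp refl bw = bw

    b-window : ∀ {N} i z → + i < N → b (+ i + N * z) ≡ b z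
    b-window {N} i (+ z) i<N = b-yes (0≤+ i ⊕ ℤ.≤-trans (0≤+ i) (ℤ.<⇒≤ i<N) ⊗ 0≤+ z)
    b-window {N} i -[1+ z ] i<N = b-no (by-< (gap< i<N ⊕ ℤ.≤-trans (0≤+ i) (ℤ.<⇒≤ i<N) ⊗ 0≤+ z)
      (((∀ i N z → + 0 ≡ i + N * (- (+ 1 + z)) + + 1 + (N - i - + 1 + N * z)) ∋ solve-∀) (+ i) N (+ z)))

    abstract
      offset : ℤ → ℕ → ℕ → ℤ
      offset k x y = k - + r * (+ p * + x + + q * + y)

      offset-def : ∀ k x y → offset k x y ≡ k - + r * (+ p * + x + + q * + y)
      offset-def k x y = refl

    -- Kaplan's lemma: within a window shorter than pq, the threshold deciding whether a term contributes
    -- may be taken at the common end k of the window.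
    abstract
      G : ℤ → ℕ → ℕ → ℤ
      G k x y = box x y (b (offset k x y)) (b (offset k x y + + p * + q * + r))

      G-def : ∀ k x y → G k x y ≡ box x y (b (offset k x y)) (b (offset k x y + + p * + q * + r))
      G-def k x y = refl

    -- At the point of `k - i` the offset from `k` is `i + p q z`, which has the sign of `z` because
    -- 0 ≤ i < p q.
    S-at : ∀ k i → i ℕ.< p ℕ.* q → S (k - + i) ≡ G k (X (k - + i)) (Y (k - + i))
    S-at k i i<pq = trans (cong₂ (box x y)
      (trans (sym (b-window i z i<N)) (cong b (sym offset≡)))
      (trans (sym (b-window i (z + + r) i<N)) (cong b (trans
        (((∀ i p q r z → i + p * q * (z + r) ≡ i + p * q * z + p * q * r) ∋ solve-∀) (+ i) (+ p) (+ q) (+ r) z)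
        (cong (_+ + p * + q * + r) (sym offset≡)))))) (sym (G-def k x y))
      where
      x = X (k - + i)
      y = Y (k - + i)
      z = Z (k - + i)
      i<N : + i < + p * + q
      i<N = subst (+ i <_) (ℤ.pos-* p q) (+<+ i<pq)
      offset≡ : offset k x y ≡ + i + + p * + q * z
      offset≡ = trans (offset-def k x y) (by-≡ (+ 1) (trans (value-coords (k - + i)) (value-def x y z))
        (((∀ p q r k i x y z → k - r * (p * x + q * y) ≡ i + p * q * z + (k - i - (r *
          (p * x + q * y) + p * q * z)) * + 1) ∋ solve-∀)
          (+ p) (+ q) (+ r) k (+ i) (+ x) (+ y) z))

    module _ (k : ℤ) where

      private
        α β : ℕ → ℕ → ℤ
        α x y = b (offset k x y)
        β x y = b (offset k x y + + p * + q * + r)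

      offset-mono : ∀ {x x′ y y′} → x ℕ.≤ x′ → y ℕ.≤ y′ → offset k x′ y′ ≤ offset k x y
      offset-mono {x} {x′} {y} {y′} x≤x′ y≤y′ = subst₂ _≤_ (sym (offset-def k x′ y′)) (sym (offset-def k x y))
          (by-≤ (0≤+ r ⊗ (0≤+ p ⊗ gap (+≤+ x≤x′) ⊕ 0≤+ q ⊗ gap (+≤+ y≤y′)))
        (((∀ p q r k x x′ y y′ → k - r * (p * x + q * y) ≡ k - r * (p * x′ + q * y′) + r * (p * (x′ - x) + q *
          (y′ - y))) ∋ solve-∀)
          (+ p) (+ q) (+ r) k (+ x) (+ x′) (+ y) (+ y′)))

      α-bit : ∀ {x x′ y y′} → x ℕ.≤ x′ → y ℕ.≤ y′ → Bit (α x y - α x′ y′)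
      α-bit x≤x′ y≤y′ = bit-b-difference (offset-mono x≤x′ y≤y′)

      -β-bit : ∀ {x x′ y y′} → x ℕ.≤ x′ → y ℕ.≤ y′ → Bit (- β x′ y′ - - β x y)
      -β-bit {x} {x′} {y} {y′} x≤x′ y≤y′ = bit-resp (((∀ m n → - m - - n ≡ n - m) ∋ solve-∀) (β x′ y′) (β x y))
        (bit-b-difference (ℤ.+-monoˡ-≤ (+ p * + q * + r) (offset-mono x≤x′ y≤y′)))

      private
        with-values : ∀ {x y x′ y′ m n} → G k x y ≡ m → G k x′ y′ ≡ n → Bit (m - n) → Bit (G k x y - G k x′ y′)
        with-values refl refl h = h

        in-value : ∀ {x y} → x ℕ.≤ ρ → y ℕ.≤ σ → G k x y ≡ α x y
        in-value {x} {y} h₁ h₂ = trans (G-def k x y) (box-in (α x y) (β x y) h₁ h₂)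
        out-value : ∀ {x y} → ρ ℕ.< x → σ ℕ.< y → G k x y ≡ - β x y
        out-value {x} {y} h₁ h₂ = trans (G-def k x y) (box-out (α x y) (β x y) h₁ h₂)
        above-value : ∀ {x y} → x ℕ.≤ ρ → σ ℕ.< y → G k x y ≡ + 0
        above-value {x} {y} h₁ h₂ = trans (G-def k x y) (box-above (α x y) (β x y) h₁ h₂)
        right-value : ∀ {x y} → ρ ℕ.< x → y ℕ.≤ σ → G k x y ≡ + 0
        right-value {x} {y} h₁ h₂ = trans (G-def k x y) (box-right (α x y) (β x y) h₁ h₂)

        α-0 : ∀ x y → Bit (α x y - + 0)
        α-0 x y = bit-resp (ℤ.+-identityʳ (α x y)) (bit-b (offset k x y))
        0-β : ∀ x y → Bit (+ 0 - - β x y)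
        0-β x y = bit-resp (((∀ m → + 0 - - m ≡ m) ∋ solve-∀) (β x y)) (bit-b (offset k x y + + p * + q * + r))

      -- With the next two lemmas this orders the rows: `G` decreases for y ≤ σ, increases above
      -- `σ`, and low rows dominate high ones. The order is the same for all `k` and `x`, which is
      -- why `E` can depend on the row alone.
      row-low : ∀ x {y y′} → y ℕ.≤ y′ → y′ ℕ.≤ σ → Bit (G k x y - G k x y′)
      row-low x {y} {y′} y≤y′ y′≤σ = cases (x ℕ.≤? ρ)
        where
        cases : Dec (x ℕ.≤ ρ) → Bit (G k x y - G k x y′)
        cases (yes x≤ρ) = with-values (in-value x≤ρ (ℕ.≤-trans y≤y′ y′≤σ)) (in-value x≤ρ y′≤σ) (α-bit ℕ.≤-refl y≤y′)
        cases (no x≰ρ)  = with-values (right-value (ℕ.≰⇒> x≰ρ) (ℕ.≤-trans y≤y′ y′≤σ)) (right-value (ℕ.≰⇒> x≰ρ) y′≤σ) bit-0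

      row-high : ∀ x {y y′} → y ℕ.≤ y′ → σ ℕ.< y → Bit (G k x y′ - G k x y)
      row-high x {y} {y′} y≤y′ σ<y = cases (x ℕ.≤? ρ)
        where
        cases : Dec (x ℕ.≤ ρ) → Bit (G k x y′ - G k x y)
        cases (yes x≤ρ) = with-values (above-value x≤ρ (ℕ.<-≤-trans σ<y y≤y′)) (above-value x≤ρ σ<y) bit-0
        cases (no x≰ρ)  = with-values (out-value (ℕ.≰⇒> x≰ρ) (ℕ.<-≤-trans σ<y y≤y′)) (out-value (ℕ.≰⇒> x≰ρ) σ<y)
            (-β-bit ℕ.≤-refl y≤y′)

      row-cross : ∀ x {y y′} → y ℕ.≤ σ → σ ℕ.< y′ → Bit (G k x y - G k x y′)
      row-cross x {y} {y′} y≤σ σ<y′ = cases (x ℕ.≤? ρ)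
        where
        cases : Dec (x ℕ.≤ ρ) → Bit (G k x y - G k x y′)
        cases (yes x≤ρ) = with-values (in-value x≤ρ y≤σ) (above-value x≤ρ σ<y′) (α-0 x y)
        cases (no x≰ρ)  = with-values (right-value (ℕ.≰⇒> x≰ρ) y≤σ) (out-value (ℕ.≰⇒> x≰ρ) σ<y′) (0-β x y′)

      private
        column-left : ∀ {x x′} → x ℕ.≤ x′ → x′ ℕ.≤ ρ → ∀ y → Bit (G k x y - G k x′ y)
        column-left {x} {x′} x≤x′ x′≤ρ y = cases (y ℕ.≤? σ)
          where
          cases : Dec (y ℕ.≤ σ) → Bit (G k x y - G k x′ y)
          cases (yes y≤σ) = with-values (in-value (ℕ.≤-trans x≤x′ x′≤ρ) y≤σ) (in-value x′≤ρ y≤σ) (α-bit x≤x′ ℕ.≤-refl)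
          cases (no y≰σ)  = with-values (above-value (ℕ.≤-trans x≤x′ x′≤ρ) (ℕ.≰⇒> y≰σ)) (above-value x′≤ρ (ℕ.≰⇒> y≰σ)) bit-0

        column-right : ∀ {x x′} → x ℕ.≤ x′ → ρ ℕ.< x → ∀ y → Bit (G k x′ y - G k x y)
        column-right {x} {x′} x≤x′ ρ<x y = cases (y ℕ.≤? σ)
          where
          cases : Dec (y ℕ.≤ σ) → Bit (G k x′ y - G k x y)
          cases (yes y≤σ) = with-values (right-value (ℕ.<-≤-trans ρ<x x≤x′) y≤σ) (right-value ρ<x y≤σ) bit-0
          cases (no y≰σ)  = with-values (out-value (ℕ.<-≤-trans ρ<x x≤x′) (ℕ.≰⇒> y≰σ)) (out-value ρ<x (ℕ.≰⇒> y≰σ))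
              (-β-bit x≤x′ ℕ.≤-refl)

        column-cross : ∀ {x x′} → x ℕ.≤ ρ → ρ ℕ.< x′ → ∀ y → Bit (G k x y - G k x′ y)
        column-cross {x} {x′} x≤ρ ρ<x′ y = cases (y ℕ.≤? σ)
          where
          cases : Dec (y ℕ.≤ σ) → Bit (G k x y - G k x′ y)
          cases (yes y≤σ) = with-values (in-value x≤ρ y≤σ) (right-value ρ<x′ y≤σ) (α-0 x y)
          cases (no y≰σ)  = with-values (above-value x≤ρ (ℕ.≰⇒> y≰σ)) (out-value ρ<x′ (ℕ.≰⇒> y≰σ)) (0-β x′ y)

      -- Which of two columns dominates does not depend on the row. A mixed second difference is
      -- therefore a difference of two bits, up to sign.
      column : ∀ x x′ → (∀ y → Bit (G k x y - G k x′ y)) ⊎ (∀ y → Bit (G k x′ y - G k x y))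
      column x x′ with ℕ.≤-total x x′ | x ℕ.≤? ρ | x′ ℕ.≤? ρ
      ... | inj₁ x≤x′ | _       | yes x′≤ρ = inj₁ (column-left x≤x′ x′≤ρ)
      ... | inj₁ x≤x′ | yes x≤ρ | no x′≰ρ  = inj₁ (column-cross x≤ρ (ℕ.≰⇒> x′≰ρ))
      ... | inj₁ x≤x′ | no x≰ρ  | no _     = inj₂ (column-right x≤x′ (ℕ.≰⇒> x≰ρ))
      ... | inj₂ x′≤x | yes x≤ρ | _        = inj₂ (column-left x′≤x x≤ρ)
      ... | inj₂ x′≤x | no x≰ρ  | yes x′≤ρ = inj₂ (column-cross x′≤ρ (ℕ.≰⇒> x≰ρ))
      ... | inj₂ x′≤x | no _    | no x′≰ρ  = inj₁ (column-right x′≤x (ℕ.≰⇒> x′≰ρ))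

      mixed-difference : ∀ x x′ y y′ → - + 1 ≤ G k x y - G k x′ y - (G k x y′ - G k x′ y′) × G k x y - G k x′ y -
          (G k x y′ - G k x′ y′) ≤ + 1
      mixed-difference x x′ y y′ = cases (column x x′)
        where
        bits : ∀ {m n : ℤ} → Bit m → Bit n → - + 1 ≤ m - n × m - n ≤ + 1
        bits {m} {n} (0≤m , m≤1) (0≤n , n≤1) =
          by-≤ (0≤m ⊕ gap n≤1) (((∀ m n → m - n ≡ - + 1 + (m + (+ 1 - n))) ∋ solve-∀) m n) ,
          by-≤ (0≤n ⊕ gap m≤1) (((∀ m n → + 1 ≡ m - n + (n + (+ 1 - m))) ∋ solve-∀) m n)
        cases : (∀ y → Bit (G k x y - G k x′ y)) ⊎ (∀ y → Bit (G k x′ y - G k x y)) →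
          - + 1 ≤ G k x y - G k x′ y - (G k x y′ - G k x′ y′) × G k x y - G k x′ y - (G k x y′ - G k x′ y′) ≤ + 1
        cases (inj₁ h) = bits (h y) (h y′)
        cases (inj₂ h) = subst (λ d → - + 1 ≤ d × d ≤ + 1)
          (((∀ u v m n → u - v - (m - n) ≡ n - m - (v - u)) ∋ solve-∀) (G k x′ y′) (G k x y′) (G k x′ y) (G k x y))
          (bits (h y′) (h y))

    ȓ : ℕ
    ȓ = r̄ %ℕ p

    ȓ<p : ȓ ℕ.< p
    ȓ<p = n%ℕd<d r̄ p

    g′ : ℤ
    g′ = + q * g - + r * (r̄ /ℕ p)

    inverse-mod-p : + r * + ȓ ≡ + 1 + + p * g′
    inverse-mod-p = by-≡ (+ 1) inv (by-≡ (- + r) (a≡a%ℕn+[a/ℕn]*n r̄ p)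
      (((∀ p q r r̄ g ȓ a → r * ȓ ≡ + 1 + p * (q * g - r * a) + (r * r̄ - (+ 1 + p * q * g)) * + 1 + (r̄ -
        (ȓ + a * p)) * - r) ∋ solve-∀)
        (+ p) (+ q) (+ r) r̄ g (+ ȓ) (r̄ /ℕ p)))

    private
      coords-def : ∀ t → t ≡ + r * (+ p * + X t + + q * + Y t) + + p * + q * Z t
      coords-def t = trans (value-coords t) (value-def (X t) (Y t) (Z t))

    X-shift-q : ∀ t → X (t - + q) ≡ X t
    X-shift-q t = X-unique (t - + q) (X t) (+ r * + Y t + + p * Z t - + 1) (X<q t)
      (by-≡ (+ 1) (coords-def t) (((∀ p q r t x y z → t - q ≡ r * p * x + q * (r * y + p * z - + 1)
          + (t - (r * (p * x + q * y) + p * q * z)) * + 1) ∋ solve-∀) (+ p) (+ q) (+ r) t (+ X t) (+ Y t) (Z t)))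

    Y-shift-p : ∀ t → Y (t - + p) ≡ Y t
    Y-shift-p t = Y-unique (t - + p) (Y t) (+ r * + X t + + q * Z t - + 1) (Y<p t)
      (by-≡ (+ 1) (coords-def t) (((∀ p q r t x y z → t - p ≡ r * q * y + p * (r * x + q * z - + 1)
          + (t - (r * (p * x + q * y) + p * q * z)) * + 1) ∋ solve-∀) (+ p) (+ q) (+ r) t (+ X t) (+ Y t) (Z t)))

    -- Modulo `p`, `q ≡ r q ȓ`, so subtracting `q` lowers the row by `ȓ`; `c` is 1 if the row wraps
    -- around and 0 if not.
    Y-shift-q : ∀ t y c → y ℕ.< p → + y ≡ + Y t - + ȓ + + p * c → Y (t - + q) ≡ y
    Y-shift-q t y c y<p y≡ = Y-unique (t - + q) y (+ r * + X t + + q * Z t + + q * g′ - + r * + q * c) y<p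
      (by-≡ (+ 1) (coords-def t) (by-≡ (+ q) inverse-mod-p (by-≡ (- (+ r * + q)) y≡
        (((∀ p q r t x y y′ z ȓ g′ c → t - q ≡ r * q * y′ + p * (r * x + q * z + q * g′ - r * q * c)
          + (t - (r * (p * x + q * y) + p * q * z)) * + 1 + (r * ȓ - (+ 1 + p * g′)) * q + (y′ -
            (y - ȓ + p * c)) * - (r * q)) ∋ solve-∀)
          (+ p) (+ q) (+ r) t (+ X t) (+ Y t) (+ y) (Z t) (+ ȓ) g′ c))))

    C : Seq
    C k = window p S k - window p S (k - + q)

    private
      i<pq : ∀ {i} → i ℕ.≤ p ℕ.+ q → i ℕ.< p ℕ.* q
      i<pq i≤ = ℕ.≤-<-trans i≤ p+q<pq

    term : ℤ → ℕ → ℤ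
    term k m = G k (X (k - + m)) (Y (k - + m)) - G k (X (k - + m)) (Y (k - + m - + q))

    C-terms : ∀ k → C k ≡ ∑ p (term k)
    C-terms k = trans (∑-minus p _ _) (∑-cong p λ m m<p → cong₂ _-_
      (S-at k m (i<pq (ℕ.≤-trans (ℕ.<⇒≤ m<p) (ℕ.m≤m+n p q))))
      (trans (cong S (swap k (+ m))) (trans (S-at′ m m<p) (cong (λ x → G k x (Y (k - + m - + q))) (X-shift-q (k - + m))))))
      where
      swap : ∀ k m → k - + q - m ≡ k - m - + q
      swap k m = ((∀ k m q → k - q - m ≡ k - m - q) ∋ solve-∀) k m (+ q)
      S-at′ : ∀ m → m ℕ.< p → S (k - + m - + q) ≡ G k (X (k - + m - + q)) (Y (k - + m - + q))
      S-at′ m m<p = subst (λ t → S t ≡ G k (X t) (Y t)) (sym join) (S-at k (m ℕ.+ q) (i<pq (ℕ.+-monoˡ-≤ q (ℕ.<⇒≤ m<p))))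
        where
        join : k - + m - + q ≡ k - + (m ℕ.+ q)
        join = trans (((∀ k m q → k - m - q ≡ k - (m + q)) ∋ solve-∀) k (+ m) (+ q)) (cong (_-_ k) (sym (ℤ.pos-+ m q)))

    -- Only the ends k, k - p, k - q and k - p - q of the two windows change. They are the vertices
    -- of a rectangle, since subtracting `q` keeps `X` and subtracting `p` keeps `Y`; `p + q < p q`
    -- lets all four be evaluated with the threshold at `k`.
    C-jump : ∀ k → - + 1 ≤ C k - C (k - + 1) × C k - C (k - + 1) ≤ + 1
    C-jump k = subst (λ d → - + 1 ≤ d × d ≤ + 1) (sym difference) (mixed-difference k (X k) (X (k - + p)) (Y k) (Y
        (k - + q)))
      where
      open ≡-Reasoning
      D : Seq
      D = window p S
      window-step : ∀ t → D t - D (t - + 1) ≡ S t - S (t - + p)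
      window-step t = trans (((∀ u v → u - v ≡ - (v - u)) ∋ solve-∀) (D t) (D (t - + 1)))
        (trans (cong -_ (trans (sym (act-e 1 (ℕ.s≤s ℕ.z≤n) D t)) (trans (window-difference p 0<p S t) (act-e p 0<p S t))))
          (((∀ u v → - (v - u) ≡ u - v) ∋ solve-∀) (S t) (S (t - + p))))
      S-0 : S k ≡ G k (X k) (Y k)
      S-0 = subst (λ t → S t ≡ G k (X t) (Y t)) (ℤ.+-identityʳ k) (S-at k 0 (i<pq ℕ.z≤n))
      S-pq : S (k - + q - + p) ≡ G k (X (k - + q - + p)) (Y (k - + q - + p))
      S-pq = subst (λ t → S t ≡ G k (X t) (Y t)) (sym join) (S-at k (p ℕ.+ q) (i<pq ℕ.≤-refl))
        where
        join : k - + q - + p ≡ k - + (p ℕ.+ q)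
        join = trans (((∀ k p q → k - q - p ≡ k - (p + q)) ∋ solve-∀) k (+ p) (+ q)) (cong (_-_ k) (sym (ℤ.pos-+ p q)))
      swap : k - + 1 - + q ≡ k - + q - + 1
      swap = ((∀ k q → k - + 1 - q ≡ k - q - + 1) ∋ solve-∀) k (+ q)
      X-pq : X (k - + q - + p) ≡ X (k - + p)
      X-pq = trans (cong X (((∀ k p q → k - q - p ≡ k - p - q) ∋ solve-∀) k (+ p) (+ q))) (X-shift-q (k - + p))
      difference : C k - C (k - + 1) ≡ G k (X k) (Y k) - G k (X (k - + p)) (Y k) - (G k (X k) (Y (k - + q)) - G k
          (X (k - + p)) (Y (k - + q)))
      difference = begin
        D k - D (k - + q) - (D (k - + 1) - D (k - + 1 - + q))
          ≡⟨ cong (λ t → D k - D (k - + q) - (D (k - + 1) - D t)) swap ⟩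
        D k - D (k - + q) - (D (k - + 1) - D (k - + q - + 1))
          ≡⟨ ((∀ u v w z → u - v - (w - z) ≡ u - w - (v - z)) ∋ solve-∀) (D k) (D (k - + q)) (D (k - + 1)) (D
            (k - + q - + 1)) ⟩
        D k - D (k - + 1) - (D (k - + q) - D (k - + q - + 1))
          ≡⟨ cong₂ _-_ (window-step k) (window-step (k - + q)) ⟩
        S k - S (k - + p) - (S (k - + q) - S (k - + q - + p))
          ≡⟨ cong₂ _-_
               (cong₂ _-_ S-0 (trans (S-at k p (i<pq (ℕ.m≤m+n p q))) (cong (G k (X (k - + p))) (Y-shift-p k))))
               (cong₂ _-_ (trans (S-at k q (i<pq (ℕ.m≤n+m q p))) (cong (λ x → G k x (Y (k - + q))) (X-shift-q k)))
                 (trans S-pq (cong₂ (G k) X-pq (Y-shift-p (k - + q))))) ⟩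
        G k (X k) (Y k) - G k (X (k - + p)) (Y k) - (G k (X k) (Y (k - + q)) - G k (X (k - + p)) (Y (k - + q))) ∎

    A : ℕ
    A = suc σ

    -- Row y contributes 0 or 1 to every coefficient when E y = 1, and -1 or 0 when E y = 0.
    E : ℕ → ℤ
    E y = + 1 - le (ȓ ℕ.⊓ A) y + le (A ℕ.+ ȓ) y

    InRange : ℤ → ℤ → Set
    InRange ε v = ε - + 1 ≤ v × v ≤ ε

    private
      E-one : ∀ y → (y ℕ.< ȓ × y ℕ.≤ σ) ⊎ A ℕ.+ ȓ ℕ.≤ y → E y ≡ + 1
      E-one y (inj₁ (y<ȓ , y≤σ)) = cong₂ (λ u v → + 1 - u + v) (le-no (ℕ.⊓-glb y<ȓ (ℕ.s≤s y≤σ)))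
        (le-no (ℕ.<-≤-trans y<ȓ (ℕ.m≤n+m ȓ A)))
      E-one y (inj₂ A+ȓ≤y) = cong₂ (λ u v → + 1 - u + v)
        (le-yes (ℕ.≤-trans (ℕ.m⊓n≤m ȓ A) (ℕ.≤-trans (ℕ.m≤n+m ȓ A) A+ȓ≤y))) (le-yes A+ȓ≤y)

      E-zero : ∀ y → (ȓ ℕ.≤ y ⊎ σ ℕ.< y) → y ℕ.< A ℕ.+ ȓ → E y ≡ + 0
      E-zero y h y<A+ȓ = cong₂ (λ u v → + 1 - u + v) (le-yes (below h)) (le-no y<A+ȓ)
        where
        below : ȓ ℕ.≤ y ⊎ σ ℕ.< y → ȓ ℕ.⊓ A ℕ.≤ y
        below (inj₁ ȓ≤y) = ℕ.≤-trans (ℕ.m⊓n≤m ȓ A) ȓ≤y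
        below (inj₂ σ<y) = ℕ.≤-trans (ℕ.m⊓n≤n ȓ A) σ<y

      range-one : ∀ {ε v} → ε ≡ + 1 → Bit v → InRange ε v
      range-one refl h = h

      range-zero : ∀ {ε u v} → ε ≡ + 0 → Bit (u - v) → InRange ε (v - u)
      range-zero {ε} {u} {v} refl (0≤d , d≤1) =
        by-≤ (gap d≤1) (((∀ u v → v - u ≡ + 0 - + 1 + (+ 1 - (u - v))) ∋ solve-∀) u v) ,
        by-≤ 0≤d (((∀ u v → + 0 ≡ v - u + (u - v)) ∋ solve-∀) u v)

    -- `E` is 1 when row `Y t` dominates the row it is paired with and 0 when it is dominated. Which
    -- holds is decided by the wrap of `Y t - ȓ` and by the sides of `σ` on which the two rows lie.
    row-range : ∀ k x t → InRange (E (Y t)) (G k x (Y t) - G k x (Y (t - + q)))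
    row-range k x t = cases (ȓ ℕ.≤? y)
      where
      y = Y t
      Goal : ℕ → Set
      Goal y′ = InRange (E y) (G k x y - G k x y′)
      unwrapped : ∀ y′ → y′ ℕ.+ ȓ ≡ y → Goal y′
      unwrapped y′ y≡ = split (y′ ℕ.≤? σ) (y ℕ.≤? σ)
        where
        y′≤y : y′ ℕ.≤ y
        y′≤y = subst (y′ ℕ.≤_) y≡ (ℕ.m≤m+n y′ ȓ)
        ȓ≤y : ȓ ℕ.≤ y
        ȓ≤y = subst (ȓ ℕ.≤_) y≡ (ℕ.m≤n+m ȓ y′)
        zero-E : y′ ℕ.≤ σ → E y ≡ + 0
        zero-E y′≤σ = E-zero y (inj₁ ȓ≤y) (subst (ℕ._< A ℕ.+ ȓ) y≡ (ℕ.+-monoˡ-< ȓ (ℕ.s≤s y′≤σ)))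
        split : Dec (y′ ℕ.≤ σ) → Dec (y ℕ.≤ σ) → Goal y′
        split (no y′≰σ) _ = range-one (E-one y (inj₂ (subst (A ℕ.+ ȓ ℕ.≤_) y≡ (ℕ.+-monoˡ-≤ ȓ (ℕ.≰⇒> y′≰σ)))))
            (row-high k x y′≤y (ℕ.≰⇒> y′≰σ))
        split (yes y′≤σ) (yes y≤σ) = range-zero {E y} {G k x y′} {G k x y} (zero-E y′≤σ) (row-low k x y′≤y y≤σ)
        split (yes y′≤σ) (no y≰σ)  = range-zero {E y} {G k x y′} {G k x y} (zero-E y′≤σ) (row-cross k x y′≤σ (ℕ.≰⇒> y≰σ))
      wrapped : ∀ y′ → y ℕ.< ȓ → y ℕ.≤ y′ → Goal y′
      wrapped y′ y<ȓ y≤y′ = split (y ℕ.≤? σ) (y′ ℕ.≤? σ)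
        where
        split : Dec (y ℕ.≤ σ) → Dec (y′ ℕ.≤ σ) → Goal y′
        split (yes y≤σ) (yes y′≤σ) = range-one (E-one y (inj₁ (y<ȓ , y≤σ))) (row-low k x y≤y′ y′≤σ)
        split (yes y≤σ) (no y′≰σ)  = range-one (E-one y (inj₁ (y<ȓ , y≤σ))) (row-cross k x y≤σ (ℕ.≰⇒> y′≰σ))
        split (no y≰σ) _ = range-zero {E y} {G k x y′} {G k x y} (E-zero y (inj₂ (ℕ.≰⇒> y≰σ)) (ℕ.<-≤-trans y<ȓ
            (ℕ.m≤n+m ȓ A))) (row-high k x y≤y′ (ℕ.≰⇒> y≰σ))
      cases : Dec (ȓ ℕ.≤ y) → Goal (Y (t - + q))
      cases (yes ȓ≤y) = subst Goal (sym (Y-shift-q t (y ℕ.∸ ȓ) (+ 0) (ℕ.≤-<-trans (ℕ.m∸n≤m y ȓ) (Y<p t))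
          (trans (trans (sym (ℤ.⊖-≥ ȓ≤y)) (sym (ℤ.m-n≡m⊖n y ȓ))) (((∀ d p → d ≡ d + p * + 0) ∋ solve-∀) (+ y - + ȓ) (+ p)))))
        (unwrapped (y ℕ.∸ ȓ) (ℕ.m∸n+n≡m ȓ≤y))
      cases (no ȓ≰y) = subst Goal (sym (Y-shift-q t y′ (+ 1) y′<p y′≡)) (wrapped y′ (ℕ.≰⇒> ȓ≰y) (ℕ.m≤m+n y (p ℕ.∸ ȓ)))
        where
        y′ = y ℕ.+ (p ℕ.∸ ȓ)
        y′≡ : + y′ ≡ + y - + ȓ + + p * + 1
        y′≡ = trans (ℤ.pos-+ y (p ℕ.∸ ȓ)) (trans (cong (_+_ (+ y)) (trans (sym (ℤ.⊖-≥ (ℕ.<⇒≤ ȓ<p))) (sym (ℤ.m-n≡m⊖n p ȓ))))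
          (((∀ y p ȓ → y + (p - ȓ) ≡ y - ȓ + p * + 1) ∋ solve-∀) (+ y) (+ p) (+ ȓ)))
        y′<p : y′ ℕ.< p
        y′<p = subst (y′ ℕ.<_) (ℕ.m+[n∸m]≡n (ℕ.<⇒≤ ȓ<p)) (ℕ.+-monoˡ-< (p ℕ.∸ ȓ) (ℕ.≰⇒> ȓ≰y))

    -- Modulo `p` an integer `t` is `r q` times `Y t`, with `r q` invertible, so `p` consecutive
    -- integers meet each row once.
    ∑-E : ∀ k → ∑ p (λ m → E (Y (k - + m))) ≡ ∑ p E
    ∑-E k = ∑-permute p (λ m → Y (k - + m)) (λ m _ → Y<p (k - + m)) injective surjective E
      where
      injective : ∀ {i j} → i ℕ.< j → j ℕ.< p → Y (k - + i) ≢ Y (k - + j)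
      injective {i} {j} i<j j<p Y≡ = ℕ.<⇒≢ i<j (residue-unique
        (+ r * + X (k - + j) + + q * Z (k - + j) - + r * + X (k - + i) - + q * Z (k - + i)) (ℕ.<-trans i<j j<p) j<p
        (by-≡ (- + 1) (coords-def (k - + i)) (by-≡ (+ 1) (coords-def (k - + j)) (by-≡ (- (+ r * + q)) (cong +_ Y≡)
          (((∀ p q r k i j x x′ y y′ z z′ → i - j ≡ p * (r * x′ + q * z′ - r * x - q * z)
              + (k - i - (r * (p * x + q * y) + p * q * z)) * - + 1 + (k - j - (r *
                (p * x′ + q * y′) + p * q * z′)) * + 1 + (y - y′) * - (r * q)) ∋ solve-∀)
            (+ p) (+ q) (+ r) k (+ i) (+ j) (+ X (k - + i)) (+ X (k - + j)) (+ Y (k - + i)) (+ Y (k - + j)) (Z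
              (k - + i)) (Z (k - + j)))))))
      surjective : ∀ y → y ℕ.< p → ∃ λ m → m ℕ.< p × y ≡ Y (k - + m)
      surjective y y<p = m , n%ℕd<d d p , sym (Y-unique (k - + m) y (d /ℕ p) y<p
        (by-≡ (+ 1) (a≡a%ℕn+[a/ℕn]*n d p) (((∀ k c m a p → k - m ≡ c + p * a + (k - c - (m + a * p)) * + 1) ∋ solve-∀)
          k (+ r * + q * + y) (+ m) (d /ℕ p) (+ p))))
        where
        d = k - + r * + q * + y
        m = d %ℕ p

    U : ℕ
    U = ȓ ℕ.⊓ A ℕ.+ (p ℕ.∸ (A ℕ.+ ȓ))

    ∑E≡U : ∑ p E ≡ + U
    ∑E≡U = begin
      ∑ p E
        ≡⟨ ∑-plus p (λ y → + 1 - le c y) (le (A ℕ.+ ȓ)) ⟩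
      ∑ p (λ y → + 1 - le c y) + ∑ p (le (A ℕ.+ ȓ))
        ≡⟨ cong₂ _+_ (trans (sym (∑-minus p (λ _ → + 1) (le c))) (cong₂ _-_ (∑-one p) (∑-le c p))) (∑-le (A ℕ.+ ȓ) p) ⟩
      + p - + (p ℕ.∸ c) + + (p ℕ.∸ (A ℕ.+ ȓ))
        ≡⟨ cong (_+ + (p ℕ.∸ (A ℕ.+ ȓ))) (trans (cong (λ n → + n - + (p ℕ.∸ c)) (sym (ℕ.m+[n∸m]≡n c≤p)))
             (trans (cong (_- + (p ℕ.∸ c)) (ℤ.pos-+ c (p ℕ.∸ c))) (((∀ c d → c + d - d ≡ c) ∋ solve-∀) (+ c) (+
               (p ℕ.∸ c))))) ⟩
      + c + + (p ℕ.∸ (A ℕ.+ ȓ))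
        ≡⟨ ℤ.pos-+ c (p ℕ.∸ (A ℕ.+ ȓ)) ⟨
      + U ∎
      where
      open ≡-Reasoning
      c = ȓ ℕ.⊓ A
      c≤p : c ℕ.≤ p
      c≤p = ℕ.≤-trans (ℕ.m⊓n≤n ȓ A) (ℕ.<⇒≤ σ<p)

    C≤U : ∀ k → C k ≤ + U
    C≤U k = subst (_≤ + U) (sym (C-terms k)) (ℤ.≤-trans (∑-mono p λ m → proj₂ (row-range k (X (k - + m)) (k - + m)))
      (≡⇒≤ (trans (∑-E k) ∑E≡U)))

    U-p≤C : ∀ k → + U - + p ≤ C k
    U-p≤C k = subst (+ U - + p ≤_) (sym (C-terms k)) (ℤ.≤-trans
      (≡⇒≤ (sym (trans (sym (∑-minus p (λ m → E (Y (k - + m))) (λ _ → + 1))) (cong₂ _-_ (trans (∑-E k) ∑E≡U) (∑-one p)))))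
      (∑-mono p λ m → proj₁ (row-range k (X (k - + m)) (k - + m))))

    U≤p : U ℕ.≤ p
    U≤p = ℕ.≤-trans (ℕ.+-monoˡ-≤ (p ℕ.∸ (A ℕ.+ ȓ)) (ℕ.m⊓n≤n ȓ A))
      (ℕ.≤-trans (ℕ.+-monoʳ-≤ A (ℕ.∸-monoʳ-≤ p (ℕ.m≤m+n A ȓ))) (ℕ.≤-reflexive (ℕ.m+[n∸m]≡n (ℕ.<⇒≤ σ<p))))

    module _ {M : ℕ} (A≤M : A ℕ.≤ M) (p≤A+M : p ℕ.≤ A ℕ.+ M) where

      -- If `A + ȓ ≤ p`, then `U ≤ ȓ + (p - A - ȓ) = p - A`. Otherwise the second part of `U`
      -- vanishes and `U ≤ A`.
      U≤M : U ℕ.≤ M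
      U≤M = cases (A ℕ.+ ȓ ℕ.≤? p)
        where
        cases : Dec (A ℕ.+ ȓ ℕ.≤ p) → U ℕ.≤ M
        cases (yes A+ȓ≤p) = ℕ.+-cancelˡ-≤ A U M (ℕ.≤-trans (ℕ.+-monoʳ-≤ A (ℕ.+-monoˡ-≤ (p ℕ.∸ (A ℕ.+ ȓ)) (ℕ.m⊓n≤m ȓ A)))
          (ℕ.≤-trans (ℕ.≤-reflexive (trans (sym (ℕ.+-assoc A ȓ (p ℕ.∸ (A ℕ.+ ȓ)))) (ℕ.m+[n∸m]≡n A+ȓ≤p))) p≤A+M))
        cases (no A+ȓ≰p) = ℕ.≤-trans (ℕ.≤-reflexive (trans (cong (ℕ._+_ (ȓ ℕ.⊓ A)) (ℕ.m≤n⇒m∸n≡0 (ℕ.<⇒≤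
            (ℕ.≰⇒> A+ȓ≰p)))) (ℕ.+-identityʳ _)))
          (ℕ.≤-trans (ℕ.m⊓n≤n ȓ A) A≤M)

      p≤M+U : p ℕ.≤ M ℕ.+ U
      p≤M+U = cases (ℕ.≤-total ȓ A)
        where
        cases : ȓ ℕ.≤ A ⊎ A ℕ.≤ ȓ → p ℕ.≤ M ℕ.+ U
        cases (inj₁ ȓ≤A) = ℕ.≤-trans (ℕ.m≤n+m∸n p (A ℕ.+ ȓ)) (ℕ.≤-trans (ℕ.≤-reflexive (ℕ.+-assoc A ȓ (p ℕ.∸ (A ℕ.+ ȓ))))
          (ℕ.+-mono-≤ A≤M (ℕ.+-monoˡ-≤ (p ℕ.∸ (A ℕ.+ ȓ)) (ℕ.≤-reflexive (sym (ℕ.m≤n⇒m⊓n≡m ȓ≤A))))))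
        cases (inj₂ A≤ȓ) = ℕ.≤-trans p≤A+M (ℕ.≤-trans (ℕ.≤-reflexive (ℕ.+-comm A M))
          (ℕ.+-monoʳ-≤ M (ℕ.≤-trans (ℕ.≤-reflexive (sym (ℕ.m≥n⇒m⊓n≡n A≤ȓ))) (ℕ.m≤m+n (ȓ ℕ.⊓ A) (p ℕ.∸ (A ℕ.+ ȓ))))))

    -- Evaluation at the extremal exponents.

    module Eval
      (B s τ v : ℕ) (p≡ : p ≡ suc σ ℕ.+ B) (ρ≡ : ρ ≡ σ ℕ.* s ℕ.+ τ) (τ<σ : τ ℕ.< σ) (σp≤q : σ ℕ.* p ℕ.≤ q)
      (B≤σ : B ℕ.≤ σ) (v≤B : v ℕ.≤ B) (σ<B+v : σ ℕ.< B ℕ.+ v) (1≤s : 1 ℕ.≤ s)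
      (M₀ : ℤ) (rv≡-1 : + 1 + + r * + v ≡ + p * M₀) where

      p≡′ : + p ≡ + 1 + + σ + + B
      p≡′ = cong +_ p≡

      ρ≡′ : + ρ ≡ + σ * + s + + τ
      ρ≡′ = trans (cong +_ ρ≡) (cong (_+ + τ) (ℤ.pos-* σ s))

      -- The change of `p x + q y` along one step (-s, +1).
      h : ℤ
      h = + q - + s * + p

      private
        σh≡ : + σ * (+ q - + s * + p) ≡ (+ σ - + B) * + q + (+ p - + 1) + + τ * + p
        σh≡ = by-≡ (- + 1) ident (by-≡ (- + q) p≡′ (by-≡ (+ p) ρ≡′
          (((∀ p q ρ σ B s τ → σ * (q - s * p) ≡ (σ - B) * q + (p - + 1) + τ * p
            + (p * (+ 1 + ρ) + q * (+ 1 + σ) - (+ 1 + p * q)) * - + 1 + (p - (+ 1 + σ + B)) * - q + (ρ -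
              (σ * s + τ)) * p) ∋ solve-∀)
            (+ p) (+ q) (+ ρ) (+ σ) (+ B) (+ s) (+ τ))))

        σp≤q′ : + σ * + p ≤ + q
        σp≤q′ = subst (_≤ + q) (ℤ.pos-* σ p) (+≤+ σp≤q)

        positive-factor : ∀ n {d} → + 0 < + n * d → + 0 < d
        positive-factor n {+ zero}  0<nd = subst (+ 0 <_) (ℤ.*-zeroʳ (+ n)) 0<nd
        positive-factor n {+ suc d} _    = +<+ (ℕ.s≤s ℕ.z≤n)
        positive-factor n { -[1+ d ]} 0<nd = contradiction
          (by-≤ {+ n * -[1+ d ]} {+ 0} (0≤+ n ⊗ (0≤+ 1 ⊕ 0≤+ d)) (((∀ n d → + 0 ≡ n * - (+ 1 + d) + n *
            (+ 1 + d)) ∋ solve-∀) (+ n) (+ d)))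
          (ℤ.<⇒≱ 0<nd)

      abstract
        h-gap : + 0 ≤ h - + 1
        h-gap = subst (+ 0 ≤_) (((∀ x → x - + 0 - + 1 ≡ x - + 1) ∋ solve-∀) h) (gap< (positive-factor σ
          (by-< (gap (+≤+ B≤σ) ⊗ 0≤+ q ⊕ gap< (+<+ (ℕ.≤-<-trans (ℕ.s≤s ℕ.z≤n) σ<p)) ⊕ 0≤+ τ ⊗ 0≤+ p)
            (by-≡ (+ 1) σh≡ (((∀ p q σ B s τ → σ * (q - s * p) ≡ + 0 + + 1 + ((σ - B) * q + (p - + 1 - + 1) + τ * p)
              + (σ * (q - s * p) - ((σ - B) * q + (p - + 1) + τ * p)) * + 1) ∋ solve-∀) (+ p) (+ q) (+ σ) (+ B)
                (+ s) (+ τ))))))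

        -- This is where q ≥ (p + l) p / 2 and l + 2 ≤ v enter.
        v-gap : + 0 ≤ + v * + q - + σ * h - + 1
        v-gap = subst (+ 0 ≤_) (sym (by-≡ (- + 1) σh≡
          (((∀ p q σ B s τ v → v * q - σ * (q - s * p) - + 1 ≡ (B + v - (+ 1 + σ)) * q + (q - σ * p) + p * (σ - (+ 1 + τ))
             + (σ * (q - s * p) - ((σ - B) * q + (p - + 1) + τ * p)) * - + 1) ∋ solve-∀) (+ p) (+ q) (+ σ) (+ B)
               (+ s) (+ τ) (+ v))))
          (gap (+≤+ σ<B+v) ⊗ 0≤+ q ⊕ gap σp≤q′ ⊕ 0≤+ p ⊗ gap (+≤+ τ<σ))

        -- Up to `B` steps of length `s` beyond `ρ` stay inside x < q. Multiplied by `p`, the claim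
        -- reduces through `ident` to `h > 0` and `B ≤ σ`.
        x-gap : + 0 ≤ + q - + ρ - + B * + s - + 1
        x-gap = subst (+ 0 ≤_) (((∀ x → x - + 0 - + 1 ≡ x - + 1) ∋ solve-∀) (+ q - + ρ - + B * + s)) (gap< (positive-factor p
          (by-< ((0≤+ 1 ⊕ gap (+≤+ B≤σ)) ⊗ 0≤+ q ⊕ 0≤+ B ⊗ h-gap ⊕ 0≤+ B ⊕ gap (+≤+ σ<p) ⊕ 0≤+ σ)
            (by-≡ (- + 1) ident (((∀ p q ρ σ B s → p * (q - ρ - B * s) ≡ + 0 + + 1 + ((+ 1 + (σ - B)) * q + B *
              (q - s * p - + 1) + B + (p - (+ 1 + (+ 1 + σ))) + σ)
              + (p * (+ 1 + ρ) + q * (+ 1 + σ) - (+ 1 + p * q)) * - + 1) ∋ solve-∀) (+ p) (+ q) (+ ρ) (+ σ) (+ B) (+ s))))))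

      at-point : ∀ t x y M c → x ℕ.< q → y ℕ.< p → t ≡ + r * (+ p * (+ x + + q * c) + + q * + y) + + p * + q * M
          → X t ≡ x × Y t ≡ y
      at-point t x y M c x<q y<p t≡ =
        X-unique t x (+ r * + p * c + + r * + y + + p * M) x<q
          (trans t≡ (((∀ p q r x y M c → r * (p * (x + q * c) + q * y) + p * q * M ≡ r * p * x + q *
            (r * p * c + r * y + p * M)) ∋ solve-∀)
            (+ p) (+ q) (+ r) (+ x) (+ y) M c)) ,
        Y-unique t y (+ r * (+ x + + q * c) + + q * M) y<p
          (trans t≡ (((∀ p q r x y M c → r * (p * (x + q * c) + q * y) + p * q * M ≡ r * q * y + p * (r *
            (x + q * c) + q * M)) ∋ solve-∀)
            (+ p) (+ q) (+ r) (+ x) (+ y) M c))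

      -- `v` represents -1/r modulo `p`, so subtracting `q` raises the row by `v`; `c` again records
      -- a wrap.
      Y-step : ∀ t y′ c → y′ ℕ.< p → + Y t + + v ≡ + y′ + + p * c → Y (t - + q) ≡ y′
      Y-step t y′ c y′<p y≡ = Y-unique (t - + q) y′ (+ r * + X t + + q * Z t - + q * M₀ + + r * + q * c) y′<p
        (by-≡ (+ 1) (trans (value-coords t) (value-def (X t) (Y t) (Z t))) (by-≡ (- + q) rv≡-1 (by-≡ (+ r * + q) y≡
          (((∀ p q r t x y z v y′ M₀ c → t - q ≡ r * q * y′ + p * (r * x + q * z - q * M₀ + r * q * c)
            + (t - (r * (p * x + q * y) + p * q * z)) * + 1 + (+ 1 + r * v - p * M₀) * - q + (y + v -
              (y′ + p * c)) * (r * q)) ∋ solve-∀)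
            (+ p) (+ q) (+ r) t (+ X t) (+ Y t) (Z t) (+ v) (+ y′) M₀ c))))

      Y-step-< : ∀ t {y} → Y t ≡ y → y ℕ.+ v ℕ.< p → Y (t - + q) ≡ y ℕ.+ v
      Y-step-< t {y} refl y+v<p = Y-step t (Y t ℕ.+ v) (+ 0) y+v<p (((∀ y p → y ≡ y + p * + 0) ∋ solve-∀)
          (+ Y t + + v) (+ p))

      Y-step-≥ : ∀ t {y y′} → Y t ≡ y → y′ ℕ.< p → y ℕ.+ v ≡ y′ ℕ.+ p → Y (t - + q) ≡ y′
      Y-step-≥ t {y} {y′} refl y′<p y+v≡ = Y-step t y′ (+ 1) y′<p (trans (cong +_ y+v≡) (((∀ y p
          → y + p ≡ y + p * + 1) ∋ solve-∀) (+ y′) (+ p)))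

      difference : ℤ → ℤ → ℤ
      difference k t = G k (X t) (Y t) - G k (X t) (Y (t - + q))

      -- For `k` in [r α, r α + r) the sign of an offset only tells whether the weight is at most
      -- `α`, since weights are integers scaled by `r`.
      module Threshold (k α : ℤ) (rα≤k : + r * α ≤ k) (k<rα+r : k < + r * α + + r) where

        private
          below : ∀ {j w} → w ≡ k - + r * j → j ≤ α → b w ≡ + 1
          below {j} refl j≤α = b-yes (subst (+ 0 ≤_) (((∀ k r α j → k - r * α + r *
              (α - j) ≡ k - r * j) ∋ solve-∀) k (+ r) α j)
            (gap rα≤k ⊕ 0≤+ r ⊗ gap j≤α))

          above : ∀ {j w} → w ≡ k - + r * j → α < j → b w ≡ + 0
          above {j} refl α<j = b-no (by-< (gap< k<rα+r ⊕ 0≤+ r ⊗ gap< α<j)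
            (((∀ k r α j → + 0 ≡ k - r * j + + 1 + (r * α + r - k - + 1 + r * (j - α - + 1))) ∋ solve-∀) k (+ r) α j))

          out-offset : ∀ x y → offset k x y + + p * + q * + r ≡ k - + r * (+ p * + x + + q * + y - + p * + q)
          out-offset x y = trans (cong (_+ + p * + q * + r) (offset-def k x y))
            (((∀ k p q r x y → k - r * (p * x + q * y) + p * q * r ≡ k - r * (p * x + q * y - p * q)) ∋ solve-∀) k
              (+ p) (+ q) (+ r) (+ x) (+ y))

          βx : ℕ → ℕ → ℤ
          βx x y = b (offset k x y + + p * + q * + r)

        G-one : ∀ x y → x ℕ.≤ ρ → y ℕ.≤ σ → + p * + x + + q * + y ≤ α → G k x y ≡ + 1
        G-one x y x≤ρ y≤σ j≤α = trans (G-def k x y) (trans (box-in (b (offset k x y)) (βx x y) x≤ρ y≤σ) (below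
            (offset-def k x y) j≤α))

        G-zero : ∀ x y → x ℕ.≤ ρ → α < + p * + x + + q * + y → G k x y ≡ + 0
        G-zero x y x≤ρ α<j = cases (y ℕ.≤? σ)
          where
          cases : Dec (y ℕ.≤ σ) → G k x y ≡ + 0
          cases (yes y≤σ) = trans (G-def k x y) (trans (box-in (b (offset k x y)) (βx x y) x≤ρ y≤σ) (above
              (offset-def k x y) α<j))
          cases (no y≰σ)  = trans (G-def k x y) (box-above (b (offset k x y)) (βx x y) x≤ρ (ℕ.≰⇒> y≰σ))

        G-minus : ∀ x y → ρ ℕ.< x → σ ℕ.< y → + p * + x + + q * + y - + p * + q ≤ α → G k x y ≡ - + 1
        G-minus x y ρ<x σ<y j≤α = trans (G-def k x y) (trans (box-out (b (offset k x y)) (βx x y) ρ<x σ<y)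
            (cong -_ (below (out-offset x y) j≤α)))

        G-zero-out : ∀ x y → ρ ℕ.< x → α < + p * + x + + q * + y - + p * + q → G k x y ≡ + 0
        G-zero-out x y ρ<x α<j = cases (y ℕ.≤? σ)
          where
          cases : Dec (y ℕ.≤ σ) → G k x y ≡ + 0
          cases (yes y≤σ) = trans (G-def k x y) (box-right (b (offset k x y)) (βx x y) ρ<x y≤σ)
          cases (no y≰σ)  = trans (G-def k x y) (trans (box-out (b (offset k x y)) (βx x y) ρ<x (ℕ.≰⇒> y≰σ))
              (cong -_ (above (out-offset x y) α<j)))

        G-right : ∀ x y → ρ ℕ.< x → y ℕ.≤ σ → G k x y ≡ + 0
        G-right x y ρ<x y≤σ = trans (G-def k x y) (box-right (b (offset k x y)) (βx x y) ρ<x y≤σ)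

        difference-at : ∀ t {x y y′ m n} → X t ≡ x × Y t ≡ y → Y (t - + q) ≡ y′ → G k x y ≡ m → G k x y′ ≡ n
            → difference k t ≡ m - n
        difference-at t {x} {y} (X≡ , Y≡) Y′≡ G₁ G₂ = cong₂ _-_ (trans (cong₂ (G k) X≡ Y≡) G₁) (trans (cong₂
            (G k) X≡ Y′≡) G₂)

      private
        <p : ∀ {n} → n ℕ.≤ σ → n ℕ.+ v ℕ.< p
        <p n≤σ = subst (_ ℕ.<_) (sym p≡) (ℕ.s≤s (ℕ.+-mono-≤ n≤σ v≤B))

        wrap-≤σ : ∀ {n z} → n ℕ.< p → n ℕ.+ v ≡ z ℕ.+ p → z ℕ.≤ σ
        wrap-≤σ {n} {z} n<p n+v≡ = ℕ.≤-trans (ℕ.<⇒≤ (ℕ.+-cancelʳ-< p z v (subst (ℕ._< v ℕ.+ p) n+v≡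
          (subst (n ℕ.+ v ℕ.<_) (ℕ.+-comm p v) (ℕ.+-monoˡ-< v n<p))))) (ℕ.≤-trans v≤B B≤σ)

        +≤⁻ : ∀ {m n} → + m ≤ + n → m ℕ.≤ n
        +≤⁻ = ℤ.drop‿+≤+

      -- The threshold `σ q` is the weight of (0, σ), the last and heaviest point of the diagonal in
      -- the positive box.
      module Plus (k : ℤ) (rα≤k : + r * (+ σ * + q) ≤ k) (k<rα+r : k < + r * (+ σ * + q) + + r) where

        open Threshold k (+ σ * + q) rα≤k k<rα+r

        difference⁺ : ∀ t n M → n ℕ.< p → t ≡ + r * (+ p * ((+ σ - + n) * + s) + + q * + n) + + p * + q * M
            → difference k t ≡ le n σ
        difference⁺ t n M n<p t≡ = cases (ℕ.≤-<-connex n σ)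
          where
          -- The weight is `σ q - i h`, within the threshold. Raising by `v` rows adds
          -- `v q > σ h ≥ i h` and crosses it.
          low : ∀ i → n ℕ.+ i ≡ σ → difference k t ≡ le n σ
          low i n+i≡σ = trans (difference-at t point (Y-step-< t (proj₂ point) (<p n≤σ))
              (G-one x n x≤ρ n≤σ (by-≤ (0≤+ i ⊗ (h-gap ⊕ 0≤+ 1))
                (by-≡ (- + q) n+i≡σ′ (by-≡ (- + p) (ℤ.pos-* i s)
                  (((∀ p q s σ n i x → σ * q ≡ p * x + q * n + i * (q - s * p - + 1 + + 1) + (n + i - σ) * - q +
                    (x - i * s) * - p) ∋ solve-∀)
                    (+ p) (+ q) (+ s) (+ σ) (+ n) (+ i) (+ x))))))
              (G-zero x (n ℕ.+ v) x≤ρ (by-< (v-gap ⊕ 0≤+ n ⊗ (h-gap ⊕ 0≤+ 1))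
                (by-≡ (+ s * + p) n+i≡σ′ (by-≡ (+ p) (ℤ.pos-* i s)
                  (((∀ p q s σ n i x v → p * x + q * (n + v) ≡ σ * q + + 1 + (v * q - σ * (q - s * p) - + 1 + n *
                    (q - s * p - + 1 + + 1)) + (n + i - σ) * (s * p) + (x - i * s) * p) ∋ solve-∀)
                    (+ p) (+ q) (+ s) (+ σ) (+ n) (+ i) (+ x) (+ v)))))))
            (sym (le-yes n≤σ))
            where
            x = i ℕ.* s
            n+i≡σ′ : + n + + i ≡ + σ
            n+i≡σ′ = cong +_ n+i≡σ
            n≤σ : n ℕ.≤ σ
            n≤σ = subst (n ℕ.≤_) n+i≡σ (ℕ.m≤m+n n i)
            x≤ρ : x ℕ.≤ ρ
            x≤ρ = ℕ.≤-trans (ℕ.*-monoˡ-≤ s (subst (i ℕ.≤_) n+i≡σ (ℕ.m≤n+m i n))) (subst (σ ℕ.* s ℕ.≤_) (sym ρ≡)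
                (ℕ.m≤m+n (σ ℕ.* s) τ))
            point : X t ≡ x × Y t ≡ n
            point = at-point t x n M (+ 0) (ℕ.≤-<-trans x≤ρ (ℕ.<-trans ℕ.≤-refl ρ<q)) n<p
              (trans t≡ (by-≡ (- (+ r * + p * + s)) n+i≡σ′ (by-≡ (- (+ r * + p)) (ℤ.pos-* i s)
                (((∀ p q r s σ n i x M → r * (p * ((σ - n) * s) + q * n) + p * q * M ≡ r * (p *
                  (x + q * + 0) + q * n) + p * q * M
                  + (n + i - σ) * - (r * p * s) + (x - i * s) * - (r * p)) ∋ solve-∀)
                  (+ p) (+ q) (+ r) (+ s) (+ σ) (+ n) (+ i) (+ x) M))))

          -- The first coordinate -i s wraps to `q - i s`, beyond `ρ`. The weight `σ q + i h` is
          -- over the threshold, and a raised row that wraps lands at most at `σ`, where such a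
          -- column contributes nothing.
          high : ∀ i′ → σ ℕ.+ suc i′ ≡ n → difference k t ≡ le n σ
          high i′ σ+i≡n = trans (second (ℕ.<-≤-connex (n ℕ.+ v) p)) (sym (le-no σ<n))
            where
            i = suc i′
            x = q ℕ.∸ i ℕ.* s
            σ+i≡n′ : + σ + + i ≡ + n
            σ+i≡n′ = cong +_ σ+i≡n
            σ<n : σ ℕ.< n
            σ<n = subst (suc σ ℕ.≤_) (trans (sym (ℕ.+-suc σ i′)) σ+i≡n) (ℕ.s≤s (ℕ.m≤m+n σ i′))
            i≤B : i ℕ.≤ B
            i≤B = ℕ.+-cancelˡ-≤ (suc σ) i B (subst₂ ℕ._≤_ (sym (cong suc σ+i≡n)) p≡ n<p)
            i*s≤q : i ℕ.* s ℕ.≤ q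
            i*s≤q = +≤⁻ (by-≤ (x-gap ⊕ 0≤+ ρ ⊕ gap (+≤+ i≤B) ⊗ 0≤+ s ⊕ 0≤+ 1) (by-≡ (- + 1) (ℤ.pos-* i s)
              (((∀ q ρ B s i y → q ≡ y + (q - ρ - B * s - + 1 + ρ + (B - i) * s + + 1) +
                (y - i * s) * - + 1) ∋ solve-∀) (+ q) (+ ρ) (+ B) (+ s) (+ i) (+ (i ℕ.* s)))))
            x≡ : + x ≡ + q - + i * + s
            x≡ = trans (sym (ℤ.⊖-≥ i*s≤q)) (trans (sym (ℤ.m-n≡m⊖n q (i ℕ.* s))) (cong (_-_ (+ q)) (ℤ.pos-* i s)))
            ρ<x : ρ ℕ.< x
            ρ<x = ℤ.drop‿+<+ (by-< (x-gap ⊕ gap (+≤+ i≤B) ⊗ 0≤+ s) (by-≡ (+ 1) x≡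
              (((∀ q ρ B s i x → x ≡ ρ + + 1 + (q - ρ - B * s - + 1 + (B - i) * s) + (x -
                (q - i * s)) * + 1) ∋ solve-∀) (+ q) (+ ρ) (+ B) (+ s) (+ i) (+ x))))
            x<q : x ℕ.< q
            x<q = ℤ.drop‿+<+ (by-< (gap (+≤+ 1≤s) ⊕ 0≤+ i′ ⊗ 0≤+ s) (by-≡ (- + 1) x≡
              (((∀ q s i′ x → q ≡ x + + 1 + (s - + 1 + i′ * s) + (x - (q - (+ 1 + i′) * s)) * - + 1) ∋ solve-∀)
                (+ q) (+ s) (+ i′) (+ x))))
            point : X t ≡ x × Y t ≡ n
            point = at-point t x n M (- + 1) x<q n<p
              (trans t≡ (by-≡ (+ r * + p * + s) σ+i≡n′ (by-≡ (- (+ r * + p)) x≡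
                (((∀ p q r s σ n i x M → r * (p * ((σ - n) * s) + q * n) + p * q * M ≡ r * (p *
                  (x + q * - + 1) + q * n) + p * q * M
                  + (σ + i - n) * (r * p * s) + (x - (q - i * s)) * - (r * p)) ∋ solve-∀)
                  (+ p) (+ q) (+ r) (+ s) (+ σ) (+ n) (+ i) (+ x) M))))
            first : ∀ w → + σ * + q < + p * + x + + q * (+ n + + w) - + p * + q
            first w = by-< ((h-gap ⊕ 0≤+ i′ ⊗ (h-gap ⊕ 0≤+ 1)) ⊕ 0≤+ q ⊗ 0≤+ w)
              (by-≡ (- + q) σ+i≡n′ (by-≡ (+ p) x≡
                (((∀ p q s σ n i′ x w → p * x + q * (n + w) - p * q ≡ σ * q + + 1 + (q - s * p - + 1 + i′ *
                  (q - s * p - + 1 + + 1) + q * w)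
                  + (σ + (+ 1 + i′) - n) * - q + (x - (q - (+ 1 + i′) * s)) * p) ∋ solve-∀) (+ p) (+ q) (+ s)
                    (+ σ) (+ n) (+ i′) (+ x) (+ w))))
            G₁ : G k x n ≡ + 0
            G₁ = G-zero-out x n ρ<x (subst (λ y → + σ * + q < + p * + x + + q * y - + p * + q) (ℤ.+-identityʳ
                (+ n)) (first 0))
            second : n ℕ.+ v ℕ.< p ⊎ p ℕ.≤ n ℕ.+ v → difference k t ≡ + 0
            second (inj₁ n+v<p) = difference-at t point (Y-step-< t (proj₂ point) n+v<p) G₁ (G-zero-out x
                (n ℕ.+ v) ρ<x (first v))
            second (inj₂ p≤n+v) = difference-at t point (Y-step-≥ t (proj₂ point) z<p n+v≡) G₁ (G-right x z ρ<x z≤σ)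
              where
              z = n ℕ.+ v ℕ.∸ p
              n+v≡ : n ℕ.+ v ≡ z ℕ.+ p
              n+v≡ = sym (ℕ.m∸n+n≡m p≤n+v)
              z≤σ = wrap-≤σ n<p n+v≡
              z<p : z ℕ.< p
              z<p = ℕ.≤-<-trans z≤σ (ℕ.<-trans ℕ.≤-refl σ<p)

          cases : n ℕ.≤ σ ⊎ σ ℕ.< n → difference k t ≡ le n σ
          cases (inj₁ n≤σ) = low (σ ℕ.∸ n) (ℕ.m+[n∸m]≡n n≤σ)
          cases (inj₂ σ<n) = high (n ℕ.∸ suc σ) (trans (ℕ.+-suc σ (n ℕ.∸ suc σ)) (ℕ.m+[n∸m]≡n σ<n))

      -- The threshold is the weight of (ρ + s, p - 1), the heaviest of the points met in the
      -- opposite box. It equals `ρ p - h`, just short of the least weight `ρ p` met in the positive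
      -- box.
      module Minus (k : ℤ) (rα≤k : + r * ((+ ρ + + s) * + p - + q) ≤ k) (k<rα+r : k < + r *
          ((+ ρ + + s) * + p - + q) + + r) where

        open Threshold k ((+ ρ + + s) * + p - + q) rα≤k k<rα+r

        difference⁻ : ∀ t n M → n ℕ.< p → t ≡ + r * (+ p * ((+ p - + 1 - + n) * + s + + τ) + + q *
            (+ n - + B)) + + p * + q * M →
          difference k t ≡ - (+ 1 - le B n)
        difference⁻ t n M n<p t≡ = cases (ℕ.<-≤-connex n B)
          where
          -- The row n - B is negative and wraps to n + σ + 1. The weight is the threshold minus
          -- `i h`, and `i ≤ σ` lets `v-gap` carry the raised point over it.
          low : ∀ i → suc n ℕ.+ i ≡ B → difference k t ≡ - (+ 1 - le B n)
          low i n+i≡B = trans (second (ℕ.<-≤-connex (y ℕ.+ v) p)) (cong (λ c → - (+ 1 - c)) (sym (le-no n<B)))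
            where
            n+i≡B′ : + 1 + + n + + i ≡ + B
            n+i≡B′ = cong +_ n+i≡B
            n<B : n ℕ.< B
            n<B = subst (suc n ℕ.≤_) n+i≡B (ℕ.m≤m+n (suc n) i)
            i≤σ : i ℕ.≤ σ
            i≤σ = ℕ.≤-trans (subst (i ℕ.≤_) n+i≡B (ℕ.m≤n+m i (suc n))) B≤σ
            x = ρ ℕ.+ suc i ℕ.* s
            y = n ℕ.+ suc σ
            x≡ : + x ≡ + ρ + (+ 1 + + i) * + s
            x≡ = cong (_+_ (+ ρ)) (ℤ.pos-* (suc i) s)
            ρ<x : ρ ℕ.< x
            ρ<x = ℤ.drop‿+<+ (by-< (gap (+≤+ 1≤s) ⊕ 0≤+ i ⊗ 0≤+ s) (trans x≡
              (((∀ ρ i s → ρ + (+ 1 + i) * s ≡ ρ + + 1 + (s - + 1 + i * s)) ∋ solve-∀) (+ ρ) (+ i) (+ s))))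
            x<q : x ℕ.< q
            x<q = ℤ.drop‿+<+ (by-< (x-gap ⊕ 0≤+ n ⊗ 0≤+ s) (by-≡ (- + 1) x≡ (by-≡ (- + s) n+i≡B′
              (((∀ q ρ B s n i x → q ≡ x + + 1 + (q - ρ - B * s - + 1 + n * s) + (x - (ρ +
                (+ 1 + i) * s)) * - + 1 + (+ 1 + n + i - B) * - s) ∋ solve-∀)
                (+ q) (+ ρ) (+ B) (+ s) (+ n) (+ i) (+ x)))))
            σ<y : σ ℕ.< y
            σ<y = ℕ.m≤n+m (suc σ) n
            y<p : y ℕ.< p
            y<p = subst (y ℕ.<_) (trans (ℕ.+-comm B (suc σ)) (sym p≡)) (ℕ.+-monoˡ-< (suc σ) n<B)
            point : X t ≡ x × Y t ≡ y
            point = at-point t x y (M - + r) (+ 0) x<q y<p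
              (trans t≡ (by-≡ (- (+ r * + p)) x≡ (by-≡ (+ r * + p * + s + + r * + q) p≡′ (by-≡ (- (+ r * + p)) ρ≡′
                (by-≡ (- (+ r * + p * + s)) n+i≡B′
                (((∀ p q r s σ τ B ρ n i x M → r * (p * ((p - + 1 - n) * s + τ) + q * (n - B)) + p * q * M
                  ≡ r * (p * (x + q * + 0) + q * (n + (+ 1 + σ))) + p * q * (M - r)
                  + (x - (ρ + (+ 1 + i) * s)) * - (r * p) + (p - (+ 1 + σ + B)) * (r * p * s + r * q) + (ρ -
                    (σ * s + τ)) * - (r * p)
                  + (+ 1 + n + i - B) * - (r * p * s)) ∋ solve-∀)
                  (+ p) (+ q) (+ r) (+ s) (+ σ) (+ τ) (+ B) (+ ρ) (+ n) (+ i) (+ x) M))))))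
            j≡ : ∀ w → + p * + x + + q * (+ y + + w) - + p * + q ≡ (+ ρ + + s) * + p - + q - + i *
                (+ q - + s * + p) + + w * + q
            j≡ w = by-≡ (+ p) x≡ (by-≡ (- + q) p≡′ (by-≡ (+ q) n+i≡B′
              (((∀ p q s σ B ρ n i x w → p * x + q * (n + (+ 1 + σ) + w) - p * q ≡ (ρ + s) * p - q - i * (q - s * p) + w * q
                + (x - (ρ + (+ 1 + i) * s)) * p + (p - (+ 1 + σ + B)) * - q + (+ 1 + n + i - B) * q) ∋ solve-∀)
                (+ p) (+ q) (+ s) (+ σ) (+ B) (+ ρ) (+ n) (+ i) (+ x) (+ w))))
            G₁ : G k x y ≡ - + 1
            G₁ = G-minus x y ρ<x σ<y (by-≤ (0≤+ i ⊗ (h-gap ⊕ 0≤+ 1)) (by-≡ (- + 1)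
              (trans (cong (λ y → + p * + x + + q * y - + p * + q) (sym (ℤ.+-identityʳ (+ y)))) (j≡ 0))
              (((∀ α j i q s p → α ≡ j + i * (q - s * p - + 1 + + 1) + (j - (α - i *
                (q - s * p) + + 0 * q)) * - + 1) ∋ solve-∀)
                ((+ ρ + + s) * + p - + q) (+ p * + x + + q * + y - + p * + q) (+ i) (+ q) (+ s) (+ p))))
            second : y ℕ.+ v ℕ.< p ⊎ p ℕ.≤ y ℕ.+ v → difference k t ≡ - + 1
            second (inj₁ y+v<p) = difference-at t point (Y-step-< t (proj₂ point) y+v<p) G₁ (G-zero-out x (y ℕ.+ v) ρ<x
              (by-< (v-gap ⊕ gap (+≤+ i≤σ) ⊗ (h-gap ⊕ 0≤+ 1)) (trans (j≡ v)
                (((∀ α i q s p v σ → α - i * (q - s * p) + v * q ≡ α + + 1 + (v * q - σ * (q - s * p) - + 1 +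
                  (σ - i) * (q - s * p - + 1 + + 1))) ∋ solve-∀)
                  ((+ ρ + + s) * + p - + q) (+ i) (+ q) (+ s) (+ p) (+ v) (+ σ)))))
            second (inj₂ p≤y+v) = difference-at t point (Y-step-≥ t (proj₂ point) z<p y+v≡) G₁ (G-right x z ρ<x z≤σ)
              where
              z = y ℕ.+ v ℕ.∸ p
              y+v≡ : y ℕ.+ v ≡ z ℕ.+ p
              y+v≡ = sym (ℕ.m∸n+n≡m p≤y+v)
              z≤σ = wrap-≤σ y<p y+v≡
              z<p : z ℕ.< p
              z<p = ℕ.≤-<-trans z≤σ (ℕ.<-trans ℕ.≤-refl σ<p)

          -- The weight `ρ p + j h` exceeds the threshold by at least `h`, so neither the point nor
          -- its raised copy counts.
          high : ∀ j → B ℕ.+ j ≡ n → difference k t ≡ - (+ 1 - le B n)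
          high j B+j≡n = split (σ ℕ.∸ j) (ℕ.m+[n∸m]≡n j≤σ)
            where
            j≤σ : j ℕ.≤ σ
            j≤σ = ℕ.+-cancelˡ-≤ (suc B) j σ (subst₂ ℕ._≤_ (sym (cong suc B+j≡n)) (trans p≡ (trans (ℕ.+-comm
                (suc σ) B) (ℕ.+-suc B σ))) n<p)
            B+j≡n′ : + B + + j ≡ + n
            B+j≡n′ = cong +_ B+j≡n
            split : ∀ i → j ℕ.+ i ≡ σ → difference k t ≡ - (+ 1 - le B n)
            split i j+i≡σ = trans (difference-at t point (Y-step-< t (proj₂ point) (<p j≤σ))
                (G-zero x j x≤ρ (subst (λ y → (+ ρ + + s) * + p - + q < + p * + x + + q * y) (ℤ.+-identityʳ (+ j))
                  (above 0)))
                (G-zero x (j ℕ.+ v) x≤ρ (above v)))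
              (cong (λ c → - (+ 1 - c)) (sym (le-yes (subst (B ℕ.≤_) B+j≡n (ℕ.m≤m+n B j)))))
              where
              x = i ℕ.* s ℕ.+ τ
              x≡ : + x ≡ + i * + s + + τ
              x≡ = cong (_+ + τ) (ℤ.pos-* i s)
              j+i≡σ′ : + j + + i ≡ + σ
              j+i≡σ′ = cong +_ j+i≡σ
              x≤ρ : x ℕ.≤ ρ
              x≤ρ = subst (x ℕ.≤_) (sym ρ≡) (ℕ.+-monoˡ-≤ τ (ℕ.*-monoˡ-≤ s (subst (i ℕ.≤_) j+i≡σ (ℕ.m≤n+m i j))))
              point : X t ≡ x × Y t ≡ j
              point = at-point t x j M (+ 0) (ℕ.≤-<-trans x≤ρ (ℕ.<-trans ℕ.≤-refl ρ<q)) (ℕ.≤-<-trans j≤σ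
                  (ℕ.<-trans ℕ.≤-refl σ<p))
                (trans t≡ (by-≡ (- (+ r * + p)) x≡ (by-≡ (+ r * + p * + s) p≡′ (by-≡
                  (+ r * + p * + s - + r * + q) B+j≡n′ (by-≡ (- (+ r * + p * + s)) j+i≡σ′
                  (((∀ p q r s σ τ B n i j x M → r * (p * ((p - + 1 - n) * s + τ) + q * (n - B)) + p * q * M
                    ≡ r * (p * (x + q * + 0) + q * j) + p * q * M
                    + (x - (i * s + τ)) * - (r * p) + (p - (+ 1 + σ + B)) * (r * p * s) + (B + j - n) * (r * p * s - r * q)
                    + (j + i - σ) * - (r * p * s)) ∋ solve-∀)
                    (+ p) (+ q) (+ r) (+ s) (+ σ) (+ τ) (+ B) (+ n) (+ i) (+ j) (+ x) M))))))
              above : ∀ w → (+ ρ + + s) * + p - + q < + p * + x + + q * (+ j + + w)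
              above w = by-< (0≤+ j ⊗ (h-gap ⊕ 0≤+ 1) ⊕ h-gap ⊕ 0≤+ q ⊗ 0≤+ w)
                (by-≡ (+ p) x≡ (by-≡ (- + p) ρ≡′ (by-≡ (+ p * + s) j+i≡σ′
                  (((∀ p q s σ τ ρ i j x w → p * x + q * (j + w) ≡ (ρ + s) * p - q + + 1 + (j *
                    (q - s * p - + 1 + + 1) + (q - s * p - + 1) + q * w)
                    + (x - (i * s + τ)) * p + (ρ - (σ * s + τ)) * - p + (j + i - σ) * (p * s)) ∋ solve-∀)
                    (+ p) (+ q) (+ s) (+ σ) (+ τ) (+ ρ) (+ i) (+ j) (+ x) (+ w)))))

          cases : n ℕ.< B ⊎ B ℕ.≤ n → difference k t ≡ - (+ 1 - le B n)
          cases (inj₁ n<B) = low (B ℕ.∸ suc n) (ℕ.m+[n∸m]≡n n<B)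
          cases (inj₂ B≤n) = high (n ℕ.∸ B) (ℕ.m+[n∸m]≡n B≤n)

      le-complement : ∀ x n → le x n ≡ + 1 - le (suc n) x
      le-complement zero    n       = refl
      le-complement (suc x) zero    = refl
      le-complement (suc x) (suc n) = le-complement x n

      ∑-below : ∀ c → c ℕ.≤ p → ∑ p (λ n → + 1 - le c n) ≡ + c
      ∑-below c c≤p = trans (sym (∑-minus p (λ _ → + 1) (le c))) (trans (cong₂ _-_ (∑-one p) (∑-le c p))
        (trans (cong (λ n → + n - + (p ℕ.∸ c)) (sym (ℕ.m+[n∸m]≡n c≤p))) (((∀ c d → c + d - d ≡ c) ∋ solve-∀) (+ c)
          (+ (p ℕ.∸ c)))))

      -- The summation index m of the window and the index n of the lattice points are related by n = m or n = p - 1 - m.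
      record Reindexing : Set where
        field
          N     : ℕ → ℕ
          N<p   : ∀ m → m ℕ.< p → N m ℕ.< p
          ∑-N   : ∀ f → ∑ p (f ∘ N) ≡ ∑ p f

      forward : Reindexing
      forward = record { N = λ m → m ; N<p = λ _ m<p → m<p ; ∑-N = λ _ → refl }

      backward : Reindexing
      backward = record { N = π ; N<p = π<p ; ∑-N = ∑-permute p π π<p injective λ y y<p → π y , π<p y y<p , sym
          (involutive y<p) }
        where
        π : ℕ → ℕ
        π m = p ℕ.∸ suc m
        π<p : ∀ m → m ℕ.< p → π m ℕ.< p
        π<p m m<p = ℕ.∸-monoʳ-< {p} {suc m} {0} (ℕ.s≤s ℕ.z≤n) m<p
        injective : ∀ {i j} → i ℕ.< j → j ℕ.< p → π i ≢ π j
        injective i<j j<p π≡ = ℕ.<⇒≢ i<j (ℕ.suc-injective (ℕ.∸-cancelˡ-≡ (ℕ.<-trans i<j j<p) j<p π≡))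
        involutive : ∀ {y} → y ℕ.< p → π (π y) ≡ y
        involutive {y} y<p = trans (cong (p ℕ.∸_) (sym (ℕ.+-∸-assoc 1 y<p))) (ℕ.m∸[m∸n]≡n (ℕ.<⇒≤ y<p))

      module _ (k : ℤ) (I : Reindexing) (M : ℕ → ℤ) where

        open Reindexing I

        C-plus : + r * (+ σ * + q) ≤ k → k < + r * (+ σ * + q) + + r →
          (∀ m → m ℕ.< p → k - + m ≡ + r * (+ p * ((+ σ - + N m) * + s) + + q * + N m) + + p * + q * M m) → C k ≡ + suc σ
        C-plus lo hi points = begin
          C k                                     ≡⟨ C-terms k ⟩
          ∑ p (term k)                            ≡⟨ ∑-cong p (λ m m<p → trans (Plus.difference⁺ k lo hi (k - + m)
            (N m) (M m) (N<p m m<p) (points m m<p))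
                                                       (le-complement (N m) σ)) ⟩
          ∑ p (λ m → + 1 - le (suc σ) (N m))      ≡⟨ ∑-N (λ n → + 1 - le (suc σ) n) ⟩
          ∑ p (λ n → + 1 - le (suc σ) n)          ≡⟨ ∑-below (suc σ) (ℕ.<⇒≤ σ<p) ⟩
          + suc σ                                 ∎
          where open ≡-Reasoning

        C-minus : + r * ((+ ρ + + s) * + p - + q) ≤ k → k < + r * ((+ ρ + + s) * + p - + q) + + r →
          (∀ m → m ℕ.< p → k - + m ≡ + r * (+ p * ((+ p - + 1 - + N m) * + s + + τ) + + q *
            (+ N m - + B)) + + p * + q * M m) → C k ≡ - + B
        C-minus lo hi points = begin
          C k                                     ≡⟨ C-terms k ⟩
          ∑ p (term k)                            ≡⟨ ∑-cong p (λ m m<p → Minus.difference⁻ k lo hi (k - + m) (N m)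
            (M m) (N<p m m<p) (points m m<p)) ⟩
          ∑ p (λ m → - (+ 1 - le B (N m)))        ≡⟨ ∑-N (λ n → - (+ 1 - le B n)) ⟩
          ∑ p (λ n → - (+ 1 - le B n))            ≡⟨ ∑-neg p (λ n → + 1 - le B n) ⟩
          - ∑ p (λ n → + 1 - le B n)              ≡⟨ cong -_ (∑-below B (subst (B ℕ.≤_) (sym p≡) (ℕ.m≤n+m B (suc σ)))) ⟩
          - + B                                   ∎
          where open ≡-Reasoning

      -- As -1 = r (q - s p) + p q g, lowering the exponent by 1 is the step (-s, +1) together with
      -- `g` in the third coordinate. The walk starts at n = 0, whose unreduced weight is the `u` of
      -- the theorem.
      module _ (r̄≡ : r̄ ≡ + s * + p - + q) (k t : ℤ) where

        C-plus-forward : + r * (+ σ * + q) ≤ k → k < + r * (+ σ * + q) + + r →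
          k ≡ + r * (+ σ * + s * + p) + t * (+ p * + q) → C k ≡ + suc σ
        C-plus-forward lo hi k≡ = C-plus k forward (λ m → t + + m * g) lo hi λ m m<p →
          by-≡ (+ 1) k≡ (by-≡ (+ m) inv (by-≡ (- (+ m * + r)) r̄≡
            (((∀ p q r s σ r̄ g k t m → k - m ≡ r * (p * ((σ - m) * s) + q * m) + p * q * (t + m * g)
              + (k - (r * (σ * s * p) + t * (p * q))) * + 1 + (r * r̄ - (+ 1 + p * q * g)) * m + (r̄ -
                (s * p - q)) * - (m * r)) ∋ solve-∀)
              (+ p) (+ q) (+ r) (+ s) (+ σ) r̄ g k t (+ m))))

        C-minus-forward : + r * ((+ ρ + + s) * + p - + q) ≤ k → k < + r * ((+ ρ + + s) * + p - + q) + + r →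
          k ≡ + r * (- (+ B * + q) + ((+ p - + 1) * + s + + τ) * + p) + t * (+ p * + q) → C k ≡ - + B
        C-minus-forward lo hi k≡ = C-minus k forward (λ m → t + + m * g) lo hi λ m m<p →
          by-≡ (+ 1) k≡ (by-≡ (+ m) inv (by-≡ (- (+ m * + r)) r̄≡
            (((∀ p q r s τ B r̄ g k t m → k - m ≡ r * (p * ((p - + 1 - m) * s + τ) + q * (m - B)) + p * q * (t + m * g)
              + (k - (r * (- (B * q) + ((p - + 1) * s + τ) * p) + t * (p * q))) * + 1 + (r * r̄ -
                (+ 1 + p * q * g)) * m + (r̄ - (s * p - q)) * - (m * r)) ∋ solve-∀)
              (+ p) (+ q) (+ r) (+ s) (+ τ) (+ B) r̄ g k t (+ m))))

      private
        reversed : ∀ m → m ℕ.< p → + (p ℕ.∸ suc m) ≡ + p - + 1 - + m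
        reversed m m<p = trans (sym (ℤ.⊖-≥ m<p)) (trans (sym (ℤ.m-n≡m⊖n p (suc m))) (((∀ p m → p -
            (+ 1 + m) ≡ p - + 1 - m) ∋ solve-∀) (+ p) (+ m)))

      -- The step is now (s, -1): the same points are met from n = p - 1 downwards, and `u` is the
      -- unreduced weight at n = p - 1.
      module _ (r̄≡ : r̄ ≡ + q - + s * + p) (k t : ℤ) where

        C-plus-backward : + r * (+ σ * + q) ≤ k → k < + r * (+ σ * + q) + + r →
          k ≡ + r * ((+ p - + 1) * + q - + B * + s * + p) + t * (+ p * + q) → C k ≡ + suc σ
        C-plus-backward lo hi k≡ = C-plus k backward (λ m → t + + m * g) lo hi λ m m<p →
          by-≡ (+ 1) k≡ (by-≡ (+ m) inv (by-≡ (- (+ m * + r)) r̄≡ (by-≡ (+ r * + s * + p) p≡′ (by-≡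
            (+ r * + s * + p - + r * + q) (reversed m m<p)
            (((∀ p q r s σ B r̄ g k t m n → k - m ≡ r * (p * ((σ - n) * s) + q * n) + p * q * (t + m * g)
              + (k - (r * ((p - + 1) * q - B * s * p) + t * (p * q))) * + 1 + (r * r̄ - (+ 1 + p * q * g)) * m +
                (r̄ - (q - s * p)) * - (m * r)
              + (p - (+ 1 + σ + B)) * (r * s * p) + (n - (p - + 1 - m)) * (r * s * p - r * q)) ∋ solve-∀)
              (+ p) (+ q) (+ r) (+ s) (+ σ) (+ B) r̄ g k t (+ m) (+ (p ℕ.∸ suc m)))))))

        C-minus-backward : + r * ((+ ρ + + s) * + p - + q) ≤ k → k < + r * ((+ ρ + + s) * + p - + q) + + r →
          k ≡ + r * (+ σ * + q + + τ * + p) + t * (+ p * + q) → C k ≡ - + B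
        C-minus-backward lo hi k≡ = C-minus k backward (λ m → t + + m * g) lo hi λ m m<p →
          by-≡ (+ 1) k≡ (by-≡ (+ m) inv (by-≡ (- (+ m * + r)) r̄≡ (by-≡ (- (+ r * + q)) p≡′ (by-≡
            (+ r * + s * + p - + r * + q) (reversed m m<p)
            (((∀ p q r s σ τ B r̄ g k t m n → k - m ≡ r * (p * ((p - + 1 - n) * s + τ) + q * (n - B)) + p * q * (t + m * g)
              + (k - (r * (σ * q + τ * p) + t * (p * q))) * + 1 + (r * r̄ - (+ 1 + p * q * g)) * m + (r̄ -
                (q - s * p)) * - (m * r)
              + (p - (+ 1 + σ + B)) * - (r * q) + (n - (p - + 1 - m)) * (r * s * p - r * q)) ∋ solve-∀)
              (+ p) (+ q) (+ r) (+ s) (+ σ) (+ τ) (+ B) r̄ g k t (+ m) (+ (p ℕ.∸ suc m)))))))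

      abstract
        -- Since (p - 1)(q - 1) = p ρ + q σ, this is `p ρ ≥ 2`. The margin of 2 keeps k⁺ within the
        -- degree of Φ_pqr.
        plus-small : + σ * + q + + 2 ≤ (+ p - + 1) * (+ q - + 1)
        plus-small = by-≤ (0≤+ τ ⊗ 0≤+ p ⊕ (gap (+≤+ σ≥1) ⊗ 0≤+ s ⊕ gap (+≤+ 1≤s)) ⊗ 0≤+ p ⊕ gap (+≤+ 2≤p))
          (by-≡ (- + 1) ident (by-≡ (+ p) ρ≡′
            (((∀ p q ρ σ τ s → (p - + 1) * (q - + 1) ≡ σ * q + + 2 + (τ * p + ((σ - + 1) * s + (s - + 1)) * p + (p - + 2))
              + (p * (+ 1 + ρ) + q * (+ 1 + σ) - (+ 1 + p * q)) * - + 1 + (ρ - (σ * s + τ)) * p) ∋ solve-∀)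
              (+ p) (+ q) (+ ρ) (+ σ) (+ τ) (+ s))))
          where
          σ≥1 : 1 ℕ.≤ σ
          σ≥1 = ℕ.≤-<-trans ℕ.z≤n τ<σ
          2≤p : 2 ℕ.≤ p
          2≤p = ℕ.≤-trans (ℕ.s≤s σ≥1) (ℕ.<⇒≤ σ<p)

        minus-small : (+ ρ + + s) * + p - + q + + 2 ≤ (+ p - + 1) * (+ q - + 1)
        minus-small = by-≤ (h-gap ⊕ (gap (+≤+ σ≥1) ⊗ 0≤+ q ⊕ gap (+≤+ 0<q)))
          (by-≡ (- + 1) ident
            (((∀ p q ρ σ s → (p - + 1) * (q - + 1) ≡ (ρ + s) * p - q + + 2 + (q - s * p - + 1 + ((σ - + 1) * q + (q - + 1)))
              + (p * (+ 1 + ρ) + q * (+ 1 + σ) - (+ 1 + p * q)) * - + 1) ∋ solve-∀)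
              (+ p) (+ q) (+ ρ) (+ σ) (+ s)))
          where
          σ≥1 : 1 ℕ.≤ σ
          σ≥1 = ℕ.≤-<-trans ℕ.z≤n τ<σ

        minus-nonneg : + 0 ≤ (+ ρ + + s) * + p - + q
        minus-nonneg = by-≤ (gap (+≤+ 1≤B) ⊗ 0≤+ q ⊕ gap (+≤+ 1≤s) ⊗ 0≤+ p ⊕ 0≤+ 1)
          (by-≡ (+ 1) ident (by-≡ (+ q) p≡′
            (((∀ p q ρ σ B s → (ρ + s) * p - q ≡ + 0 + ((B - + 1) * q + (s - + 1) * p + + 1)
              + (p * (+ 1 + ρ) + q * (+ 1 + σ) - (+ 1 + p * q)) * + 1 + (p - (+ 1 + σ + B)) * q) ∋ solve-∀)
              (+ p) (+ q) (+ ρ) (+ σ) (+ B) (+ s))))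
          where
          1≤B : 1 ℕ.≤ B
          1≤B = ℕ.≤-trans (ℕ.+-cancelˡ-≤ B 1 v (ℕ.≤-trans (ℕ.≤-reflexive (ℕ.+-comm B 1)) (ℕ.≤-trans (ℕ.s≤s B≤σ) σ<B+v))) v≤B

-- The polynomials Φ_p and Φ_pq.

module Binary where

  open import Defs
  open import Data.Integer using (_+_; _*_; _-_; -_; _≤_; _<_; _%ℕ_; _/ℕ_)
  open Series
  open Cyclo
  open Lin

  open CommutativeMonoid *ₚ-commutativeMonoid using () renaming (trans to ≈ₚ-trans; ∙-cong to *ₚ-cong)

  open Algebra.Solver.CommutativeMonoid *ₚ-commutativeMonoid using (solve; _⊜_; id) renaming (_⊕_ to _∙_)

  prime>1 : ∀ {p} → Prime p → 1 ℕ.< p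
  prime>1 {p} pp = ℕ.nonTrivial⇒n>1 p {{prime⇒nonTrivial pp}}

  prime>0 : ∀ {p} → Prime p → 0 ℕ.< p
  prime>0 pp = ℕ.<-trans ℕ.≤-refl (prime>1 pp)

  bezoutℤ : ∀ {m n} → Coprime m n → ∃₂ λ x y → + m * x + + n * y ≡ + 1
  bezoutℤ {m} {n} c with coprime-Bézout c
  ... | Bézout.+- x y e = + x , - + y , (begin
    + m * + x + + n * - + y          ≡⟨ ((∀ m n x y → m * x + n * - y ≡ x * m - y * n) ∋ solve-∀) (+ m) (+ n) (+ x) (+ y) ⟩
    + x * + m - + y * + n            ≡⟨ cong₂ _-_ (ℤ.pos-* x m) (ℤ.pos-* y n) ⟨
    + (x ℕ.* m) - + (y ℕ.* n)        ≡⟨ cong (λ k → + k - + (y ℕ.* n)) e ⟨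
    + 1 + + (y ℕ.* n) - + (y ℕ.* n)  ≡⟨ ((∀ k → + 1 + k - k ≡ + 1) ∋ solve-∀) (+ (y ℕ.* n)) ⟩
    + 1                              ∎)
    where open ≡-Reasoning
  ... | Bézout.-+ x y e = - + x , + y , (begin
    + m * - + x + + n * + y          ≡⟨ ((∀ m n x y → m * - x + n * y ≡ y * n - x * m) ∋ solve-∀) (+ m) (+ n) (+ x) (+ y) ⟩
    + y * + n - + x * + m            ≡⟨ cong₂ _-_ (ℤ.pos-* y n) (ℤ.pos-* x m) ⟨
    + (y ℕ.* n) - + (x ℕ.* m)        ≡⟨ cong (λ k → + k - + (x ℕ.* m)) e ⟨
    + 1 + + (x ℕ.* m) - + (x ℕ.* m)  ≡⟨ ((∀ k → + 1 + k - k ≡ + 1) ∋ solve-∀) (+ (x ℕ.* m)) ⟩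
    + 1                              ∎)
    where open ≡-Reasoning

  record Exponents (p q : ℕ) : Set where
    field
      ρ σ   : ℕ
      ρ<q   : suc ρ ℕ.< q
      σ<p   : suc σ ℕ.< p
      ident : + p * + suc ρ + + q * + suc σ ≡ + 1 + + p * + q

  private
    remainder-one : ∀ (p q x y z : ℤ) → Set
    remainder-one p q x y z = p * x + q * y + p * q * z ≡ + 1

  -- Reducing a Bézout relation gives `p x + q y + p q z = 1` with 0 ≤ x < q and 0 ≤ y < p. Neither
  -- prime divides 1, so `x` and `y` are positive; then z ≥ 0 makes the left side too large and z ≤
  -- -2 too small, leaving z = -1.
  exponents : ∀ {p q} → 1 ℕ.< p → 1 ℕ.< q → Coprime p q → Exponents p q
  exponents {p} {q} 1<p 1<q c =
    build (α %ℕ q) (β %ℕ p) (α /ℕ q + β /ℕ p) (n%ℕd<d α q) (n%ℕd<d β p)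
      (by-≡ (+ 1) αβ (by-≡ (- + p) (a≡a%ℕn+[a/ℕn]*n α q) (by-≡ (- + q) (a≡a%ℕn+[a/ℕn]*n β p)
        (((∀ p q a d x y k l → p * x + q * y + p * q * (k + l) ≡ + 1 + (p * a + q * d - + 1) * + 1
            + (a - (x + k * q)) * - p + (d - (y + l * p)) * - q) ∋ solve-∀)
          (+ p) (+ q) α β (+ (α %ℕ q)) (+ (β %ℕ p)) (α /ℕ q) (β /ℕ p)))))
    where
    instance
      p≢0 = ℕ.>-nonZero (ℕ.<-trans ℕ.≤-refl 1<p)
      q≢0 = ℕ.>-nonZero (ℕ.<-trans ℕ.≤-refl 1<q)
    α = proj₁ (bezoutℤ c)
    β = proj₁ (proj₂ (bezoutℤ c))
    αβ = proj₂ (proj₂ (bezoutℤ c))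
    1≢0 : 1 ≢ 0
    1≢0 ()
    build : ∀ x y z → x ℕ.< q → y ℕ.< p → remainder-one (+ p) (+ q) (+ x) (+ y) z → Exponents p q
    build zero y z x<q y<p eq = contradiction (residue-unique (+ y + + p * z) 1<q (ℕ.<-trans ℕ.≤-refl 1<q)
      (by-≡ (- + 1) eq (((∀ p q y z → + 1 - + 0 ≡ q * (y + p * z) +
        (p * + 0 + q * y + p * q * z - + 1) * - + 1) ∋ solve-∀) (+ p) (+ q) (+ y) z))) 1≢0
    build (suc x) zero z x<q y<p eq = contradiction (residue-unique (+ suc x + + q * z) 1<p (ℕ.<-trans ℕ.≤-refl 1<p)
      (by-≡ (- + 1) eq (((∀ p q x z → + 1 - + 0 ≡ p * (x + q * z) +
        (p * x + q * + 0 + p * q * z - + 1) * - + 1) ∋ solve-∀) (+ p) (+ q) (+ suc x) z))) 1≢0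
    build (suc x) (suc y) (+ z) x<q y<p eq = contradiction
      (by-≤ {+ 1 + + 1} {+ 1} (gap (+≤+ 1<p) ⊕ 0≤+ p ⊗ 0≤+ x ⊕ 0≤+ q ⊗ (0≤+ 1 ⊕ 0≤+ y) ⊕ 0≤+ p ⊗ 0≤+ q ⊗ 0≤+ z)
        (by-≡ (- + 1) eq (((∀ p q x y z → + 1 ≡ + 1 + + 1 + (p - + 2 + p * x + q * (+ 1 + y) + p * q * z)
            + (p * (+ 1 + x) + q * (+ 1 + y) + p * q * z - + 1) * - + 1) ∋ solve-∀) (+ p) (+ q) (+ x) (+ y) (+ z))))
      λ { (+≤+ (ℕ.s≤s ())) }
    build (suc x) (suc y) -[1+ zero ] x<q y<p eq = record
      { ρ = x ; σ = y ; ρ<q = x<q ; σ<p = y<p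
      ; ident = by-≡ (+ 1) eq (((∀ p q x y → p * x + q * y ≡ + 1 + p * q +
          (p * x + q * y + p * q * - + 1 - + 1) * + 1) ∋ solve-∀) (+ p) (+ q) (+ suc x) (+ suc y)) }
    build (suc x) (suc y) -[1+ suc z ] x<q y<p eq = contradiction
      (by-≤ {+ 1} {+ 0} (0≤+ p ⊗ gap (+≤+ (ℕ.<⇒≤ x<q)) ⊕ 0≤+ q ⊗ gap (+≤+ (ℕ.<⇒≤ y<p)) ⊕ 0≤+ p ⊗ 0≤+ q ⊗ 0≤+ z)
        (by-≡ (+ 1) eq (((∀ p q x y z → + 0 ≡ + 1 + (p * (q - x) + q * (p - y) + p * q * z)
            + (p * x + q * y + p * q * - (+ 1 + (+ 1 + z)) - + 1) * + 1) ∋ solve-∀) (+ p) (+ q) (+ suc x) (+ suc y) (+ z))))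
      λ { (+≤+ ()) }

  distinct-primes⇒coprime : ∀ {p q} → Prime p → Prime q → p ≢ q → Coprime p q
  distinct-primes⇒coprime {p} {q} pp pq p≢q = prime∤⇒coprime pq λ q∣p → go (prime⇒irreducible pp q∣p)
    where
    go : ¬ (q ≡ 1 Data.Sum.⊎ q ≡ p)
    go (inj₁ refl) = contradiction (prime>1 pq) λ { (ℕ.s≤s ()) }
    go (inj₂ refl) = p≢q refl

  unit-factor : ∀ {c d} h → Unit c → Unit d → c * h ≡ d → Unit h
  unit-factor {c} h u v refl = trans (sym (ℤ.*-identityˡ _)) (trans (cong (_* (h * h)) (sym u))
    (trans (((∀ c h → c * c * (h * h) ≡ c * h * (c * h)) ∋ solve-∀) c h) v))

  Φ1≡ : Φ 1 ≡ e 1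
  Φ1≡ = sym (e-def 1)

  unit-e : ∀ m → Unit (headₚ (e m))
  unit-e m = subst Unit (sym (head-e m)) refl

  factor-Φ : ∀ n d → 0 ℕ.< d → d ℕ.≤ n → factor n d ≡ Φ d
  factor-Φ n (suc d) _ d<n = nth-table n d d<n

  factor-last : ∀ n → factor n (suc n) ≡ 1ₚ
  factor-last n = nth-beyond (cycloTable n) n (ℕ.≤-reflexive (length-cycloTable n))

  coeffs⇒act : ∀ P f → Causal f → (∀ k → coeffₚ P k ≡ f (+ k)) → act P δ ≗ f
  coeffs⇒act P f f0 eq (+ k)    = trans (act-δ P k) (eq k)
  coeffs⇒act P f f0 eq -[1+ k ] = trans (act-causal P δ-causal k) (sym (f0 k))

  proper-suc : ∀ P {d} → length P ≡ suc d → Unit (headₚ P) → Proper P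
  proper-suc (c ∷ P) _ u = refl , u

  proper-e1 : Proper (e 1)
  proper-e1 = proper-suc (e 1) (cong length (e-def 1)) (unit-e 1)

  degree-e1 : degree (e 1) ≡ 1
  degree-e1 = cong degree (e-def 1)

  module _ (n : ℕ) (pp : Prime (suc n)) where
    private
      p = suc n
      f = window p δ

      0<n : 0 ℕ.< n
      0<n = ℕ.s≤s⁻¹ (prime>1 pp)

      D≈e1 : prodₚ (e 1 ∷ 1ₚ ∷ []) ≈ₚ e 1
      D≈e1 = solve 1 (λ x → x ∙ (id ∙ id) ⊜ x) (λ _ → refl) (e 1)

      factors≡ : map (factor n) (1 ∷ p ∷ []) ≡ e 1 ∷ 1ₚ ∷ []
      factors≡ = cong₂ (λ P Q → P ∷ Q ∷ []) (trans (factor-Φ n 1 ℕ.≤-refl 0<n) Φ1≡) (factor-last n)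

      proper : All Proper (e 1 ∷ 1ₚ ∷ [])
      proper = proper-e1 ∷ (refl , refl) ∷ []

      quotient : ∀ k → act (prodₚ (e 1 ∷ 1ₚ ∷ [])) f k ≡ act (e p) δ k
      quotient k = trans (act-≈ (prodₚ (e 1 ∷ 1ₚ ∷ [])) (e 1) D≈e1 f k) (window-difference p (ℕ.s≤s ℕ.z≤n) δ k)

      beyond : ∀ k → p ℕ.≤ k → f (+ k) ≡ + 0
      beyond k p≤k = trans (∑-cong p λ m m<p → trans (cong δ (trans (ℤ.m-n≡m⊖n k m) (ℤ.⊖-≥ (ℕ.≤-trans (ℕ.<⇒≤ m<p) p≤k))))
        (δ-pos (ℕ.m<n⇒0<n∸m (ℕ.<-≤-trans m<p p≤k)))) (∑-zero p)
        where
        δ-pos : ∀ {j} → 0 ℕ.< j → δ (+ j) ≡ + 0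
        δ-pos {suc j} _ = refl

      N≡ : suc (suc n) ℕ.∸ (degree (e 1) ℕ.+ 0) ≡ suc n
      N≡ = cong (λ d → suc (suc n) ℕ.∸ (d ℕ.+ 0)) degree-e1

    length-Φ-prime : length (Φ (suc n)) ≡ suc n
    length-Φ-prime = trans (length-Φ n (isDivisors-prime pp) (e 1 ∷ 1ₚ ∷ []) factors≡ proper f
        (window-causal p {δ} δ-causal) quotient) N≡

    act-Φ-prime : act (Φ (suc n)) δ ≗ f
    act-Φ-prime = coeffs⇒act (Φ p) f (window-causal p {δ} δ-causal) coeffs
      where
      coeffs : ∀ k → coeffₚ (Φ p) k ≡ f (+ k)
      coeffs k with k ℕ.<? p
      ... | yes k<p = coeff-Φ n (isDivisors-prime pp) (e 1 ∷ 1ₚ ∷ []) factors≡ proper f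
          (window-causal p {δ} δ-causal) quotient k (subst (k ℕ.<_) (sym N≡) k<p)
      ... | no k≮p  = trans (coeff-beyond (Φ p) k (ℕ.≤-trans (ℕ.≤-reflexive length-Φ-prime) (ℕ.≮⇒≥ k≮p)))
                            (sym (beyond k (ℕ.≮⇒≥ k≮p)))

  Φ-prime : ∀ {p} → Prime p → e 1 *ₚ Φ p ≈ₚ e p
  Φ-prime {zero}  pp = contradiction (prime>0 pp) λ ()
  Φ-prime {suc n} pp = δ⇒≈ (e 1 *ₚ Φ (suc n)) (e (suc n)) λ k →
    trans (act-* (e 1) (Φ (suc n)) δ k) (trans (act-cong (e 1) (act-Φ-prime n pp) k) (window-difference (suc n)
      (ℕ.s≤s ℕ.z≤n) δ k))

  degree-Φ-prime : ∀ {p} → Prime p → length (Φ p) ≡ suc (pred p)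
  degree-Φ-prime {zero}  pp = contradiction (prime>0 pp) λ ()
  degree-Φ-prime {suc n} pp = length-Φ-prime n pp

  unit-Φ-prime : ∀ {p} → Prime p → Unit (headₚ (Φ p))
  unit-Φ-prime {p} pp = unit-factor {headₚ (e 1)} (headₚ (Φ p)) (unit-e 1) (unit-e p)
    (trans (sym (head-* (e 1) (Φ p))) (Φ-prime pp 0))

  act-neg : ∀ P f k → act P (λ j → - f j) k ≡ - act P f k
  act-neg P f k = trans (act-cong P (λ j → ((∀ x → - x ≡ - + 1 * x + + 0) ∋ solve-∀) (f j)) k)
    (trans (act-lin P (- + 1) f (λ _ → + 0) k) (trans (cong (_+_ (- + 1 * act P f k)) (act-zero P k))
      (((∀ x → - + 1 * x + + 0 ≡ - x) ∋ solve-∀) (act P f k))))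


  reverse-neg : ∀ P Q R f h → (∀ k → act R (act Q (act P f)) k ≡ - h k) → act P (act Q (λ t → - act R f t)) ≗ h
  reverse-neg P Q R f h eq k = begin
    act P (act Q (λ t → - act R f t)) k  ≡⟨ act-cong P (act-neg Q (act R f)) k ⟩
    act P (λ t → - act Q (act R f) t) k  ≡⟨ act-neg P (act Q (act R f)) k ⟩
    - act P (act Q (act R f)) k          ≡⟨ cong -_ (act-cong P (act-comm Q R f) k) ⟩
    - act P (act R (act Q f)) k          ≡⟨ cong -_ (act-comm P R (act Q f) k) ⟩
    - act R (act P (act Q f)) k          ≡⟨ cong -_ (act-cong R (act-comm P Q f) k) ⟩
    - act R (act Q (act P f)) k          ≡⟨ cong -_ (eq k) ⟩
    - - h k                              ≡⟨ ℤ.neg-involutive (h k) ⟩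
    h k                                  ∎
    where open ≡-Reasoning

  module _ {p q : ℕ} (pp : Prime p) (qp : Prime q) (p≢q : p ≢ q) where

    private
      0<p = prime>0 pp
      0<q = prime>0 qp
      E : Exponents p q
      E = exponents (prime>1 pp) (prime>1 qp) (distinct-primes⇒coprime pp qp p≢q)
      open Exponents E

      inv : + 1 * + 1 ≡ + 1 + + p * + q * + 0
      inv = sym (((∀ x → + 1 + x * + 0 ≡ + 1 * + 1) ∋ solve-∀) (+ p * + q))

      -- The lattice at `r = 1`, where the series is Φ_pq / (1 - x^(pq)); so `c` below is the
      -- coefficient sequence of Φ_pq.
      S : Seq
      S = Lattice.S p q 1 ρ σ 0<p 0<q (ℕ.s≤s ℕ.z≤n) ρ<q σ<p ident (+ 1) (+ 0) inv

      S-causal : Causal S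
      S-causal = Lattice.S-causal p q 1 ρ σ 0<p 0<q (ℕ.s≤s ℕ.z≤n) ρ<q σ<p ident (+ 1) (+ 0) inv

      0<pq : 0 ℕ.< p ℕ.* q
      0<pq = ℕ.*-mono-≤ 0<p 0<q

      c : Seq
      c t = - act (e (p ℕ.* q)) S t

      c-causal : Causal c
      c-causal n = cong -_ (act-causal (e (p ℕ.* q)) {S} S-causal n)

      c-equation : act (e p) (act (e q) c) ≗ act (e (p ℕ.* q)) (act (e 1) δ)
      c-equation k = trans (reverse-neg (e p) (e q) (e (p ℕ.* q)) S (act (e 1) (act (e
          (p ℕ.* q)) δ)) S-equation k) (act-comm (e 1) (e (p ℕ.* q)) δ k)
        where
        S-equation : ∀ k → act (e (p ℕ.* q)) (act (e q) (act (e p) S)) k ≡ - act (e 1) (act (e (p ℕ.* q)) δ) k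
        S-equation = transport {f = S} (ℕ.*-identityʳ p) (ℕ.*-identityʳ q) (ℕ.*-identityʳ (p ℕ.* q))
            (Lattice.S-equation p q 1 ρ σ 0<p 0<q (ℕ.s≤s ℕ.z≤n) ρ<q σ<p ident (+ 1) (+ 0) inv)
          where
          transport : ∀ {i i′ j j′ m m′ l} {f : Seq} → i ≡ i′ → j ≡ j′ → m ≡ m′ →
            (∀ k → act (e l) (act (e j) (act (e i) f)) k ≡ - act (e 1) (act (e m) δ) k) →
            (∀ k → act (e l) (act (e j′) (act (e i′) f)) k ≡ - act (e 1) (act (e m′) δ) k)
          transport refl refl refl eq = eq

      c-beyond : ∀ t → + 1 * (+ p * + q - + p - + q + + 1) < t → c t ≡ + 0
      c-beyond t φ<t = trans (cong -_ (act-e (p ℕ.* q) 0<pq S t))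
        (trans (((∀ x y → - (x - y) ≡ y - x) ∋ solve-∀) (S (t - + (p ℕ.* q))) (S t))
          (Lattice.S-difference-zero p q 1 ρ σ 0<p 0<q (ℕ.s≤s ℕ.z≤n) ρ<q σ<p ident (+ 1) (+ 0) inv t φ<t))

      n = pred (p ℕ.* q)

      suc-n : suc n ≡ p ℕ.* q
      suc-n = ℕ.suc-pred (p ℕ.* q) {{ℕ.>-nonZero 0<pq}}

      D : IsDivisors (suc n) (1 ∷ q ∷ p ∷ p ℕ.* q ∷ [])
      D = subst (λ m → IsDivisors m (1 ∷ q ∷ p ∷ p ℕ.* q ∷ [])) (sym suc-n)
        (subst (λ m → IsDivisors (p ℕ.* q) (1 ∷ q ∷ m ∷ p ℕ.* q ∷ [])) (ℕ.*-identityʳ p)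
          (isDivisors-* pp p∤q (isDivisors-prime qp)))
        where
        p∤q : ¬ p ℕ.∣ q
        p∤q p∣q with prime⇒irreducible qp p∣q
        ... | inj₁ refl = contradiction (prime>1 pp) λ { (ℕ.s≤s ()) }
        ... | inj₂ p≡q = p≢q p≡q

      Ps : List Poly
      Ps = e 1 ∷ Φ q ∷ Φ p ∷ 1ₚ ∷ []

      factors≡ : map (factor n) (1 ∷ q ∷ p ∷ p ℕ.* q ∷ []) ≡ Ps
      factors≡ = cong₂ _∷_ (trans (factor-Φ n 1 ℕ.≤-refl (ℕ.≤-trans 0<q (≤n q<pq))) Φ1≡)
        (cong₂ _∷_ (factor-Φ n q 0<q (≤n q<pq)) (cong₂ _∷_ (factor-Φ n p 0<p (≤n p<pq))
          (cong (λ P → P ∷ []) (trans (cong (factor n) (sym suc-n)) (factor-last n)))))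
        where
        ≤n : ∀ {m} → m ℕ.< p ℕ.* q → m ℕ.≤ n
        ≤n {m} m<pq = ℕ.s≤s⁻¹ (subst (m ℕ.<_) (sym suc-n) m<pq)
        q<pq : q ℕ.< p ℕ.* q
        q<pq = subst (q ℕ.<_) (ℕ.*-comm q p) (ℕ.m<m*n q p {{ℕ.>-nonZero 0<q}} (prime>1 pp))
        p<pq : p ℕ.< p ℕ.* q
        p<pq = ℕ.m<m*n p q {{ℕ.>-nonZero 0<p}} (prime>1 qp)

      proper : All Proper Ps
      proper = proper-e1 ∷ proper-suc (Φ q) (degree-Φ-prime qp) (unit-Φ-prime qp) ∷
        proper-suc (Φ p) (degree-Φ-prime pp) (unit-Φ-prime pp) ∷ (refl , refl) ∷ []

      -- Two factors x - 1 turn Φ_p and Φ_q into x^p - 1 and x^q - 1; `act-regular` removes them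
      -- again in `quotient`.
      cancelled : (e 1 *ₚ e 1) *ₚ prodₚ Ps ≈ₚ e 1 *ₚ (e p *ₚ e q)
      cancelled = ≈ₚ-trans {(e 1 *ₚ e 1) *ₚ prodₚ Ps} {e 1 *ₚ ((e 1 *ₚ Φ p) *ₚ (e 1 *ₚ Φ q))} {e 1 *ₚ (e p *ₚ e q)}
        (solve 3 (λ x y z → (x ∙ x) ∙ (x ∙ (z ∙ (y ∙ id))) ⊜ x ∙ ((x ∙ y) ∙ (x ∙ z))) (λ _ → refl) (e 1) (Φ p) (Φ q))
        (*ₚ-cong {e 1} {e 1} (λ _ → refl) (*ₚ-cong {e 1 *ₚ Φ p} {e p} {e 1 *ₚ Φ q} {e q} (Φ-prime pp) (Φ-prime qp)))

      quotient : ∀ k → act (prodₚ Ps) c k ≡ act (e (suc n)) δ k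
      quotient k = trans (act-regular (e 1 *ₚ e 1) {act (prodₚ Ps) c} {act (e (p ℕ.* q)) δ} (subst Unit (sym
          (head-* (e 1) (e 1))) (unit-* {headₚ (e 1)} (unit-e 1) (unit-e 1))) (act-causal (prodₚ Ps) {c} c-causal)
          (act-causal (e (p ℕ.* q)) {δ} δ-causal) (λ k → begin
        act (e 1 *ₚ e 1) (act (prodₚ Ps) c) k          ≡⟨ act-* (e 1 *ₚ e 1) (prodₚ Ps) c k ⟨
        act ((e 1 *ₚ e 1) *ₚ prodₚ Ps) c k             ≡⟨ act-≈ ((e 1 *ₚ e 1) *ₚ prodₚ Ps) (e 1 *ₚ
          (e p *ₚ e q)) cancelled c k ⟩
        act (e 1 *ₚ (e p *ₚ e q)) c k                  ≡⟨ act-* (e 1) (e p *ₚ e q) c k ⟩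
        act (e 1) (act (e p *ₚ e q) c) k               ≡⟨ act-cong (e 1) (λ k → trans (act-* (e p) (e q) c k)
          (trans (c-equation k) (act-comm (e (p ℕ.* q)) (e 1) δ k))) k ⟩
        act (e 1) (act (e 1) (act (e (p ℕ.* q)) δ)) k  ≡⟨ act-* (e 1) (e 1) (act (e (p ℕ.* q)) δ) k ⟨
        act (e 1 *ₚ e 1) (act (e (p ℕ.* q)) δ) k       ∎) k) (cong (λ m → act (e m) δ k) (sym suc-n))
        where open ≡-Reasoning

      φ : ℕ
      φ = pred p ℕ.* pred q

      N≡ : suc (suc n) ℕ.∸ (degree (e 1) ℕ.+ (degree (Φ q) ℕ.+ (degree (Φ p) ℕ.+ 0))) ≡ suc φ
      N≡ = trans (cong (λ d → suc (suc n) ℕ.∸ (d ℕ.+ (degree (Φ q) ℕ.+ (degree (Φ p) ℕ.+ 0)))) degree-e1) (trans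
          (cong₂ (λ i j → suc (suc n) ℕ.∸ (1 ℕ.+ (i ℕ.+ (j ℕ.+ 0)))) (cong pred (degree-Φ-prime qp)) (cong pred
          (degree-Φ-prime pp)))
        (trans (cong (ℕ._∸ (pred q ℕ.+ (pred p ℕ.+ 0))) (trans suc-n (arith p q 0<p 0<q))) (ℕ.m+n∸n≡m (suc φ)
          (pred q ℕ.+ (pred p ℕ.+ 0)))))
        where
        arith : ∀ p q → 0 ℕ.< p → 0 ℕ.< q → p ℕ.* q ≡ suc (pred p ℕ.* pred q) ℕ.+ (pred q ℕ.+ (pred p ℕ.+ 0))
        arith (suc p) (suc q) _ _ = ((∀ p q → (1 ℕ.+ p) ℕ.* (1 ℕ.+ q) ≡ 1 ℕ.+ p ℕ.* q ℕ.+ (q ℕ.+ (p ℕ.+ 0))) ∋ ℕ-solve-∀) p q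

    degree-Φ-binary : length (Φ (p ℕ.* q)) ≡ suc (pred p ℕ.* pred q)
    degree-Φ-binary = trans (cong (length ∘ Φ) (sym suc-n)) (trans (length-Φ n D Ps factors≡ proper c c-causal quotient) N≡)

    private
      act-Φ-binary : act (Φ (p ℕ.* q)) δ ≗ c
      act-Φ-binary = coeffs⇒act (Φ (p ℕ.* q)) c c-causal coeffs
        where
        coeffs : ∀ k → coeffₚ (Φ (p ℕ.* q)) k ≡ c (+ k)
        coeffs k = cases (k ℕ.<? suc φ)
          where
          φ≡ : + φ ≡ + 1 * (+ p * + q - + p - + q + + 1)
          φ≡ = trans (ℤ.pos-* (pred p) (pred q)) (trans (cong₂ _*_ (pos-pred 0<p) (pos-pred 0<q))
            (((∀ p q → (p - + 1) * (q - + 1) ≡ + 1 * (p * q - p - q + + 1)) ∋ solve-∀) (+ p) (+ q)))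
          cases : Dec (k ℕ.< suc φ) → coeffₚ (Φ (p ℕ.* q)) k ≡ c (+ k)
          cases (yes k<N) = trans (cong (λ m → coeffₚ (Φ m) k) (sym suc-n))
            (coeff-Φ n D Ps factors≡ proper c c-causal quotient k (subst (k ℕ.<_) (sym N≡) k<N))
          cases (no k≮N) = trans (coeff-beyond (Φ (p ℕ.* q)) k (ℕ.≤-trans (ℕ.≤-reflexive degree-Φ-binary) (ℕ.≮⇒≥ k≮N)))
            (sym (c-beyond (+ k) (subst (_< + k) φ≡ (+<+ (ℕ.≮⇒≥ k≮N)))))

    Φ-binary : e p *ₚ (e q *ₚ Φ (p ℕ.* q)) ≈ₚ e (p ℕ.* q) *ₚ e 1
    Φ-binary = δ⇒≈ (e p *ₚ (e q *ₚ Φ (p ℕ.* q))) (e (p ℕ.* q) *ₚ e 1) λ k → begin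
      act (e p *ₚ (e q *ₚ Φ (p ℕ.* q))) δ k            ≡⟨ act-* (e p) (e q *ₚ Φ (p ℕ.* q)) δ k ⟩
      act (e p) (act (e q *ₚ Φ (p ℕ.* q)) δ) k         ≡⟨ act-cong (e p) (act-* (e q) (Φ (p ℕ.* q)) δ) k ⟩
      act (e p) (act (e q) (act (Φ (p ℕ.* q)) δ)) k    ≡⟨ act-cong (e p) (act-cong (e q) act-Φ-binary) k ⟩
      act (e p) (act (e q) c) k                        ≡⟨ c-equation k ⟩
      act (e (p ℕ.* q)) (act (e 1) δ) k                ≡⟨ act-* (e (p ℕ.* q)) (e 1) δ k ⟨
      act (e (p ℕ.* q) *ₚ e 1) δ k                     ∎
      where open ≡-Reasoning

    unit-Φ-binary : Unit (headₚ (Φ (p ℕ.* q)))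
    unit-Φ-binary = unit-factor {headₚ (e p) * headₚ (e q)} (headₚ (Φ (p ℕ.* q)))
      (unit-* {headₚ (e p)} (unit-e p) (unit-e q)) (subst Unit (sym (head-* (e (p ℕ.* q)) (e 1))) (unit-* {headₚ
        (e (p ℕ.* q))} (unit-e (p ℕ.* q)) (unit-e 1)))
      (trans (trans (ℤ.*-assoc (headₚ (e p)) (headₚ (e q)) _) (trans (cong (headₚ (e p) *_) (sym (head-* (e q) (Φ
        (p ℕ.* q)))))
        (sym (head-* (e p) (e q *ₚ Φ (p ℕ.* q)))))) (Φ-binary 0))

-- The polynomial Φ_pqr, its height and its set of coefficients.

module Ternary {p q r : ℕ} (pp : Prime p) (qp : Prime q) (rp : Prime r) (p≢q : p ≢ q) (p≢r : p ≢ r) (q≢r : q ≢ r)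
  (E : Binary.Exponents p q) (r̄ g : ℤ) (inv : + r ℤ.* r̄ ≡ + 1 ℤ.+ + p ℤ.* + q ℤ.* g) where

  open import Defs hiding (A)
  open import Data.Integer using (_+_; _*_; _-_; -_; _≤_; _<_)
  open Series
  open Cyclo
  open Lin
  open Binary
  open Heights

  open CommutativeMonoid *ₚ-commutativeMonoid using () renaming (trans to ≈ₚ-trans; ∙-cong to *ₚ-cong)
  open Algebra.Solver.CommutativeMonoid *ₚ-commutativeMonoid using (solve; _⊜_; id) renaming (_⊕_ to _∙_)

  private
    0<p = prime>0 pp
    0<q = prime>0 qp
    0<r = prime>0 rp

  open Exponents E

  private
    S : Seq
    S = Lattice.S p q r ρ σ 0<p 0<q 0<r ρ<q σ<p ident r̄ g inv

  C : Seq
  C k = - act (e q) (window p S) k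

  private
    window-equation : ∀ T E₁ Q P R N (W f h : Seq) → (∀ k → act E₁ W k ≡ act P f k) → (∀ k → act T f k ≡ - act R
        (act N δ) k) →
      ∀ k → act (T *ₚ E₁) (λ j → - act Q W j) k ≡ act (Q *ₚ (P *ₚ R)) (act N δ) k
    window-equation T E₁ Q P R N W f h W-eq f-eq k = begin
      act (T *ₚ E₁) (λ j → - act Q W j) k          ≡⟨ act-* T E₁ (λ j → - act Q W j) k ⟩
      act T (act E₁ (λ j → - act Q W j)) k         ≡⟨ act-cong T (λ j → trans (act-neg E₁ (act Q W) j)
                                                      (cong -_ (trans (act-comm E₁ Q W j) (act-cong Q W-eq j)))) k ⟩
      act T (λ j → - act Q (act P f) j) k          ≡⟨ act-neg T (act Q (act P f)) k ⟩
      - act T (act Q (act P f)) k                  ≡⟨ cong -_ (trans (act-comm T Q (act P f) k) (act-cong Q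
        (act-comm T P f) k)) ⟩
      - act Q (act P (act T f)) k                  ≡⟨ cong -_ (act-cong Q (λ j → trans (act-cong P f-eq j)
        (act-neg P (act R (act N δ)) j)) k) ⟩
      - act Q (λ j → - act P (act R (act N δ)) j) k ≡⟨ cong -_ (act-neg Q (act P (act R (act N δ))) k) ⟩
      - - act Q (act P (act R (act N δ))) k        ≡⟨ ℤ.neg-involutive (act Q (act P (act R (act N δ))) k) ⟩
      act Q (act P (act R (act N δ))) k            ≡⟨ trans (act-* Q (P *ₚ R) (act N δ) k) (act-cong Q (act-* P R
        (act N δ)) k) ⟨
      act (Q *ₚ (P *ₚ R)) (act N δ) k              ∎
      where open ≡-Reasoning

    T : Poly
    T = e (p ℕ.* q) *ₚ (e (q ℕ.* r) *ₚ e (p ℕ.* r))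

    C-equation : ∀ k → act (T *ₚ e 1) C k ≡ act (e q *ₚ (e p *ₚ e r)) (act (e (p ℕ.* q ℕ.* r)) δ) k
    C-equation = window-equation T (e 1) (e q) (e p) (e r) (e (p ℕ.* q ℕ.* r)) (window p S) S δ (window-difference p 0<p S)
      λ k → trans (act-* (e (p ℕ.* q)) (e (q ℕ.* r) *ₚ e (p ℕ.* r)) S k)
        (trans (act-cong (e (p ℕ.* q)) (act-* (e (q ℕ.* r)) (e (p ℕ.* r)) S) k)
          (Lattice.S-equation p q r ρ σ 0<p 0<q 0<r ρ<q σ<p ident r̄ g inv k))

    n : ℕ
    n = pred (p ℕ.* q ℕ.* r)

    0<pqr : 0 ℕ.< p ℕ.* q ℕ.* r
    0<pqr = ℕ.*-mono-≤ (ℕ.*-mono-≤ 0<p 0<q) 0<r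

    suc-n : suc n ≡ p ℕ.* q ℕ.* r
    suc-n = ℕ.suc-pred (p ℕ.* q ℕ.* r) {{ℕ.>-nonZero 0<pqr}}

    ds : List ℕ
    ds = 1 ∷ r ∷ q ∷ q ℕ.* r ∷ p ∷ p ℕ.* r ∷ p ℕ.* q ∷ p ℕ.* q ℕ.* r ∷ []

    prime∤prime : ∀ {p q} → Prime p → Prime q → p ≢ q → ¬ p ℕ.∣ q
    prime∤prime pp qp p≢q p∣q with prime⇒irreducible qp p∣q
    ... | inj₁ refl = contradiction (prime>1 pp) λ { (ℕ.s≤s ()) }
    ... | inj₂ p≡q  = p≢q p≡q

    D : IsDivisors (suc n) ds
    D = transport (ℕ.*-identityʳ q) (ℕ.*-identityʳ p) (sym (ℕ.*-assoc p q r)) (sym suc-n)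
      (isDivisors-* pp p∤qr (isDivisors-* qp (prime∤prime qp rp q≢r) (isDivisors-prime rp)))
      where
      p∤qr : ¬ p ℕ.∣ q ℕ.* r
      p∤qr p∣qr with euclidsLemma q r pp p∣qr
      ... | inj₁ p∣q = prime∤prime pp qp p≢q p∣q
      ... | inj₂ p∣r = prime∤prime pp rp p≢r p∣r
      transport : ∀ {q′ p′ m m′} → q′ ≡ q → p′ ≡ p → p ℕ.* (q ℕ.* r) ≡ m → m ≡ m′ →
        IsDivisors (p ℕ.* (q ℕ.* r)) (1 ∷ r ∷ q′ ∷ q ℕ.* r ∷ p′ ∷ p ℕ.* r ∷ p ℕ.* q′ ∷ p ℕ.* (q ℕ.* r) ∷ []) →
        IsDivisors m′ (1 ∷ r ∷ q ∷ q ℕ.* r ∷ p ∷ p ℕ.* r ∷ p ℕ.* q ∷ m ∷ [])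
      transport refl refl refl refl d = d

    Ps : List Poly
    Ps = e 1 ∷ Φ r ∷ Φ q ∷ Φ (q ℕ.* r) ∷ Φ p ∷ Φ (p ℕ.* r) ∷ Φ (p ℕ.* q) ∷ 1ₚ ∷ []

    factors≡ : map (factor n) ds ≡ Ps
    factors≡ = trans
      (cong₂ _∷_ (trans (factor-Φ n 1 ℕ.≤-refl (≤n (ℕ.≤-<-trans 0<r (ℕ.<-trans r<qr qr<n)))) Φ1≡)
      (cong₂ _∷_ (factor-Φ n r 0<r (≤n (ℕ.<-trans r<qr qr<n)))
      (cong₂ _∷_ (factor-Φ n q 0<q (≤n (ℕ.<-trans q<pq pq<n)))
      (cong₂ _∷_ (factor-Φ n (q ℕ.* r) (ℕ.*-mono-≤ 0<q 0<r) (≤n qr<n))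
      (cong₂ _∷_ (factor-Φ n p 0<p (≤n (ℕ.<-trans p<pq pq<n)))
      (cong₂ _∷_ (factor-Φ n (p ℕ.* r) (ℕ.*-mono-≤ 0<p 0<r) (≤n pr<n))
      (cong₂ _∷_ (factor-Φ n (p ℕ.* q) (ℕ.*-mono-≤ 0<p 0<q) (≤n pq<n)) refl))))))) last
      where
      last : e 1 ∷ Φ r ∷ Φ q ∷ Φ (q ℕ.* r) ∷ Φ p ∷ Φ (p ℕ.* r) ∷ Φ (p ℕ.* q) ∷ factor n (p ℕ.* q ℕ.* r) ∷ [] ≡ Ps
      last = cong (λ P → e 1 ∷ Φ r ∷ Φ q ∷ Φ (q ℕ.* r) ∷ Φ p ∷ Φ (p ℕ.* r) ∷ Φ (p ℕ.* q) ∷ P ∷ [])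
        (trans (cong (factor n) (sym suc-n)) (factor-last n))
      ≤n : ∀ {m} → m ℕ.< p ℕ.* q ℕ.* r → m ℕ.≤ n
      ≤n {m} m< = ℕ.s≤s⁻¹ (subst (m ℕ.<_) (sym suc-n) m<)
      grow : ∀ m {k} → 0 ℕ.< m → 1 ℕ.< k → m ℕ.< m ℕ.* k
      grow m {k} 0<m 1<k = ℕ.m<m*n m k {{ℕ.>-nonZero 0<m}} 1<k
      r<qr : r ℕ.< q ℕ.* r
      r<qr = subst (r ℕ.<_) (ℕ.*-comm r q) (grow r 0<r (prime>1 qp))
      q<pq : q ℕ.< p ℕ.* q
      q<pq = subst (q ℕ.<_) (ℕ.*-comm q p) (grow q 0<q (prime>1 pp))
      p<pq : p ℕ.< p ℕ.* q
      p<pq = grow p 0<p (prime>1 qp)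
      pq<n : p ℕ.* q ℕ.< p ℕ.* q ℕ.* r
      pq<n = grow (p ℕ.* q) (ℕ.*-mono-≤ 0<p 0<q) (prime>1 rp)
      qr<n : q ℕ.* r ℕ.< p ℕ.* q ℕ.* r
      qr<n = subst (q ℕ.* r ℕ.<_) (((∀ p q r → q ℕ.* r ℕ.* p ≡ p ℕ.* q ℕ.* r) ∋ ℕ-solve-∀) p q r) (grow (q ℕ.* r)
          (ℕ.*-mono-≤ 0<q 0<r) (prime>1 pp))
      pr<n : p ℕ.* r ℕ.< p ℕ.* q ℕ.* r
      pr<n = subst (p ℕ.* r ℕ.<_) (((∀ p q r → p ℕ.* r ℕ.* q ≡ p ℕ.* q ℕ.* r) ∋ ℕ-solve-∀) p q r) (grow (p ℕ.* r)
          (ℕ.*-mono-≤ 0<p 0<r) (prime>1 qp))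

    proper : All Proper Ps
    proper = proper-e1 ∷ proper-suc (Φ r) (degree-Φ-prime rp) (unit-Φ-prime rp) ∷ proper-suc (Φ q)
        (degree-Φ-prime qp) (unit-Φ-prime qp) ∷
      proper-suc (Φ (q ℕ.* r)) (degree-Φ-binary qp rp q≢r) (unit-Φ-binary qp rp q≢r) ∷
      proper-suc (Φ p) (degree-Φ-prime pp) (unit-Φ-prime pp) ∷
      proper-suc (Φ (p ℕ.* r)) (degree-Φ-binary pp rp p≢r) (unit-Φ-binary pp rp p≢r) ∷
      proper-suc (Φ (p ℕ.* q)) (degree-Φ-binary pp qp p≢q) (unit-Φ-binary pp qp p≢q) ∷ (refl , refl) ∷ []

    -- `K` clears all denominators: each of the three Φ of a prime needs one factor x - 1, and each
    -- Φ of a product of two primes needs the two factors x^m - 1 of those primes. Hence the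
    -- exponents 3 and 2 of these factors in `K`.
    U V K : Poly
    U = (e 1 *ₚ (e 1 *ₚ e 1)) *ₚ (e p *ₚ (e q *ₚ e r))
    V = e q *ₚ (e p *ₚ e r)
    K = U *ₚ V

    grouped₁ grouped₂ : Poly
    grouped₁ = e 1 *ₚ (((e 1 *ₚ Φ p) *ₚ ((e 1 *ₚ Φ q) *ₚ (e 1 *ₚ Φ r))) *ₚ
      ((e q *ₚ (e r *ₚ Φ (q ℕ.* r))) *ₚ ((e p *ₚ (e r *ₚ Φ (p ℕ.* r))) *ₚ (e p *ₚ (e q *ₚ Φ (p ℕ.* q))))))
    grouped₂ = e 1 *ₚ ((e p *ₚ (e q *ₚ e r)) *ₚ
      ((e (q ℕ.* r) *ₚ e 1) *ₚ ((e (p ℕ.* r) *ₚ e 1) *ₚ (e (p ℕ.* q) *ₚ e 1))))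

    cancelled : K *ₚ prodₚ Ps ≈ₚ U *ₚ (T *ₚ e 1)
    cancelled = ≈ₚ-trans {K *ₚ prodₚ Ps} {grouped₁} {U *ₚ (T *ₚ e 1)}
      (solve 10 (λ x a b c P Q R qr pr pq →
          (((x ∙ (x ∙ x)) ∙ (a ∙ (b ∙ c))) ∙ (b ∙ (a ∙ c))) ∙ (x ∙ (R ∙ (Q ∙ (qr ∙ (P ∙ (pr ∙ (pq ∙ (id ∙ id))))))))
          ⊜ x ∙ (((x ∙ P) ∙ ((x ∙ Q) ∙ (x ∙ R))) ∙ ((b ∙ (c ∙ qr)) ∙ ((a ∙ (c ∙ pr)) ∙ (a ∙ (b ∙ pq))))))
        (λ _ → refl) (e 1) (e p) (e q) (e r) (Φ p) (Φ q) (Φ r) (Φ (q ℕ.* r)) (Φ (p ℕ.* r)) (Φ (p ℕ.* q)))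
      (≈ₚ-trans {grouped₁} {grouped₂} {U *ₚ (T *ₚ e 1)}
        (*ₚ-cong {e 1} {e 1} (λ _ → refl)
          (*ₚ-cong {(e 1 *ₚ Φ p) *ₚ ((e 1 *ₚ Φ q) *ₚ (e 1 *ₚ Φ r))} {e p *ₚ (e q *ₚ e r)}
            (*ₚ-cong {e 1 *ₚ Φ p} {e p} (Φ-prime pp)
              (*ₚ-cong {e 1 *ₚ Φ q} {e q} {e 1 *ₚ Φ r} {e r} (Φ-prime qp) (Φ-prime rp)))
            (*ₚ-cong {e q *ₚ (e r *ₚ Φ (q ℕ.* r))} {e (q ℕ.* r) *ₚ e 1} (Φ-binary qp rp q≢r)
              (*ₚ-cong {e p *ₚ (e r *ₚ Φ (p ℕ.* r))} {e (p ℕ.* r) *ₚ e 1} {e p *ₚ (e q *ₚ Φ (p ℕ.* q))} {e (p ℕ.* q) *ₚ e 1}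
                (Φ-binary pp rp p≢r) (Φ-binary pp qp p≢q)))))
        (solve 7 (λ x a b c qr pr pq →
          x ∙ ((a ∙ (b ∙ c)) ∙ ((qr ∙ x) ∙ ((pr ∙ x) ∙ (pq ∙ x))))
          ⊜ ((x ∙ (x ∙ x)) ∙ (a ∙ (b ∙ c))) ∙ ((pq ∙ (qr ∙ pr)) ∙ x))
        (λ _ → refl) (e 1) (e p) (e q) (e r) (e (q ℕ.* r)) (e (p ℕ.* r)) (e (p ℕ.* q))))

    unit-product : ∀ P Q → Unit (headₚ P) → Unit (headₚ Q) → Unit (headₚ (P *ₚ Q))
    unit-product P Q u v = subst Unit (sym (head-* P Q)) (unit-* {headₚ P} {headₚ Q} u v)

    unit-K : Unit (headₚ K)
    unit-K = unit-product U V
      (unit-product (e 1 *ₚ (e 1 *ₚ e 1)) (e p *ₚ (e q *ₚ e r))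
        (unit-product (e 1) (e 1 *ₚ e 1) (unit-e 1) (unit-product (e 1) (e 1) (unit-e 1) (unit-e 1)))
        (unit-product (e p) (e q *ₚ e r) (unit-e p) (unit-product (e q) (e r) (unit-e q) (unit-e r))))
      (unit-product (e q) (e p *ₚ e r) (unit-e q) (unit-product (e p) (e r) (unit-e p) (unit-e r)))

    C-causal : Causal C
    C-causal m = cong -_ (act-causal (e q) {window p S} (window-causal p {S}
        (Lattice.S-causal p q r ρ σ 0<p 0<q 0<r ρ<q σ<p ident r̄ g inv)) m)

    -- Both sides agree after multiplication by `K`: `K P f = U T₁ f = U V N δ = K N δ`.
    cancel : ∀ K U T₁ V P N f → Unit (headₚ K) → Causal f → K ≡ U *ₚ V → K *ₚ P ≈ₚ U *ₚ T₁ →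
      (∀ k → act T₁ f k ≡ act V (act N δ) k) → ∀ k → act P f k ≡ act N δ k
    cancel K U T₁ V P N f u f0 refl eq f-eq = act-regular K {act P f} {act N δ} u (act-causal P {f} f0)
        (act-causal N {δ} δ-causal) λ k → begin
      act K (act P f) k           ≡⟨ act-* K P f k ⟨
      act (K *ₚ P) f k            ≡⟨ act-≈ (K *ₚ P) (U *ₚ T₁) eq f k ⟩
      act (U *ₚ T₁) f k           ≡⟨ act-* U T₁ f k ⟩
      act U (act T₁ f) k          ≡⟨ act-cong U f-eq k ⟩
      act U (act V (act N δ)) k   ≡⟨ act-* U V (act N δ) k ⟨
      act (U *ₚ V) (act N δ) k    ∎
      where open ≡-Reasoning

    quotient : ∀ k → act (prodₚ Ps) C k ≡ act (e (suc n)) δ k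
    quotient k = trans (cancel K U (T *ₚ e 1) V (prodₚ Ps) (e (p ℕ.* q ℕ.* r)) C unit-K C-causal refl cancelled C-equation k)
      (cong (λ m → act (e m) δ k) (sym suc-n))

  φ : ℕ
  φ = pred p ℕ.* pred q ℕ.* pred r

  private
    degrees : ℕ
    degrees = degree (e 1) ℕ.+ (degree (Φ r) ℕ.+ (degree (Φ q) ℕ.+ (degree (Φ (q ℕ.* r)) ℕ.+
      (degree (Φ p) ℕ.+ (degree (Φ (p ℕ.* r)) ℕ.+ (degree (Φ (p ℕ.* q)) ℕ.+ 0))))))

    N≡ : suc (suc n) ℕ.∸ degrees ≡ suc φ
    N≡ = trans (cong₂ ℕ._∸_ (cong suc suc-n)
        (cong₂ ℕ._+_ degree-e1 (cong₂ ℕ._+_ (cong pred (degree-Φ-prime rp)) (cong₂ ℕ._+_ (cong pred (degree-Φ-prime qp))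
        (cong₂ ℕ._+_ (cong pred (degree-Φ-binary qp rp q≢r)) (cong₂ ℕ._+_ (cong pred (degree-Φ-prime pp))
        (cong₂ ℕ._+_ (cong pred (degree-Φ-binary pp rp p≢r)) (cong (ℕ._+ 0) (cong pred (degree-Φ-binary pp qp p≢q))))))))))
      (trans (cong (ℕ._∸ total) (arith p q r 0<p 0<q 0<r)) (ℕ.m+n∸n≡m (suc φ) total))
      where
      total : ℕ
      total = 1 ℕ.+ (pred r ℕ.+ (pred q ℕ.+ (pred q ℕ.* pred r ℕ.+ (pred p ℕ.+ (pred p ℕ.* pred r ℕ.+
          (pred p ℕ.* pred q ℕ.+ 0))))))
      arith : ∀ p q r → 0 ℕ.< p → 0 ℕ.< q → 0 ℕ.< r → suc (p ℕ.* q ℕ.* r) ≡ suc (pred p ℕ.* pred q ℕ.* pred r) ℕ.+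
        (1 ℕ.+ (pred r ℕ.+ (pred q ℕ.+ (pred q ℕ.* pred r ℕ.+ (pred p ℕ.+ (pred p ℕ.* pred r ℕ.+
          (pred p ℕ.* pred q ℕ.+ 0)))))))
      arith (suc p) (suc q) (suc r) _ _ _ = ((∀ p q r → 1 ℕ.+ (1 ℕ.+ p) ℕ.* (1 ℕ.+ q) ℕ.* (1 ℕ.+ r) ≡ 1 ℕ.+ p ℕ.* q ℕ.* r ℕ.+
        (1 ℕ.+ (r ℕ.+ (q ℕ.+ (q ℕ.* r ℕ.+ (p ℕ.+ (p ℕ.* r ℕ.+ (p ℕ.* q ℕ.+ 0)))))))) ∋ ℕ-solve-∀) p q r

  length-Φ-ternary : length (Φ (p ℕ.* q ℕ.* r)) ≡ suc φ
  length-Φ-ternary = trans (cong (length ∘ Φ) (sym suc-n)) (trans (length-Φ n D Ps factors≡ proper C C-causal quotient) N≡)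

  coeff-ternary : ∀ k → k ℕ.< suc φ → coeffₚ (Φ (p ℕ.* q ℕ.* r)) k ≡ C (+ k)
  coeff-ternary k k<N = trans (cong (λ m → coeffₚ (Φ m) k) (sym suc-n))
    (coeff-Φ n D Ps factors≡ proper C C-causal quotient k (subst (k ℕ.<_) (sym N≡) k<N))

  coeff-ternary-beyond : ∀ k → suc φ ℕ.≤ k → coeffₚ (Φ (p ℕ.* q ℕ.* r)) k ≡ + 0
  coeff-ternary-beyond k N≤k = coeff-beyond (Φ (p ℕ.* q ℕ.* r)) k (subst (ℕ._≤ k) (sym length-Φ-ternary) N≤k)

  module Height (p+q<pq : p ℕ.+ q ℕ.< p ℕ.* q) where

    private
      N = p ℕ.* q ℕ.* r

      Cₖ : Seq
      Cₖ = Lattice.Kaplan.C p q r ρ σ 0<p 0<q 0<r ρ<q σ<p ident r̄ g inv p+q<pq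

      top : ℕ
      top = Lattice.Kaplan.U p q r ρ σ 0<p 0<q 0<r ρ<q σ<p ident r̄ g inv p+q<pq

    C≡ : ∀ k → C k ≡ Cₖ k
    C≡ k = trans (cong -_ (act-e q 0<q (window p S) k))
      (((∀ x y → - (x - y) ≡ y - x) ∋ solve-∀) (window p S (k - + q)) (window p S k))

    coefficient : ∀ k → k ℕ.≤ φ → a N (+ k) ≡ Cₖ (+ k)
    coefficient k k≤φ = trans (coeff-ternary k (ℕ.s≤s k≤φ)) (C≡ (+ k))

    coefficient-bounds : ∀ k → + top - + p ≤ a N (+ k) × a N (+ k) ≤ + top
    coefficient-bounds k = cases (k ℕ.≤? φ)
      where
      Goal : ℤ → Set
      Goal c = + top - + p ≤ c × c ≤ + top
      cases : Dec (k ℕ.≤ φ) → Goal (a N (+ k))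
      cases (yes k≤φ) = subst Goal (sym (coefficient k k≤φ))
          ((Lattice.Kaplan.U-p≤C p q r ρ σ 0<p 0<q 0<r ρ<q σ<p ident r̄ g inv p+q<pq) (+ k) ,
          (Lattice.Kaplan.C≤U p q r ρ σ 0<p 0<q 0<r ρ<q σ<p ident r̄ g inv p+q<pq) (+ k))
      -- Beyond the degree the coefficient is 0, which lies in the interval because `top ≤ p`.
      cases (no k≰φ)  = subst Goal (sym (coeff-ternary-beyond k (ℕ.≰⇒> k≰φ)))
        (by-≤ (gap (+≤+ (Lattice.Kaplan.U≤p p q r ρ σ 0<p 0<q 0<r ρ<q σ<p ident r̄ g inv p+q<pq))) (((∀ u p
          → + 0 ≡ u - p + (p - u)) ∋ solve-∀) (+ top) (+ p)) , +≤+ ℕ.z≤n)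

    height-bound : ∀ {M} → suc σ ℕ.≤ M → p ℕ.≤ suc σ ℕ.+ M → Defs.A N ℕ.≤ M
    height-bound {M} A≤M p≤A+M = height-≤ (Φ N) λ k → let lower , upper = coefficient-bounds k in ∣∣-≤
      (ℤ.≤-trans (by-≤ (gap (+≤+ ((Lattice.Kaplan.p≤M+U p q r ρ σ 0<p 0<q 0<r ρ<q σ<p ident r̄ g inv p+q<pq) A≤M p≤A+M)))
        (trans (((∀ u p m → u - p ≡ - m + (m + u - p)) ∋ solve-∀) (+ top) (+ p) (+ M)) refl)) lower)
      (ℤ.≤-trans upper (+≤+ ((Lattice.Kaplan.U≤M p q r ρ σ 0<p 0<q 0<r ρ<q σ<p ident r̄ g inv p+q<pq) A≤M p≤A+M)))

    attained : ∀ i j z → i ℕ.≤ φ → j ℕ.≤ φ → Cₖ (+ i) ≤ z → z ≤ Cₖ (+ j) → ∃ λ k → a N (+ k) ≡ z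
    attained i j z i≤φ j≤φ lower upper =
      let k , k≤ , C≡z = Intermediate.attained (λ m → Cₖ (+ m)) (λ m → (Lattice.Kaplan.C-jump p q r ρ σ 0<p 0<q 0<r ρ<q σ<p ident r̄ g inv p+q<pq) (+ suc m)) i j z lower upper
      in k , trans (coefficient k (ℕ.≤-trans k≤ (ℕ.⊔-lub i≤φ j≤φ))) C≡z

    -- If the extreme values suc σ and -B with suc σ + B = p are attained, they determine everything, because top - p ≤ C ≤ top.
    module Extremes {B : ℕ} (p≡ : p ≡ suc σ ℕ.+ B) (B≤A : B ℕ.≤ suc σ) where

      height≤ : Defs.A N ℕ.≤ suc σ
      height≤ = height-bound ℕ.≤-refl (ℕ.≤-trans (ℕ.≤-reflexive p≡) (ℕ.+-monoʳ-≤ (suc σ) B≤A))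

      private
        A≤A : ∀ {z} → z ≤ + top → z ≤ + suc σ
        A≤A z≤U = ℤ.≤-trans z≤U (+≤+ ((Lattice.Kaplan.U≤M p q r ρ σ 0<p 0<q 0<r ρ<q σ<p ident r̄ g inv p+q<pq)
            ℕ.≤-refl (ℕ.≤-trans (ℕ.≤-reflexive p≡) (ℕ.+-monoʳ-≤ (suc σ) B≤A))))

      Conclusion : ℤ → ℤ → Set
      Conclusion k⁻ k⁺ = a N k⁻ ≡ - + B × a N k⁺ ≡ + suc σ ×
        ((z : ℤ) → (∃ λ (k : ℕ) → a N (+ k) ≡ z) ⇔ (- + B ≤ z × z ≤ + suc σ)) × Defs.A N ≡ suc σ

      conclusion : ∀ k⁻ k⁺ → + 0 ≤ k⁻ → k⁻ ≤ + φ → + 0 ≤ k⁺ → k⁺ ≤ + φ → Cₖ k⁻ ≡ - + B → Cₖ k⁺ ≡ + suc σ → Conclusion k⁻ k⁺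
      conclusion (+ i) (+ j) _ (+≤+ i≤φ) _ (+≤+ j≤φ) C⁻ C⁺ =
        trans (coefficient i i≤φ) C⁻ , a⁺ ,
        (λ z → mk⇔ (λ { (k , refl) → lower k , A≤A (proj₂ (coefficient-bounds k)) })
          (λ { (lo , hi) → attained i j z i≤φ j≤φ (subst (_≤ z) (sym C⁻) lo) (subst (z ≤_) (sym C⁺) hi) })) ,
        ℕ.≤-antisym height≤ (subst (ℕ._≤ Defs.A N) (cong ∣_∣ a⁺) (≤-height (Φ N) j))
        where
        a⁺ : a N (+ j) ≡ + suc σ
        a⁺ = trans (coefficient j j≤φ) C⁺
        -- The attained value `suc σ` forces `top ≥ suc σ`, so the general lower bound `top - p` is
        -- at least `suc σ - p = - B`.
        lower : ∀ k → - + B ≤ a N (+ k)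
        lower k = ℤ.≤-trans (by-≤ (gap (subst (_≤ + top) C⁺
            ((Lattice.Kaplan.C≤U p q r ρ σ 0<p 0<q 0<r ρ<q σ<p ident r̄ g inv p+q<pq) (+ j)))) (by-≡ (- + 1)
            (cong +_ p≡)
          (((∀ u p A B → u - p ≡ - B + (u - A) + (p - (A + B)) * - + 1) ∋ solve-∀) (+ top) (+ p) (+ suc σ) (+ B))))
          (proj₁ (coefficient-bounds k))

-- Arithmetic of the hypotheses and the two cases.

module Main (l p q : ℕ) (l-odd : l ℕ.% 2 ≡ 1) (pp : Prime p) (qp : Prime q) (2<p : 2 ℕ.< p) (p<q : p ℕ.< q)
  (q-large : (p ℕ.+ l) ℕ.* p ℕ.≤ 2 ℕ.* q) (q-mod : Defs.modℕ ((l ℕ.+ 2) ℕ.* q) p ≡ Defs.modℕ 2 p)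
  (ρ σ : ℕ) (ρσ : 1 ℕ.+ p ℕ.* q ≡ (ρ ℕ.+ 1) ℕ.* p ℕ.+ (σ ℕ.+ 1) ℕ.* q)
  (s τ : ℕ) (2ρ≡ : 2 ℕ.* ρ ≡ (p ℕ.+ l) ℕ.* s ℕ.+ 2 ℕ.* τ) (2τ< : 2 ℕ.* τ ℕ.< p ℕ.+ l)
  (l+2<p : l ℕ.+ 2 ℕ.< p) where

  open import Data.Integer using (_+_; _*_; _-_; -_; _≤_; _<_; _%ℕ_; _/ℕ_)
  open import Defs using (modℕ)
  open import Defs using (a; half; fdiv; MEquals)
  open import Data.Integer.Divisibility using (_∣_)
  open Lin
  open Binary
  open Cyclo using (prime∤⇒coprime)

  mod⇒ℤ : ∀ {x y} p → modℕ x p ≡ modℕ y p → ∃ λ M → + x - + y ≡ + p * M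
  mod⇒ℤ {x} {y} zero    x≡y = + 0 , trans (cong (λ x → + x - + y) x≡y) (ℤ.+-inverseʳ (+ y))
  mod⇒ℤ {x} {y} (suc p) x≡y = + (x ℕ./ suc p) - + (y ℕ./ suc p) ,
    by-≡ (+ 1) (split x) (by-≡ (- + 1) (split y) (by-≡ (+ 1) (cong +_ x≡y)
      (((∀ p x y c d m n → x - y ≡ p * (c - d) + (x - (m + c * p)) * + 1 + (y - (n + d * p)) * - + 1 +
        (m - n) * + 1) ∋ solve-∀)
        (+ suc p) (+ x) (+ y) (+ (x ℕ./ suc p)) (+ (y ℕ./ suc p)) (+ (x ℕ.% suc p)) (+ (y ℕ.% suc p)))))
    where
    split : ∀ x → + x ≡ + (x ℕ.% suc p) + + (x ℕ./ suc p) * + suc p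
    split x = trans (cong +_ (ℕ.m≡m%n+[m/n]*n x (suc p))) (cong (_+_ (+ (x ℕ.% suc p))) (ℤ.pos-* (x ℕ./ suc p) (suc p)))

  half-double : ∀ z x → z ≡ x * + 2 → half z ≡ x
  half-double z x z≡ = quotient (residue-unique (x - z /ℕ 2) (n%ℕd<d z 2) (ℕ.s≤s ℕ.z≤n)
    (by-≡ (+ 1) z≡ (by-≡ (- + 1) (a≡a%ℕn+[a/ℕn]*n z 2)
      (((∀ z x c m → m - + 0 ≡ + 2 * (x - c) + (z - x * + 2) * + 1 + (z - (m + c * + 2)) * - + 1) ∋ solve-∀) z x
        (z /ℕ 2) (+ (z %ℕ 2))))))
    where
    quotient : z %ℕ 2 ≡ 0 → z /ℕ 2 ≡ x
    quotient m≡0 = ℤ.*-cancelʳ-≡ (z /ℕ 2) x (+ 2) (by-≡ (+ 1) z≡ (by-≡ (- + 1) (a≡a%ℕn+[a/ℕn]*n z 2) (by-≡ (- + 1)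
        (cong +_ m≡0)
      (((∀ z x c m → c * + 2 ≡ x * + 2 + (z - x * + 2) * + 1 + (z - (m + c * + 2)) * - + 1 +
        (m - + 0) * - + 1) ∋ solve-∀) z x (z /ℕ 2) (+ (z %ℕ 2))))))

  -- The exponent r u + t d, where t is chosen so that it exceeds r α by at most d.
  exponent : ℕ → ℤ → ℤ → ℕ → ℤ
  exponent r α u d = + r * u + (fdiv ((α - u) * + r) d + + 1) * + d

  -- The excess over `r α` is `d` minus a remainder modulo `d`, hence between 1 and `d`. With
  -- `d = p q` this is where r > p q puts the exponent into the threshold interval.
  exponent-bounds : ∀ r α u d → 0 ℕ.< d → d ℕ.< r → + r * α ≤ exponent r α u d × exponent r α u d < + r * α + + r
  exponent-bounds r α u (suc d) _ d<r =
    by-≤ (gap (+≤+ (ℕ.<⇒≤ (n%ℕd<d x (suc d)))))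
      (by-≡ (- + 1) split (((∀ r α u d c m → r * u + (c + + 1) * d ≡ r * α + (d - m) + ((α - u) * r -
        (m + c * d)) * - + 1) ∋ solve-∀)
        (+ r) α u (+ suc d) (x /ℕ suc d) (+ (x %ℕ suc d)))) ,
    by-< (gap< (+<+ d<r) ⊕ 0≤+ (x %ℕ suc d))
      (by-≡ (+ 1) split (((∀ r α u d c m → r * α + r ≡ r * u + (c + + 1) * d + + 1 + (r - d - + 1 + m) +
        ((α - u) * r - (m + c * d)) * + 1) ∋ solve-∀)
        (+ r) α u (+ suc d) (x /ℕ suc d) (+ (x %ℕ suc d))))
    where
    x = (α - u) * + r
    split : x ≡ + (x %ℕ suc d) + (x /ℕ suc d) * + suc d
    split = a≡a%ℕn+[a/ℕn]*n x (suc d)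

  private
    1<p : 1 ℕ.< p
    1<p = prime>1 pp
    0<p = prime>0 pp
    0<q = prime>0 qp

  ident : + p * + suc ρ + + q * + suc σ ≡ + 1 + + p * + q
  ident = sym (begin
    + 1 + + p * + q                                    ≡⟨ cong (_+_ (+ 1)) (ℤ.pos-* p q) ⟨
    + (1 ℕ.+ p ℕ.* q)                                  ≡⟨ cong +_ ρσ ⟩
    + ((ρ ℕ.+ 1) ℕ.* p ℕ.+ (σ ℕ.+ 1) ℕ.* q)           ≡⟨ cong₂ (λ m n → + (m ℕ.+ n)) (reorder ρ p) (reorder σ q) ⟩
    + (p ℕ.* suc ρ) + + (q ℕ.* suc σ)                 ≡⟨ cong₂ _+_ (ℤ.pos-* p (suc ρ)) (ℤ.pos-* q (suc σ)) ⟩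
    + p * + suc ρ + + q * + suc σ                      ∎)
    where
    open ≡-Reasoning
    reorder : ∀ x y → (x ℕ.+ 1) ℕ.* y ≡ y ℕ.* suc x
    reorder x y = trans (ℕ.*-comm (x ℕ.+ 1) y) (cong (y ℕ.*_) (ℕ.+-comm x 1))

  Ex : Exponents p q
  Ex = record { ρ = ρ ; σ = σ ; ident = ident
    -- If `suc ρ ≥ q`, the identity leaves `q (σ + 1) ≤ 1`.
    ; ρ<q = ℕ.≰⇒> λ q≤ → contradiction (prime>1 qp) (ℕ.≤⇒≯ (ℤ.drop‿+≤+ {q} {1} (by-≤ (gap (+≤+ q≤) ⊗ 0≤+ p ⊕ 0≤+ q ⊗ 0≤+ σ)
        (by-≡ (- + 1) ident (((∀ p q x σ → + 1 ≡ q + ((x - q) * p + q * σ) + (p * x + q * (+ 1 + σ) -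
          (+ 1 + p * q)) * - + 1) ∋ solve-∀) (+ p) (+ q) (+ suc ρ) (+ σ))))))
    ; σ<p = ℕ.≰⇒> λ p≤ → contradiction 1<p (ℕ.≤⇒≯ (ℤ.drop‿+≤+ {p} {1} (by-≤ (gap (+≤+ p≤) ⊗ 0≤+ q ⊕ 0≤+ p ⊗ 0≤+ ρ)
        (by-≡ (- + 1) ident (((∀ p q y ρ → + 1 ≡ p + ((y - p) * q + p * ρ) + (p * (+ 1 + ρ) + q * y -
          (+ 1 + p * q)) * - + 1) ∋ solve-∀) (+ p) (+ q) (+ suc σ) (+ ρ))))))
    }

  open Exponents Ex using (ρ<q; σ<p)

  private
    e = l ℕ./ 2

    l≡ : l ≡ 1 ℕ.+ e ℕ.* 2
    l≡ = trans (ℕ.m≡m%n+[m/n]*n l 2) (cong (ℕ._+ e ℕ.* 2) l-odd)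

    l≡′ : + l ≡ + 1 + + e * + 2
    l≡′ = trans (cong +_ l≡) (cong (_+_ (+ 1)) (ℤ.pos-* e 2))

    M = proj₁ (mod⇒ℤ p q-mod)

    M≡ : (+ l + + 2) * + q - + 2 ≡ + p * M
    M≡ = trans (cong (_- + 2) (sym (ℤ.pos-* (l ℕ.+ 2) q))) (proj₂ (mod⇒ℤ p q-mod))

    M′ : ℤ
    M′ = (+ 2 * (+ 1 + + σ) - (+ l + + 2)) * (+ 1 + + ρ - + q) + (+ 1 + + σ) * (+ 2 * + q - + 2 * (+ 1 + + ρ) - M)

    -- Multiply `(l + 2) q ≡ 2` by `σ + 1`, the inverse of `q` modulo `p`.
    2A-l-2 : + (2 ℕ.* suc σ) - + (l ℕ.+ 2) ≡ + p * M′
    2A-l-2 = trans (cong (_- (+ l + + 2)) (ℤ.pos-* 2 (suc σ)))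
      (by-≡ (- (+ 2 * (+ 1 + + σ) - (+ l + + 2)) + + 2 * (+ 1 + + σ)) ident (by-≡ (- (+ 1 + + σ)) M≡
        (((∀ p q l ρ σ M → + 2 * (+ 1 + σ) - (l + + 2) ≡ p * ((+ 2 * (+ 1 + σ) - (l + + 2)) * (+ 1 + ρ - q) +
          (+ 1 + σ) * (+ 2 * q - + 2 * (+ 1 + ρ) - M))
          + (p * (+ 1 + ρ) + q * (+ 1 + σ) - (+ 1 + p * q)) * (- (+ 2 * (+ 1 + σ) - (l + + 2)) + + 2 *
            (+ 1 + σ)) + ((l + + 2) * q - + 2 - p * M) * - (+ 1 + σ)) ∋ solve-∀)
          (+ p) (+ q) (+ l) (+ ρ) (+ σ) M)))

  -- 2 (σ + 1) ≡ l + 2 (mod p), both sides have different parity, and 0 < 2 (σ + 1) < 2p.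
  2A≡ : 2 ℕ.* suc σ ≡ p ℕ.+ (l ℕ.+ 2)
  2A≡ = cases (2 ℕ.* suc σ ℕ.<? p)
    where
    cases : Dec (2 ℕ.* suc σ ℕ.< p) → 2 ℕ.* suc σ ≡ p ℕ.+ (l ℕ.+ 2)
    cases (yes 2A<p) = contradiction (trans (sym l-odd) (trans (cong (ℕ._% 2) l≡2σ) (ℕ.m*n%n≡0 σ 2))) λ ()
      where
      l≡2σ : l ≡ σ ℕ.* 2
      l≡2σ = ℕ.+-cancelʳ-≡ 2 l (σ ℕ.* 2) (trans (sym (residue-unique M′ 2A<p l+2<p 2A-l-2)) (((∀ σ → 2 ℕ.*
          (1 ℕ.+ σ) ≡ σ ℕ.* 2 ℕ.+ 2) ∋ ℕ-solve-∀) σ))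
    cases (no 2A≮p) = trans (sym p+z) (cong (p ℕ.+_) (residue-unique (M′ - + 1) z<p l+2<p
        (by-≡ (+ 1) 2A-l-2 (by-≡ (+ 1) (cong +_ p+z) (((∀ p z x y M → z - y ≡ p * (M - + 1) +
          (x - y - p * M) * + 1 + (p + z - x) * + 1) ∋ solve-∀)
          (+ p) (+ z) (+ (2 ℕ.* suc σ)) (+ (l ℕ.+ 2)) M′)))))
      where
      z = 2 ℕ.* suc σ ℕ.∸ p
      p+z : p ℕ.+ z ≡ 2 ℕ.* suc σ
      p+z = ℕ.m+[n∸m]≡n (ℕ.≮⇒≥ 2A≮p)
      z<p : z ℕ.< p
      z<p = ℕ.+-cancelˡ-< p z p (subst₂ ℕ._<_ (sym p+z) (cong (p ℕ.+_) (ℕ.+-identityʳ p)) (ℕ.*-monoʳ-< 2 σ<p))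

  2σ≡ : 2 ℕ.* σ ≡ p ℕ.+ l
  2σ≡ = ℕ.+-cancelʳ-≡ 2 (2 ℕ.* σ) (p ℕ.+ l) (trans (((∀ σ → 2 ℕ.* σ ℕ.+ 2 ≡ 2 ℕ.* (1 ℕ.+ σ)) ∋ ℕ-solve-∀) σ)
    (trans 2A≡ (sym (ℕ.+-assoc p l 2))))

  B : ℕ
  B = p ℕ.∸ suc σ

  p≡ : p ≡ suc σ ℕ.+ B
  p≡ = sym (ℕ.m+[n∸m]≡n (ℕ.<⇒≤ σ<p))

  σ≡ : σ ≡ suc (B ℕ.+ l)
  σ≡ = ℕ.+-cancelˡ-≡ σ σ (suc (B ℕ.+ l)) (trans (((∀ σ → σ ℕ.+ σ ≡ 2 ℕ.* σ) ∋ ℕ-solve-∀) σ) (trans 2σ≡ (trans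
      (cong (ℕ._+ l) p≡)
    (((∀ σ B l → 1 ℕ.+ σ ℕ.+ B ℕ.+ l ≡ σ ℕ.+ (1 ℕ.+ (B ℕ.+ l))) ∋ ℕ-solve-∀) σ B l))))

  p≡2B : p ≡ 2 ℕ.* B ℕ.+ (l ℕ.+ 2)
  p≡2B = trans p≡ (trans (cong (λ σ → suc σ ℕ.+ B) σ≡) (((∀ B l → 1 ℕ.+ (1 ℕ.+ (B ℕ.+ l)) ℕ.+ B ≡ 2 ℕ.* B ℕ.+
      (l ℕ.+ 2)) ∋ ℕ-solve-∀) B l))

  B≤σ : B ℕ.≤ σ
  B≤σ = subst (B ℕ.≤_) (sym σ≡) (ℕ.m≤n⇒m≤1+n (ℕ.m≤m+n B l))

  ρ≡ : ρ ≡ σ ℕ.* s ℕ.+ τ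
  ρ≡ = ℕ.*-cancelˡ-≡ ρ (σ ℕ.* s ℕ.+ τ) 2 (trans 2ρ≡ (trans (cong (λ n → n ℕ.* s ℕ.+ 2 ℕ.* τ) (sym 2σ≡))
    (((∀ σ s τ → 2 ℕ.* σ ℕ.* s ℕ.+ 2 ℕ.* τ ≡ 2 ℕ.* (σ ℕ.* s ℕ.+ τ)) ∋ ℕ-solve-∀) σ s τ)))

  τ<σ : τ ℕ.< σ
  τ<σ = ℕ.*-cancelˡ-< 2 τ σ (subst (2 ℕ.* τ ℕ.<_) (sym 2σ≡) 2τ<)

  σp≤q : σ ℕ.* p ℕ.≤ q
  σp≤q = ℕ.*-cancelˡ-≤ 2 (subst (ℕ._≤ 2 ℕ.* q) (trans (cong (ℕ._* p) (sym 2σ≡)) (ℕ.*-assoc 2 σ p)) q-large)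

  p+q<pq : p ℕ.+ q ℕ.< p ℕ.* q
  p+q<pq = ℤ.drop‿+<+ (by-< (gap (+≤+ 2<p) ⊗ 0≤+ q ⊕ gap (+≤+ p<q) ⊕ 0≤+ q) (trans (ℤ.pos-* p q)
    (((∀ p q → p * q ≡ p + q + + 1 + ((p - + 3) * q + (q - (+ 1 + p)) + q)) ∋ solve-∀) (+ p) (+ q))))

  m≡ : (p ℕ.+ l ℕ.+ 2) ℕ./ 2 ≡ suc σ
  m≡ = trans (cong (ℕ._/ 2) (trans (ℕ.+-assoc p l 2) (trans (sym 2A≡) (ℕ.*-comm 2 (suc σ))))) (ℕ.m*n/n≡m (suc σ) 2)

  private
    2σ≡′ : + p + + l ≡ + 2 * + σ
    2σ≡′ = trans (cong +_ (sym 2σ≡)) (ℤ.pos-* 2 σ)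

    2B≡′ : + p ≡ + 2 * + B + (+ l + + 2)
    2B≡′ = trans (cong +_ p≡2B) (cong (_+ (+ l + + 2)) (ℤ.pos-* 2 B))

  half-α : half ((+ p + + l) * + q) ≡ + σ * + q
  half-α = half-double _ _ (by-≡ (+ q) 2σ≡′ (((∀ p l q σ → (p + l) * q ≡ σ * q * + 2 +
      (p + l - + 2 * σ) * q) ∋ solve-∀) (+ p) (+ l) (+ q) (+ σ)))

  half-u₁ : half ((+ p - + l - + 2) * + q) ≡ + B * + q
  half-u₁ = half-double _ _ (by-≡ (+ q) 2B≡′ (((∀ p l q B → (p - l - + 2) * q ≡ B * q * + 2 + (p - (+ 2 * B +
      (l + + 2))) * q) ∋ solve-∀) (+ p) (+ l) (+ q) (+ B)))

  half-u₂ : half ((+ p - + l - + 2) * + s * + p) ≡ + B * + s * + p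
  half-u₂ = half-double _ _ (by-≡ (+ s * + p) 2B≡′ (((∀ p l s B → (p - l - + 2) * s * p ≡ B * s * p * + 2 + (p -
      (+ 2 * B + (l + + 2))) * (s * p)) ∋ solve-∀) (+ p) (+ l) (+ s) (+ B)))

  half-lo : half (+ p - + l - + 2) ≡ + B
  half-lo = half-double _ _ (by-≡ (+ 1) 2B≡′ (((∀ p l B → p - l - + 2 ≡ B * + 2 + (p - (+ 2 * B +
      (l + + 2))) * + 1) ∋ solve-∀) (+ p) (+ l) (+ B)))

  half-hi : half (+ p + + l + + 2) ≡ + suc σ
  half-hi = half-double _ _ (by-≡ (+ 1) 2σ≡′ (((∀ p l σ → p + l + + 2 ≡ (+ 1 + σ) * + 2 +
      (p + l - + 2 * σ) * + 1) ∋ solve-∀) (+ p) (+ l) (+ σ)))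

  private
    p≢r : ∀ {r} → q ℕ.< r → p ≢ r
    p≢r q<r = ℕ.<⇒≢ (ℕ.<-trans p<q q<r)

    p≢q : p ≢ q
    p≢q = ℕ.<⇒≢ p<q

    r∤pq : ∀ {r} → Prime r → q ℕ.< r → ¬ r ℕ.∣ p ℕ.* q
    r∤pq rp q<r r∣pq with euclidsLemma p q rp r∣pq
    ... | inj₁ r∣p = ℕ.<⇒≱ (ℕ.<-trans p<q q<r) (ℕ.∣⇒≤ {{ℕ.>-nonZero 0<p}} r∣p)
    ... | inj₂ r∣q = ℕ.<⇒≱ q<r (ℕ.∣⇒≤ {{ℕ.>-nonZero 0<q}} r∣q)

  -- The height bound asks only for an inverse of `r` modulo `p q`, and a prime above both `p` and
  -- `q` has one.
  M-bound : ∀ r → Prime r → q ℕ.< r → Defs.A (p ℕ.* q ℕ.* r) ℕ.≤ suc σ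
  M-bound r rp q<r = bound (bezoutℤ (Coprimality.sym (prime∤⇒coprime rp (r∤pq rp q<r))))
    where
    bound : (∃ λ x → ∃ λ y → + r * x + + (p ℕ.* q) * y ≡ + 1) → Defs.A (p ℕ.* q ℕ.* r) ℕ.≤ suc σ
    bound (x , y , eq) = Ternary.Height.Extremes.height≤ pp qp rp p≢q (p≢r q<r) (ℕ.<⇒≢ q<r) Ex x (- y)
      (by-≡ (+ 1) eq (by-≡ (- y) (ℤ.pos-* p q) (((∀ r x n y p q → r * x ≡ + 1 + p * q * - y +
        (r * x + n * y - + 1) * + 1 + (n - p * q) * - y) ∋ solve-∀)
        (+ r) x (+ (p ℕ.* q)) y (+ p) (+ q)))) p+q<pq p≡ (ℕ.m≤n⇒m≤1+n B≤σ)

  -- Here 6 (σ + 1) = 3 p + 3 (l + 2). Strictness comes from primality: `3 (l + 2) = p` would force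
  -- `p = 3` and `l + 2 = 1`.
  3m<2p : 3 ℕ.* (l ℕ.+ 2) ℕ.≤ p → 3 ℕ.* suc σ ℕ.< 2 ℕ.* p
  3m<2p 3l≤p = ℕ.*-cancelˡ-< 2 (3 ℕ.* suc σ) (2 ℕ.* p) (subst₂ ℕ._<_
    (trans (cong (3 ℕ.*_) (sym 2A≡)) (((∀ x → 3 ℕ.* (2 ℕ.* x) ≡ 2 ℕ.* (3 ℕ.* x)) ∋ ℕ-solve-∀) (suc σ)))
    (((∀ p → 3 ℕ.* p ℕ.+ p ≡ 2 ℕ.* (2 ℕ.* p)) ∋ ℕ-solve-∀) p)
    (ℕ.≤-<-trans (ℕ.≤-reflexive (ℕ.*-distribˡ-+ 3 p (l ℕ.+ 2))) (ℕ.+-monoʳ-< (3 ℕ.* p) (ℕ.≤∧≢⇒< 3l≤p 3l≢p))))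
    where
    3l≢p : 3 ℕ.* (l ℕ.+ 2) ≢ p
    3l≢p 3l≡p with prime⇒irreducible pp (subst (3 ℕ.∣_) 3l≡p (ℕ.m∣m*n (l ℕ.+ 2)))
    ... | inj₂ 3≡p = contradiction (ℕ.*-cancelˡ-≡ (l ℕ.+ 2) 1 3 (trans 3l≡p (sym 3≡p))) (l+2≢1 l)
      where
      l+2≢1 : ∀ l → l ℕ.+ 2 ≢ 1
      l+2≢1 (suc zero)    ()
      l+2≢1 (suc (suc _)) ()

  -- l + 2 and 2 are invertible modulo p.
  w≡q : ∀ {w} → modℕ (w ℕ.* (l ℕ.+ 2)) p ≡ modℕ 2 p → ∃ λ N → + w - + q ≡ + p * N
  -- From `p + l = 2 σ` and `l = 1 + 2 e`, the number `σ - e` is (p + 1) / 2, the inverse of 2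
  -- modulo `p`; it removes the factor 2 from `2[w-q]`.
  w≡q {w} w-mod = N₂ * (+ σ - + e) - (+ w - + q) ,
    by-≡ (+ σ - + e) 2[w-q] (by-≡ (+ w - + q) 2σ≡′ (by-≡ (- (+ w - + q)) l≡′
      (((∀ p l σ e d N₂ → d ≡ p * (N₂ * (σ - e) - d) + (+ 2 * d - p * N₂) * (σ - e) + (p + l - + 2 * σ) * d + (l -
        (+ 1 + e * + 2)) * - d) ∋ solve-∀)
        (+ p) (+ l) (+ σ) (+ e) (+ w - + q) N₂)))
    where
    M₁ = proj₁ (mod⇒ℤ p w-mod)
    M₁≡ : + w * (+ l + + 2) - + 2 ≡ + p * M₁
    M₁≡ = trans (cong (_- + 2) (sym (ℤ.pos-* w (l ℕ.+ 2)))) (proj₂ (mod⇒ℤ p w-mod))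
    N₂ : ℤ
    N₂ = + 2 * (+ w - + q) * (+ 1 + + ρ) - + 2 * (+ w - + q) * + q + + q * (+ w - + q) + + q * (M₁ - M)
    2[w-q] : + 2 * (+ w - + q) ≡ + p * N₂
    2[w-q] = by-≡ (- (+ 2 * (+ w - + q))) ident (by-≡ (- (+ q * (+ w - + q))) 2σ≡′ (by-≡ (+ q) M₁≡ (by-≡ (- + q) M≡
      (((∀ p q l ρ σ w M M₁ → + 2 * (w - q) ≡ p * (+ 2 * (w - q) * (+ 1 + ρ) - + 2 * (w - q) * q + q *
        (w - q) + q * (M₁ - M))
        + (p * (+ 1 + ρ) + q * (+ 1 + σ) - (+ 1 + p * q)) * - (+ 2 * (w - q)) + (p + l - + 2 * σ) * - (q * (w - q))
        + (w * (l + + 2) - + 2 - p * M₁) * q + ((l + + 2) * q - + 2 - p * M) * - q) ∋ solve-∀)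
        (+ p) (+ q) (+ l) (+ ρ) (+ σ) (+ w) M M₁))))

  -- What the evaluation needs to know of an exponent, with `half` and `fdiv` already eliminated.
  record Located (r : ℕ) (α u k : ℤ) : Set where
    field
      t      : ℤ
      k≡     : k ≡ + r * u + t * (+ p * + q)
      lower  : + r * α ≤ k
      upper  : k < + r * α + + r

  located : ∀ r {α α′ u u′} → p ℕ.* q ℕ.< r → α ≡ α′ → u ≡ u′ → Located r α′ u′ (exponent r α u (p ℕ.* q))
  located r {α} {_} {u} pq<r refl refl = record
    { t = fdiv ((α - u) * + r) (p ℕ.* q) + + 1
    ; k≡ = cong (λ d → + r * u + (fdiv ((α - u) * + r) (p ℕ.* q) + + 1) * d) (ℤ.pos-* p q)
    ; lower = proj₁ (exponent-bounds r α u (p ℕ.* q) (ℕ.*-mono-≤ 0<p 0<q) pq<r)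
    ; upper = proj₂ (exponent-bounds r α u (p ℕ.* q) (ℕ.*-mono-≤ 0<p 0<q) pq<r)
    }

  Claim : ℕ → ℤ → ℤ → ℤ → ℤ → ℕ → Set
  Claim r k⁻ k⁺ lo hi m = (a (p ℕ.* q ℕ.* r) k⁻ ≡ lo) × (a (p ℕ.* q ℕ.* r) k⁺ ≡ hi)
    × ((z : ℤ) → (∃ λ (k : ℕ) → a (p ℕ.* q ℕ.* r) (+ k) ≡ z) ⇔ (lo ≤ z × z ≤ hi))
    × MEquals p q m × 3 ℕ.* m ℕ.< 2 ℕ.* p

  Claim-resp : ∀ {r k⁻ k⁺ lo lo′ hi hi′ m m′} → lo′ ≡ lo → hi′ ≡ hi → m′ ≡ m → Claim r k⁻ k⁺ lo hi m
      → Claim r k⁻ k⁺ lo′ hi′ m′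
  Claim-resp refl refl refl c = c

  -- Common form of both cases: `v` represents -1/r modulo `p` and satisfies `l + 2 ≤ v ≤ B`. Only
  -- the direction of the walk, that is the sign of `r̄`, still differs.
  module Case {r : ℕ} (rp : Prime r) (pq<r : p ℕ.* q ℕ.< r) (r̄ g : ℤ) (inv : + r * r̄ ≡ + 1 + + p * + q * g)
    (v : ℕ) (v≤B : v ℕ.≤ B) (l+2≤v : l ℕ.+ 2 ℕ.≤ v) (M₀ : ℤ) (rv≡-1 : + 1 + + r * + v ≡ + p * M₀) (1≤s : 1 ℕ.≤ s) where

    private
      q<r : q ℕ.< r
      q<r = ℕ.≤-<-trans (ℕ.m≤n*m q p {{ℕ.>-nonZero 0<p}}) pq<r

      σ<B+v : σ ℕ.< B ℕ.+ v
      σ<B+v = ℕ.≤-trans (ℕ.≤-reflexive (trans (cong suc σ≡) (((∀ B l → 1 ℕ.+ (1 ℕ.+ (B ℕ.+ l)) ≡ B ℕ.+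
          (l ℕ.+ 2)) ∋ ℕ-solve-∀) B l))) (ℕ.+-monoʳ-≤ B l+2≤v)

      3l≤p : 3 ℕ.* (l ℕ.+ 2) ℕ.≤ p
      3l≤p = ℕ.≤-trans (ℕ.≤-reflexive (((∀ x → 3 ℕ.* x ≡ 2 ℕ.* x ℕ.+ x) ∋ ℕ-solve-∀) (l ℕ.+ 2)))
        (ℕ.≤-trans (ℕ.+-monoˡ-≤ (l ℕ.+ 2) (ℕ.*-monoʳ-≤ 2 (ℕ.≤-trans l+2≤v v≤B))) (ℕ.≤-reflexive (sym p≡2B)))

    private
      φ : ℕ
      φ = Ternary.φ pp qp rp p≢q (p≢r q<r) (ℕ.<⇒≢ q<r) Ex r̄ g inv

      C : ℤ → ℤ
      C = Lattice.Kaplan.C p q r ρ σ 0<p 0<q (prime>0 rp) ρ<q σ<p ident r̄ g inv p+q<pq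

      F : ℤ
      F = (+ p - + 1) * (+ q - + 1)

      F≤r : F ≤ + r
      F≤r = by-≤ (gap< (+<+ pq<r) ⊕ 0≤+ p ⊕ 0≤+ q) (by-≡ (+ 1) (ℤ.pos-* p q)
        (((∀ p q r n → r ≡ (p - + 1) * (q - + 1) + (r - n - + 1 + p + q) + (n - p * q) * + 1) ∋ solve-∀) (+ p)
          (+ q) (+ r) (+ (p ℕ.* q))))

      φ≡ : + φ ≡ F * (+ r - + 1)
      φ≡ = trans (ℤ.pos-* (pred p ℕ.* pred q) (pred r)) (cong₂ _*_
        (trans (ℤ.pos-* (pred p) (pred q)) (cong₂ _*_ (pos-pred 0<p) (pos-pred 0<q))) (pos-pred (prime>0 rp)))

      -- As r > p q gives `F ≤ r`, the degree F (r - 1) is at least r (F - 1) ≥ r (α + 1), which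
      -- exceeds `k`.
      ≤φ : ∀ {α k} → α + + 2 ≤ F → k < + r * α + + r → k ≤ + φ
      ≤φ {α} {k} small k< = subst (k ≤_) (sym φ≡) (by-≤ (gap< k< ⊕ 0≤+ 1 ⊕ 0≤+ r ⊗ gap small ⊕ gap F≤r)
        (((∀ F r α k → F * (r - + 1) ≡ k + (r * α + r - k - + 1 + + 1 + r * (F - (α + + 2)) +
          (r - F))) ∋ solve-∀) F (+ r) α k))

    claim : ∀ {k⁻ k⁺ u⁻ u⁺} (L⁻ : Located r ((+ ρ + + s) * + p - + q) u⁻ k⁻) (L⁺ : Located r (+ σ * + q) u⁺ k⁺) →
      C k⁻ ≡ - + B → C k⁺ ≡ + suc σ → Claim r k⁻ k⁺ (- + B) (+ suc σ) (suc σ)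
    claim {k⁻} {k⁺} L⁻ L⁺ C⁻ C⁺ = assemble (Ternary.Height.Extremes.conclusion pp qp rp p≢q (p≢r q<r)
        (ℕ.<⇒≢ q<r) Ex r̄ g inv p+q<pq p≡ (ℕ.m≤n⇒m≤1+n B≤σ) k⁻ k⁺
        (ℤ.≤-trans (0≤+ r ⊗ (Lattice.Kaplan.Eval.minus-nonneg p q r ρ σ 0<p 0<q
          (prime>0 rp) ρ<q σ<p ident r̄ g inv p+q<pq B s τ v p≡ ρ≡ τ<σ σp≤q B≤σ v≤B σ<B+v 1≤s M₀ rv≡-1))
          (Located.lower L⁻)) (≤φ (Lattice.Kaplan.Eval.minus-small p q r ρ σ 0<p 0<q
          (prime>0 rp) ρ<q σ<p ident r̄ g inv p+q<pq B s τ v p≡ ρ≡ τ<σ σp≤q B≤σ v≤B σ<B+v 1≤s M₀ rv≡-1)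
          (Located.upper L⁻))
        (ℤ.≤-trans (0≤+ r ⊗ (0≤+ σ ⊗ 0≤+ q)) (Located.lower L⁺)) (≤φ
          (Lattice.Kaplan.Eval.plus-small p q r ρ σ 0<p 0<q
          (prime>0 rp) ρ<q σ<p ident r̄ g inv p+q<pq B s τ v p≡ ρ≡ τ<σ σp≤q B≤σ v≤B σ<B+v 1≤s M₀ rv≡-1)
          (Located.upper L⁺)) C⁻ C⁺)
      where
      assemble : Ternary.Height.Extremes.Conclusion pp qp rp p≢q (p≢r q<r) (ℕ.<⇒≢ q<r) Ex r̄ g inv p+q<pq p≡
          (ℕ.m≤n⇒m≤1+n B≤σ) k⁻ k⁺ → Claim r k⁻ k⁺ (- + B) (+ suc σ) (suc σ)
      assemble (a⁻ , a⁺ , values , height) = a⁻ , a⁺ , values , (M-bound , r , rp , q<r , height) , 3m<2p 3l≤p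

    claim-forward : r̄ ≡ + s * + p - + q → ∀ {k⁻ k⁺} →
      Located r ((+ ρ + + s) * + p - + q) (- (+ B * + q) + ((+ p - + 1) * + s + + τ) * + p) k⁻ →
      Located r (+ σ * + q) (+ σ * + s * + p) k⁺ → Claim r k⁻ k⁺ (- + B) (+ suc σ) (suc σ)
    claim-forward r̄≡ {k⁻} {k⁺} L⁻ L⁺ = claim L⁻ L⁺
      (Lattice.Kaplan.Eval.C-minus-forward p q r ρ σ 0<p 0<q
        (prime>0 rp) ρ<q σ<p ident r̄ g inv p+q<pq B s τ v p≡ ρ≡ τ<σ σp≤q B≤σ v≤B σ<B+v 1≤s M₀ rv≡-1
        r̄≡ k⁻ (Located.t L⁻) (Located.lower L⁻) (Located.upper L⁻) (Located.k≡ L⁻))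
      (Lattice.Kaplan.Eval.C-plus-forward p q r ρ σ 0<p 0<q
        (prime>0 rp) ρ<q σ<p ident r̄ g inv p+q<pq B s τ v p≡ ρ≡ τ<σ σp≤q B≤σ v≤B σ<B+v 1≤s M₀ rv≡-1
        r̄≡ k⁺ (Located.t L⁺) (Located.lower L⁺) (Located.upper L⁺) (Located.k≡ L⁺))

    claim-backward : r̄ ≡ + q - + s * + p → ∀ {k⁻ k⁺} →
      Located r ((+ ρ + + s) * + p - + q) (+ σ * + q + + τ * + p) k⁻ →
      Located r (+ σ * + q) ((+ p - + 1) * + q - + B * + s * + p) k⁺ → Claim r k⁻ k⁺ (- + B) (+ suc σ) (suc σ)
    claim-backward r̄≡ {k⁻} {k⁺} L⁻ L⁺ = claim L⁻ L⁺
      (Lattice.Kaplan.Eval.C-minus-backward p q r ρ σ 0<p 0<q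
        (prime>0 rp) ρ<q σ<p ident r̄ g inv p+q<pq B s τ v p≡ ρ≡ τ<σ σp≤q B≤σ v≤B σ<B+v 1≤s M₀ rv≡-1
        r̄≡ k⁻ (Located.t L⁻) (Located.lower L⁻) (Located.upper L⁻) (Located.k≡ L⁻))
      (Lattice.Kaplan.Eval.C-plus-backward p q r ρ σ 0<p 0<q
        (prime>0 rp) ρ<q σ<p ident r̄ g inv p+q<pq B s τ v p≡ ρ≡ τ<σ σp≤q B≤σ v≤B σ<B+v 1≤s M₀ rv≡-1
        r̄≡ k⁺ (Located.t L⁺) (Located.lower L⁺) (Located.upper L⁺) (Located.k≡ L⁺))

  private
    ρ-τ : + ρ - + τ ≡ + σ * + s
    ρ-τ = by-≡ (+ 1) (trans (cong +_ ρ≡) (cong (_+ + τ) (ℤ.pos-* σ s)))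
      (((∀ ρ τ σ s → ρ - τ ≡ σ * s + (ρ - (σ * s + τ)) * + 1) ∋ solve-∀) (+ ρ) (+ τ) (+ σ) (+ s))

  α⁺ α⁻ u₁⁺ u₁⁻ u₂⁺ u₂⁻ lo hi : ℤ
  α⁺ = half ((+ p + + l) * + q)
  α⁻ = (+ ρ + + s) * + p - + q
  u₁⁺ = (+ ρ - + τ) * + p
  u₁⁻ = - half ((+ p - + l - + 2) * + q) + ((+ p - + 1) * + s + + τ) * + p
  u₂⁺ = (+ p - + 1) * + q - half ((+ p - + l - + 2) * + s * + p)
  u₂⁻ = half ((+ p + + l) * + q) + + τ * + p
  lo = - half (+ p - + l - + 2)
  hi = half (+ p + + l + + 2)

  m : ℕ
  m = (p ℕ.+ l ℕ.+ 2) ℕ./ 2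

  module Cases (r₁ : ℕ) (rp₁ : Prime r₁) (pq<r₁ : p ℕ.* q ℕ.< r₁)
    (r₁-inverse : + (p ℕ.* q) ∣ (+ r₁ * (+ q - + (s ℕ.* p)) + + 1))
    (w : ℕ) (w<p : w ℕ.< p) (w-mod : modℕ (w ℕ.* (l ℕ.+ 2)) p ≡ modℕ 2 p) where

    private
      c₁ : ∃ λ c → + r₁ * (+ q - + s * + p) + + 1 ≡ c * (+ p * + q)
      c₁ with ∣ᵤ⇒∣ r₁-inverse
      ... | divides c eq = c , trans (cong (λ x → + r₁ * (+ q - x) + + 1) (sym (ℤ.pos-* s p))) (trans eq (cong
          (c *_) (ℤ.pos-* p q)))

      c = proj₁ c₁
      c≡ = proj₂ c₁
      N = proj₁ (w≡q {w} w-mod)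
      N≡ = proj₂ (w≡q {w} w-mod)

      positive : ∀ s → + r₁ * (+ q - + s * + p) + + 1 ≡ c * (+ p * + q) → 1 ℕ.≤ s
      positive (suc s) _  = ℕ.s≤s ℕ.z≤n
      -- With s = 0 the congruence for r₁ would make `q` divide 1.
      positive zero    eq = contradiction (residue-unique (c * + p - + r₁) (prime>1 qp) 0<q
        (by-≡ (+ 1) eq (((∀ p q r c → + 1 - + 0 ≡ q * (c * p - r) + (r * (q - + 0 * p) + + 1 - c *
          (p * q)) * + 1) ∋ solve-∀) (+ p) (+ q) (+ r₁) c))) λ ()

      1≤s : 1 ℕ.≤ s
      1≤s = positive s c≡

      2w≤2B : ∀ {v} → 2 ℕ.* v ℕ.+ (l ℕ.+ 2) ℕ.≤ p → v ℕ.≤ B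
      2w≤2B {v} h = ℕ.*-cancelˡ-≤ 2 (ℕ.+-cancelʳ-≤ (l ℕ.+ 2) (2 ℕ.* v) (2 ℕ.* B) (subst (2 ℕ.* v ℕ.+ (l ℕ.+ 2) ℕ.≤_) p≡2B h))

    case₁ : l ℕ.+ 2 ℕ.≤ w → 2 ℕ.* w ℕ.+ l ℕ.+ 2 ℕ.≤ p →
      Claim r₁ (exponent r₁ α⁻ u₁⁻ (p ℕ.* q)) (exponent r₁ α⁺ u₁⁺ (p ℕ.* q)) lo hi m
    case₁ l+2≤w 2w≤ = Claim-resp {r₁} {exponent r₁ α⁻ u₁⁻ (p ℕ.* q)} {exponent r₁ α⁺ u₁⁺ (p ℕ.* q)}
        (cong -_ half-lo) half-hi m≡ (Case.claim-forward rp₁ pq<r₁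
        (+ s * + p - + q) (- c)
            (by-≡ (- + 1) c≡ (((∀ p q r s c → r * (s * p - q) ≡ + 1 + p * q * - c + (r * (q - s * p) + + 1 - c *
              (p * q)) * - + 1) ∋ solve-∀) (+ p) (+ q) (+ r₁) (+ s) c))
          -- Here `v` is `w` itself: `w ≡ q` modulo `p`, and the congruence for r₁ reduces to
          -- `r₁ q ≡ -1` modulo `p`.
          w (2w≤2B (subst (ℕ._≤ p) (ℕ.+-assoc (2 ℕ.* w) l 2) 2w≤)) l+2≤w (c * + q + + r₁ * + s + + r₁ * N)
          (by-≡ (+ 1) c≡ (by-≡ (+ r₁) N≡ (((∀ p q r s c w N → + 1 + r * w ≡ p * (c * q + r * s + r * N)
            + (r * (q - s * p) + + 1 - c * (p * q)) * + 1 + (w - q - p * N) * r) ∋ solve-∀) (+ p) (+ q) (+ r₁)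
              (+ s) c (+ w) N)))
          1≤s refl L⁻ L⁺)
      where
      L⁻ : Located r₁ ((+ ρ + + s) * + p - + q) (- (+ B * + q) + ((+ p - + 1) * + s + + τ) * + p)
          (exponent r₁ α⁻ u₁⁻ (p ℕ.* q))
      L⁻ = located r₁ pq<r₁ refl (cong (λ x → - x + ((+ p - + 1) * + s + + τ) * + p) half-u₁)
      L⁺ : Located r₁ (+ σ * + q) (+ σ * + s * + p) (exponent r₁ α⁺ u₁⁺ (p ℕ.* q))
      L⁺ = located r₁ pq<r₁ half-α (cong (_* + p) ρ-τ)

    case₂ : ∀ r₂ → Prime r₂ → p ℕ.* q ℕ.< r₂ → + (p ℕ.* q) ∣ (+ r₂ + + r₁) →
      p ℕ.+ l ℕ.+ 2 ℕ.≤ 2 ℕ.* w → w ℕ.+ l ℕ.+ 2 ℕ.≤ p →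
      Claim r₂ (exponent r₂ α⁻ u₂⁻ (p ℕ.* q)) (exponent r₂ α⁺ u₂⁺ (p ℕ.* q)) lo hi m
    case₂ r₂ rp₂ pq<r₂ r₂-opposite ≤2w w+l≤p = Claim-resp {r₂} {exponent r₂ α⁻ u₂⁻ (p ℕ.* q)} {exponent r₂ α⁺ u₂⁺
        (p ℕ.* q)} (cong -_ half-lo) half-hi m≡ (Case.claim-backward rp₂ pq<r₂
        (+ q - + s * + p) g₂ inverse
          v (2w≤2B 2v≤) l+2≤v (+ r₂ - + q * g₂ - + r₂ * + s - + r₂ * N)
          (by-≡ (- + 1) inverse (by-≡ (- + r₂) N≡ (by-≡ (+ r₂) v≡ (((∀ p q r s g v w N → + 1 + r * v ≡ p *
            (r - q * g - r * s - r * N)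
            + (r * (q - s * p) - (+ 1 + p * q * g)) * - + 1 + (w - q - p * N) * - r + (v -
              (p - w)) * r) ∋ solve-∀) (+ p) (+ q) (+ r₂) (+ s) g₂ (+ v) (+ w) N))))
          1≤s refl L⁻ L⁺)
      where
      c₂ : ∃ λ c → + r₂ + + r₁ ≡ c * (+ p * + q)
      c₂ with ∣ᵤ⇒∣ r₂-opposite
      ... | divides c eq = c , trans eq (cong (c *_) (ℤ.pos-* p q))
      d = proj₁ c₂
      v = p ℕ.∸ w
      v+w≡p : v ℕ.+ w ≡ p
      v+w≡p = ℕ.m∸n+n≡m (ℕ.<⇒≤ w<p)
      v≡ : + v ≡ + p - + w
      v≡ = by-≡ (+ 1) (cong +_ v+w≡p) (((∀ v w p → v ≡ p - w + (v + w - p) * + 1) ∋ solve-∀) (+ v) (+ w) (+ p))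
      2v≤ : 2 ℕ.* v ℕ.+ (l ℕ.+ 2) ℕ.≤ p
      2v≤ = ℕ.+-cancelʳ-≤ p (2 ℕ.* v ℕ.+ (l ℕ.+ 2)) p (ℕ.≤-trans
        (ℕ.≤-reflexive (((∀ v l p → 2 ℕ.* v ℕ.+ (l ℕ.+ 2) ℕ.+ p ≡ 2 ℕ.* v ℕ.+ (p ℕ.+ l ℕ.+ 2)) ∋ ℕ-solve-∀) v l p))
        (ℕ.≤-trans (ℕ.+-monoʳ-≤ (2 ℕ.* v) ≤2w) (ℕ.≤-reflexive (trans (((∀ v w → 2 ℕ.* v ℕ.+ 2 ℕ.* w ≡
          (v ℕ.+ w) ℕ.+ (v ℕ.+ w)) ∋ ℕ-solve-∀) v w)
          (cong₂ ℕ._+_ v+w≡p v+w≡p)))))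
      l+2≤v : l ℕ.+ 2 ℕ.≤ v
      l+2≤v = ℕ.+-cancelˡ-≤ w (l ℕ.+ 2) v (ℕ.≤-trans (ℕ.≤-reflexive (sym (ℕ.+-assoc w l 2)))
        (ℕ.≤-trans w+l≤p (ℕ.≤-reflexive (trans (sym v+w≡p) (ℕ.+-comm v w)))))
      inverse : + r₂ * (+ q - + s * + p) ≡ + 1 + + p * + q * (d * (+ q - + s * + p) - c)
      inverse = by-≡ (- + 1) c≡ (by-≡ (+ q - + s * + p) (proj₂ c₂)
        (((∀ p q r r′ s c d → r′ * (q - s * p) ≡ + 1 + p * q * (d * (q - s * p) - c)
          + (r * (q - s * p) + + 1 - c * (p * q)) * - + 1 + (r′ + r - d * (p * q)) * (q - s * p)) ∋ solve-∀) (+ p)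
            (+ q) (+ r₁) (+ r₂) (+ s) c d))
      g₂ = d * (+ q - + s * + p) - c
      L⁻ : Located r₂ ((+ ρ + + s) * + p - + q) (+ σ * + q + + τ * + p) (exponent r₂ α⁻ u₂⁻ (p ℕ.* q))
      L⁻ = located r₂ pq<r₂ refl (cong (_+ + τ * + p) half-α)
      L⁺ : Located r₂ (+ σ * + q) ((+ p - + 1) * + q - + B * + s * + p) (exponent r₂ α⁺ u₂⁺ (p ℕ.* q))
      L⁺ = located r₂ pq<r₂ half-α (cong (_-_ ((+ p - + 1) * + q)) half-u₂)

open import Defs
open import Data.Nat using (ℕ; _+_; _*_; _<_; _≤_; _%_; _/_)
open import Data.Nat.Primality using (Prime)
open import Data.Integer as ℤ using (ℤ; +_)
open import Data.Integer.Divisibility using (_∣_)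
open import Data.Product using (_×_; ∃)
open import Function.Bundles using (_⇔_)
open import Relation.Binary.PropositionalEquality using (_≡_)

theorem2 :
  (l p q : ℕ) → l % 2 ≡ 1 → 1 ≤ l →
  Prime p → Prime q → 2 < p → p < q →
  (p + l) * p ≤ 2 * q →
  modℕ ((l + 2) * q) p ≡ modℕ 2 p →
  (ρ σ : ℕ) → 1 + p * q ≡ (ρ + 1) * p + (σ + 1) * q →
  (s τ : ℕ) → 2 * ρ ≡ (p + l) * s + 2 * τ → 2 * τ < p + l →
  (r₁ r₂ : ℕ) → Prime r₁ → Prime r₂ → p * q < r₁ → p * q < r₂ →
  (+ (p * q)) ∣ ((+ r₁) ℤ.* ((+ q) ℤ.- (+ (s * p))) ℤ.+ (+ 1)) →
  (+ (p * q)) ∣ ((+ r₂) ℤ.+ (+ r₁)) →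
  (w : ℕ) → w < p → modℕ (w * (l + 2)) p ≡ modℕ 2 p →
  let
    P = + p
    Q = + q
    L = + l
    S = + s
    T = + τ
    R = + ρ
    PQ = p * q
    α⁺ = half ((P ℤ.+ L) ℤ.* Q)
    α⁻ = (R ℤ.+ S) ℤ.* P ℤ.- Q
    u₁⁺ = (R ℤ.- T) ℤ.* P
    u₁⁻ = ℤ.- half ((P ℤ.- L ℤ.- + 2) ℤ.* Q)
          ℤ.+ ((P ℤ.- + 1) ℤ.* S ℤ.+ T) ℤ.* P
    u₂⁺ = (P ℤ.- + 1) ℤ.* Q ℤ.- half ((P ℤ.- L ℤ.- + 2) ℤ.* S ℤ.* P)
    u₂⁻ = half ((P ℤ.+ L) ℤ.* Q) ℤ.+ T ℤ.* P
    t₁⁺ = fdiv ((α⁺ ℤ.- u₁⁺) ℤ.* + r₁) PQ ℤ.+ + 1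
    t₁⁻ = fdiv ((α⁻ ℤ.- u₁⁻) ℤ.* + r₁) PQ ℤ.+ + 1
    t₂⁺ = fdiv ((α⁺ ℤ.- u₂⁺) ℤ.* + r₂) PQ ℤ.+ + 1
    t₂⁻ = fdiv ((α⁻ ℤ.- u₂⁻) ℤ.* + r₂) PQ ℤ.+ + 1
    k₁⁺ = + r₁ ℤ.* u₁⁺ ℤ.+ t₁⁺ ℤ.* + PQ
    k₁⁻ = + r₁ ℤ.* u₁⁻ ℤ.+ t₁⁻ ℤ.* + PQ
    k₂⁺ = + r₂ ℤ.* u₂⁺ ℤ.+ t₂⁺ ℤ.* + PQ
    k₂⁻ = + r₂ ℤ.* u₂⁻ ℤ.+ t₂⁻ ℤ.* + PQ
    lo = ℤ.- half (P ℤ.- L ℤ.- + 2)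
    hi = half (P ℤ.+ L ℤ.+ + 2)
    m = (p + l + 2) / 2
  in
  ((l + 2 ≤ w × 2 * w + l + 2 ≤ p) →
     (a (PQ * r₁) k₁⁻ ≡ lo) × (a (PQ * r₁) k₁⁺ ≡ hi)
     × ((z : ℤ) → (∃ λ (k : ℕ) → a (PQ * r₁) (+ k) ≡ z) ⇔ (lo ℤ.≤ z × z ℤ.≤ hi))
     × MEquals p q m × 3 * m < 2 * p)
  ×
  ((p + l + 2 ≤ 2 * w × w + l + 2 ≤ p) →
     (a (PQ * r₂) k₂⁻ ≡ lo) × (a (PQ * r₂) k₂⁺ ≡ hi)
     × ((z : ℤ) → (∃ λ (k : ℕ) → a (PQ * r₂) (+ k) ≡ z) ⇔ (lo ℤ.≤ z × z ℤ.≤ hi))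
     × MEquals p q m × 3 * m < 2 * p)
theorem2 l p q l-odd _ pp qp 2<p p<q q-large q-mod ρ σ ρσ s τ 2ρ≡ 2τ< r₁ r₂ rp₁ rp₂ pq<r₁ pq<r₂ r₁-inverse r₂-opposite w w<p w-mod =
  (λ (l+2≤w , 2w≤) → Main.Cases.case₁ l p q l-odd pp qp 2<p p<q q-large q-mod ρ σ ρσ s τ 2ρ≡ 2τ<
    (ℕ.≤-<-trans l+2≤w w<p) r₁ rp₁ pq<r₁ r₁-inverse w w<p w-mod l+2≤w 2w≤) ,
  (λ (≤2w , w+l≤p) → Main.Cases.case₂ l p q l-odd pp qp 2<p p<q q-large q-mod ρ σ ρσ s τ 2ρ≡ 2τ<
    (l+2<p ≤2w w+l≤p) r₁ rp₁ pq<r₁ r₁-inverse w w<p w-mod r₂ rp₂ pq<r₂ r₂-opposite ≤2w w+l≤p)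
  where
  -- The residue `l + 2` must be reduced modulo `p` before it determines `σ`. The first case has it
  -- from `l + 2 ≤ w < p`; here it follows from w > 0.
  l+2<p : p + l + 2 ≤ 2 * w → w + l + 2 ≤ p → l + 2 < p
  l+2<p ≤2w w+l≤p = ℕ.≤-trans (ℕ.+-monoˡ-≤ (l + 2) (positive w ≤2w)) (ℕ.≤-trans (ℕ.≤-reflexive (sym (ℕ.+-assoc w l 2))) w+l≤p)
    where
    positive : ∀ w → p + l + 2 ≤ 2 * w → 0 < w
    positive (suc w) _ = ℕ.s≤s ℕ.z≤n
    positive zero    h = contradiction (ℕ.≤-trans (ℕ.m≤n+m 2 (p + l)) h) λ ()
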